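{- For every timed region graph $\widehat\Gamma$, Algorithm 2 terminates after finitely many iterations and returns a pair $(T,D)$ with $(T,D)\models\mathrm{Opt}_{\mathrm{MinMax}}(\widehat\Gamma)$, such that $T$ is regionally simple and $D$ is regionally constant.
   Context: Fix $k\in\mathbb N$. Let $C$ be a finite set of clocks. A clock valuation is a function $\nu:C\to[0,k]$; $V$ is the set of clock valuations. For $t\ge 0$ let $(\nu+t)(c)=\nu(c)+t$; for $C'\subseteq C$ let $\mathrm{Reset}(\nu,C')(c)=0$ if $c\in C'$ and $=\nu(c)$ otherwise. Simple clock constraints are $c\bowtie i$ or $c-c'\bowtie i$ with $c,c'\in C$, $i\in\{0,\dots,k\}$, ${\bowtie}\in\{<,>,=,\le,\ge\}$. A clock region is an equivalence class of $V$ under "satisfies the same simple clock constraints"; a clock zone is a convex union of clock regions. For a finite set $L$ of locations, a configuration is $s=(\ell,\nu)\in Q=L\times V$; write $s(c)=\nu(c)$ and $s+t=(\ell,\nu+t)$ (defined if $\nu+t\in V$). A region is $(\ell,P)$ (identified with $\{(\ell,\nu):\nu\in P\}$) for a clock region $P$; $[s]$ is the region containing $s$, $\mathcal R$ the set of regions, $\overline R$ the topological closure of $R$. A zone is a set $\{(\ell,\nu):\nu\in W_\ell\}$ with each $W_\ell$ a clock zone. A timed automaton $\mathcal T=(L,C,S,A,E,\delta,\rho,F)$ consists of finite $L$, finite $C$, a zone $S\subseteq Q$ of states, a finite set $A$ of actions, $E:A\to 2^S$ with every $E(a)$ a zone, $\delta:L\times A\to L$, $\rho:A\to 2^C$, and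 a zone $F\subseteq S$ of final states. For $s=(\ell,\nu)$: $s\to_t s'$ if $s'=s+t$ is defined and $s+t'\in S$ for all $t'\in[0,t]$; $s\xrightarrow{a}s'$ if $s'=(\delta(\ell,a),\mathrm{Reset}(\nu,\rho(a)))$, $s,s'\in S$ and $s\in E(a)$. For $(a,t)\in A\times\mathbb R_{\ge0}$, $\mathrm{Succ}(s,(a,t))=(\delta(\ell,a),\mathrm{Reset}(\nu+t,\rho(a)))$. A reachability-time game is $\Gamma=(\mathcal T,L_{\mathrm{Min}},L_{\mathrm{Max}})$ with $(L_{\mathrm{Min}},L_{\mathrm{Max}})$ a partition of $L$; $S_{\mathrm{Min}}$, $S_{\mathrm{Max}}$, $\mathcal R_{\mathrm{Min}}$, $\mathcal R_{\mathrm{Max}}$ are the states/regions with location in $L_{\mathrm{Min}}$ resp. $L_{\mathrm{Max}}$. Region relations: $R\to_*R'$ if there are $s\in R,s'\in R'$, $t\ge 0$ with $s\to_t s'$; $R\to_{+1}R'$ ($R'$ is the time successor of $R$) if $R\to_*R'$, $R\ne R'$, and $R\to_*R''\to_*R'$ implies $R''\in\{R,R'\}$; $R\xrightarrow aR'$ if there are $s\in R,s'\in R'$ with $s\xrightarrow a s'$. $R$ is thin if for all $s\in R$ and $\varepsilon>0$, $[s+\varepsilon]\neq[s]$. For thin $R''$, $b\in\{0,\dots,k\}$, $c\in C$: $R\to_{b,c}R''$ if $R\to_*R''$ and $s+(b-s(c))\in R''$ for all $s\in R$. Simple timed actions: $\mathcal A=A\times\{0,\dots,k\}\times C$; for $\alpha=(a,b,c)$,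 $t(s,\alpha)=b-s(c)$ if $s(c)\le b$ and $0$ otherwise, and $\mathrm{Succ}(s,\alpha)=\mathrm{Succ}(s,(a,t(s,\alpha)))$. For $F$ defined on $\overline{R'}$: $F^\oplus_\alpha(s)=t(s,\alpha)+F(\mathrm{Succ}(s,\alpha))$ and $F^\boxplus_\alpha(s)=1+F(\mathrm{Succ}(s,\alpha))$. Timed region graph $\widehat\Gamma=(\mathcal R,\mathcal M)$: $(R,\alpha,R')\in\mathcal M$ with $\alpha=(a,b,c)$ iff (i) $R\to_{b,c}R''\xrightarrow aR'$ for some $R''$; or (ii) $R\in\mathcal R_{\mathrm{Min}}$ and $R\to_{b,c}R''\to_{+1}R'''\xrightarrow aR'$ for some $R'',R'''$; or (iii) $R\in\mathcal R_{\mathrm{Max}}$ and $R\to_{b,c}R''$, $R'''\to_{+1}R''$, $R'''\xrightarrow aR'$ for some $R'',R'''$. (For $(R,\alpha,R')\in\mathcal M$ and $s\in R$, $\mathrm{Succ}(s,\alpha)\in\overline{R'}$.) Regional functions: maps $T$ assigning to each region $R$ a function $T(R):\overline R\to\mathbb R\cup\{\infty\}$ (resp. $D(R):\overline R\to\mathbb N\cup\{\infty\}$); $\widetilde T(s)=T([s])(s)$. $T$ is regionally simple (regionally constant) if each $T(R)$ is simple (constant), where $F:X\to\mathbb R$ is simple if $F\equiv e$ for some $e\in\mathbb Z$ or $F(s)=e-s(c)$ for some $e\in\mathbb Z$, $c\in C$. Lexicographic order: $(x,y)\le^{\mathrm{lex}}(x',y')$ iff $x<x'$, or $x=x'$ and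 $y\le y'$. Strategies and subgraphs: a positional strategy for Min in $\widehat\Gamma$ is a map $\mu:S_{\mathrm{Min}}\to\mathcal M$ with $\mu(s)$ of the form $([s],\alpha,R)$; $\Delta_{\mathrm{Min}}$ is the set of these. $\mu$ is regionally constant if $[s]=[s']$ implies $\mu(s)=\mu(s')$ (write $\mu(R)$); then the strategy subgraph $\widehat\Gamma\upharpoonright\mu$ keeps all moves out of $\mathcal R_{\mathrm{Max}}$ and, out of each $R\in\mathcal R_{\mathrm{Min}}$, only $\mu(R)$. For $s\in S$ let $M_*(s,(T,D))$ be the set of moves $m=([s],\alpha,R')\in\mathcal M$ at which $(T(R')^\oplus_\alpha(s),D(R')^\boxplus_\alpha(s))$ is lexicographically minimal. Fix a function $\mathrm{Choose}$ selecting an element of each nonempty set of moves. $\mathrm{Improve}_{\mathrm{Min}}(\mu,(T,D))(s)=\mu(s)$ if $\mu(s)\in M_*(s,(T,D))$, and $=\mathrm{Choose}(M_*(s,(T,D)))$ otherwise. Optimality equations for a graph $G=(\mathcal R,\mathcal M')$, $\mathcal M'\subseteq\mathcal M$: $(T,D)\models\mathrm{Opt}_{\mathrm{Max}}(G)$ iff $(\widetilde T(s),\widetilde D(s))=(0,0)$ for $s\in F$ and, for all $s\in S\setminus F$, $(\widetilde T(s),\widetilde D(s))=\max^{\mathrm{lex}}\{(T(R')^\oplus_\alpha(s),D(R')^\boxplus_\alpha(s)):([s],\alpha,R')\in\mathcal M'\}$. $(T,D)\models\mathrm{Opt}_{\mathrm{MinMax}}(G)$ iff for $s\in F$ the pair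 is $(0,0)$, for $s\in S_{\mathrm{Min}}\setminus F$ it equals the $\min^{\mathrm{lex}}$ of that set, and for $s\in S_{\mathrm{Max}}\setminus F$ it equals the $\max^{\mathrm{lex}}$ of that set. Algorithm 2 (input $\widehat\Gamma$): (1) choose a regionally constant $\mu_0\in\Delta_{\mathrm{Min}}$, set $i:=0$; (2) compute $(T_i,D_i)$ with $(T_i,D_i)\models\mathrm{Opt}_{\mathrm{Max}}(\widehat\Gamma\upharpoonright\mu_i)$ (a solution with $T_i$ regionally simple and $D_i$ regionally constant, as produced by Max strategy improvement on the 1-player graph $\widehat\Gamma\upharpoonright\mu_i$); (3) if $\mathrm{Improve}_{\mathrm{Min}}(\mu_i,(T_i,D_i))=\mu_i$ return $(T_i,D_i)$; otherwise set $\mu_{i+1}:=\mathrm{Improve}_{\mathrm{Min}}(\mu_i,(T_i,D_i))$, $i:=i+1$, and go to (2).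
   Formalization: Assumes every Min state, and every Max state outside F, has a move (else no strategy exists or a maximum is over the empty set), and step (2) takes solutions with T infinite wherever D is infinite; with arbitrary solutions, zero-time cycles allow the loop to run forever. -}

module Defs where

open import Level using (0ℓ)
open import Algebra.Bundles using (CommutativeRing)
import Algebra.Definitions.RawMonoid as RawMonoidMultiples
open import Axiom.ExcludedMiddle using (ExcludedMiddle)
open import Data.Bool.Base using (Bool; true; false; if_then_else_)
open import Data.Fin.Base as Fin using (Fin; toℕ)
open import Data.Integer.Base using (ℤ; +_; -[1+_])
open import Data.List.Base as List using (List; []; _∷_; allFin; cartesianProduct)
open import Data.List.Membership.Propositional using (_∈_)
open import Data.List.Membership.Propositional.Properties
  using (∈-allFin; ∈-cartesianProduct⁺; ∈-map⁺; ∈-++⁺ˡ; ∈-++⁺ʳ)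
open import Data.List.Properties using (map-cong)
open import Data.List.Relation.Unary.Any using (here; there)
open import Data.Nat.Base as ℕ using (ℕ; zero; suc)
open import Data.Product.Base using (∃; ∃₂; _×_; _,_; proj₁; proj₂)
open import Data.Product.Relation.Binary.Lex.Strict using (×-Lex)
open import Data.Product.Relation.Binary.Pointwise.NonDependent using (Pointwise)
open import Data.Sum.Base using (_⊎_; inj₁; inj₂)
open import Function.Bundles using (_⇔_; mk⇔)
open import Relation.Binary.Core using (Rel)
open import Relation.Binary.PropositionalEquality using (_≡_; _≢_; refl; sym; cong)
open import Relation.Binary.Structures using (IsStrictTotalOrder)
import Relation.Binary.Construct.Add.Supremum.Equality as SupEquality
import Relation.Binary.Construct.Add.Supremum.NonStrict as SupNonStrict
import Relation.Binary.Construct.Add.Supremum.Strict as SupStrict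
open import Relation.Nullary using (¬_; Dec; yes; no; does)
open import Relation.Nullary.Construct.Add.Supremum using (_⁺; [_]; ⊤⁺)
open import Relation.Nullary.Decidable using (_⊎-dec_; does-⇔)
open import Relation.Unary using (Pred; Satisfiable; _≐_)

------------------------------------------------------------------------
-- Real numbers

-- The standard library has no classical real numbers.  ℝ is therefore
-- axiomatised as a Dedekind-complete ordered field, which determines it
-- up to isomorphism (given excluded middle), and every development below
-- is relative to an arbitrary such structure.
record RealNumbers : Set₁ where
  infix 4 _<_
  field
    commutativeRing : CommutativeRing 0ℓ 0ℓ

  open CommutativeRing commutativeRing public
    using (Carrier; _≈_; _+_; _*_; -_; _-_; 0#; 1#; +-rawMonoid)

  field
    _<_                : Rel Carrier 0ℓ
    isStrictTotalOrder : IsStrictTotalOrder _≈_ _<_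
    0<1                : 0# < 1#
    +-monoˡ-<          : ∀ z {x y} → x < y → x + z < y + z
    *-pos              : ∀ {x y} → 0# < x → 0# < y → 0# < x * y
    inverse            : ∀ x → ¬ (x ≈ 0#) → ∃ λ y → x * y ≈ 1#

  infix 4 _≤_
  _≤_ : Rel Carrier 0ℓ
  x ≤ y = x < y ⊎ x ≈ y

  IsUpperBound : Pred Carrier 0ℓ → Pred Carrier 0ℓ
  IsUpperBound P b = ∀ x → P x → x ≤ b

  field
    supremum : ∀ (P : Pred Carrier 0ℓ) → Satisfiable P → Satisfiable (IsUpperBound P) →
               ∃ λ u → IsUpperBound P u × (∀ b → IsUpperBound P b → u ≤ b)

  open IsStrictTotalOrder isStrictTotalOrder public
    using (compare; _<?_; _≟_)

  infix 4 _≤?_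
  _≤?_ : ∀ x y → Dec (x ≤ y)
  x ≤? y = (x <? y) ⊎-dec (x ≟ y)

  fromℕ : ℕ → Carrier
  fromℕ n = RawMonoidMultiples._×_ +-rawMonoid n 1#

  fromℤ : ℤ → Carrier
  fromℤ (+ n)    = fromℕ n
  fromℤ -[1+ n ] = - fromℕ (suc n)

------------------------------------------------------------------------
-- Clock valuations and clock regions, for nC clocks bounded by k

module Clocks (ℝ : RealNumbers) (k nC : ℕ) where
  open RealNumbers ℝ

  Clock : Set
  Clock = Fin nC

  RawValuation : Set
  RawValuation = Clock → Carrier

  record Valuation : Set where
    constructor valuation
    field
      at      : RawValuation
      bounded : ∀ c → 0# ≤ at c × at c ≤ fromℕ k
  open Valuation public

  data Comparison : Set where
    lt gt eq le ge : Comparison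

  data Term : Set where
    clock      : Clock → Term
    difference : Clock × Clock → Term

  Constraint : Set
  Constraint = Term × Comparison × Fin (suc k)

  evalTerm : RawValuation → Term → Carrier
  evalTerm ν (clock c)             = ν c
  evalTerm ν (difference (c , c′)) = ν c - ν c′

  compareWith : Comparison → Rel Carrier 0ℓ
  compareWith lt x y = x < y
  compareWith gt x y = y < x
  compareWith eq x y = x ≈ y
  compareWith le x y = x ≤ y
  compareWith ge x y = y ≤ x

  compareWith? : ∀ ⋈ x y → Dec (compareWith ⋈ x y)
  compareWith? lt x y = x <? y
  compareWith? gt x y = y <? x
  compareWith? eq x y = x ≟ y
  compareWith? le x y = x ≤? y
  compareWith? ge x y = y ≤? x

  infix 4 _⊨_ _⊨?_
  _⊨_ : RawValuation → Constraint → Set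
  ν ⊨ (x , ⋈ , i) = compareWith ⋈ (evalTerm ν x) (fromℕ (toℕ i))

  _⊨?_ : ∀ ν g → Dec (ν ⊨ g)
  ν ⊨? (x , ⋈ , i) = compareWith? ⋈ (evalTerm ν x) (fromℕ (toℕ i))

  allTerms : List Term
  allTerms = List.map clock (allFin nC) List.++
             List.map difference (cartesianProduct (allFin nC) (allFin nC))

  allComparisons : List Comparison
  allComparisons = lt ∷ gt ∷ eq ∷ le ∷ ge ∷ []

  allConstraints : List Constraint
  allConstraints =
    cartesianProduct allTerms (cartesianProduct allComparisons (allFin (suc k)))

  signature : RawValuation → List Bool
  signature ν = List.map (λ g → does (ν ⊨? g)) allConstraints

  -- The equivalence classes of "satisfies the same simple constraints" are
  -- represented by the truth tables of the constraints that are realised by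
  -- some valuation, so that equality of clock regions is _≡_ and there are
  -- finitely many of them (see clockRegion-≡ below).
  record ClockRegion : Set where
    constructor mkClockRegion
    field
      table     : List Bool
      .realised : ∃ λ (ν : Valuation) → signature (at ν) ≡ table

  clockRegion : Valuation → ClockRegion
  clockRegion ν = mkClockRegion (signature (at ν)) (ν , refl)

  ∈-allConstraints : ∀ g → g ∈ allConstraints
  ∈-allConstraints (x , ⋈ , i) =
    ∈-cartesianProduct⁺ (term x) (∈-cartesianProduct⁺ (comparison ⋈) (∈-allFin i))
    where
    term : ∀ x → x ∈ allTerms
    term (clock c)             = ∈-++⁺ˡ (∈-map⁺ clock (∈-allFin c))
    term (difference (c , c′)) =
      ∈-++⁺ʳ (List.map clock (allFin nC))
        (∈-map⁺ difference (∈-cartesianProduct⁺ (∈-allFin c) (∈-allFin c′)))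

    comparison : ∀ ⋈ → ⋈ ∈ allComparisons
    comparison lt = here refl
    comparison gt = there (here refl)
    comparison eq = there (there (here refl))
    comparison le = there (there (there (here refl)))
    comparison ge = there (there (there (there (here refl))))

  clockRegion-≡ : ∀ ν ν′ →
    clockRegion ν ≡ clockRegion ν′ ⇔ (∀ g → at ν ⊨ g ⇔ at ν′ ⊨ g)
  clockRegion-≡ ν ν′ = mk⇔
    (λ p g → agree g (pointwise allConstraints (cong ClockRegion.table p) (∈-allConstraints g)))
    (λ h → equal (map-cong (λ g → does-⇔ (h g) (at ν ⊨? g) (at ν′ ⊨? g)) allConstraints))
    where
    pointwise : ∀ {f f′ : Constraint → Bool} gs {g} →
                List.map f gs ≡ List.map f′ gs → g ∈ gs → f g ≡ f′ g
    pointwise (_ ∷ _)  p (here refl) = ∷-head p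
      where
      ∷-head : ∀ {x y : Bool} {xs ys} → x ∷ xs ≡ y ∷ ys → x ≡ y
      ∷-head refl = refl
    pointwise (_ ∷ gs) p (there g∈) = pointwise gs (∷-tail p) g∈
      where
      ∷-tail : ∀ {x y : Bool} {xs ys} → x ∷ xs ≡ y ∷ ys → xs ≡ ys
      ∷-tail refl = refl

    transfer : ∀ {P Q : Set} (P? : Dec P) (Q? : Dec Q) → does P? ≡ does Q? → P → Q
    transfer _        (yes q) _  _ = q
    transfer (yes _)  (no _)  () _
    transfer (no ¬p)  (no _)  _  p with () ← ¬p p

    agree : ∀ g → does (at ν ⊨? g) ≡ does (at ν′ ⊨? g) → at ν ⊨ g ⇔ at ν′ ⊨ g
    agree g p = mk⇔ (transfer (at ν ⊨? g) (at ν′ ⊨? g) p)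
                    (transfer (at ν′ ⊨? g) (at ν ⊨? g) (sym p))

    equal : signature (at ν) ≡ signature (at ν′) → clockRegion ν ≡ clockRegion ν′
    equal = lemma
      where
      lemma : ∀ {t t′} .{r : ∃ λ μ → signature (at μ) ≡ t} .{r′ : ∃ λ μ → signature (at μ) ≡ t′} →
              t ≡ t′ → mkClockRegion t r ≡ mkClockRegion t′ r′
      lemma refl = refl

  -- A set 𝒫 of clock regions is the clock zone ⋃ 𝒫 when that union is convex.
  IsClockZone : Pred ClockRegion 0ℓ → Set
  IsClockZone 𝒫 = ∀ ν ν′ ν″ l → 𝒫 (clockRegion ν) → 𝒫 (clockRegion ν′) →
    0# ≤ l → l ≤ 1# →
    (∀ c → at ν″ c ≈ l * at ν c + (1# - l) * at ν′ c) →
    𝒫 (clockRegion ν″)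

------------------------------------------------------------------------
-- Configurations, regions and zones

module Configurations (ℝ : RealNumbers) (k nL nC : ℕ) where
  open Clocks ℝ k nC public

  Location : Set
  Location = Fin nL

  Region : Set
  Region = Location × ClockRegion

  Config : Set
  Config = Location × Valuation

  region : Config → Region
  region (ℓ , ν) = ℓ , clockRegion ν

  record Zone : Set₁ where
    field
      regions : Location → Pred ClockRegion 0ℓ
      isZone  : ∀ ℓ → IsClockZone (regions ℓ)

  infix 4 _∈ᶻ_
  _∈ᶻ_ : Config → Zone → Set
  (ℓ , ν) ∈ᶻ Z = Zone.regions Z ℓ (clockRegion ν)

------------------------------------------------------------------------
-- Timed automata and reachability-time games

data Player : Set where
  Min Max : Player

module _ (ℝ : RealNumbers) (k : ℕ) where

  -- The finite sets of locations, clocks and actions are Fin nL, Fin nC, Fin nA.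
  record TimedAutomaton : Set₁ where
    field
      nL nC nA : ℕ

    open Configurations ℝ k nL nC public

    Action : Set
    Action = Fin nA

    field
      S   : Zone
      E   : Action → Zone
      E⊆S : ∀ a s → s ∈ᶻ E a → s ∈ᶻ S
      δ   : Location → Action → Location
      ρ   : Action → Clock → Bool
      F   : Zone
      F⊆S : ∀ s → s ∈ᶻ F → s ∈ᶻ S

  record ReachabilityTimeGame : Set₁ where
    field
      automaton : TimedAutomaton

    open TimedAutomaton automaton public

    field
      owner : Location → Player

------------------------------------------------------------------------
-- The timed region graph, regional functions and optimality equations

module TimedRegionGraph (ℝ : RealNumbers) (k : ℕ) (Γ : ReachabilityTimeGame ℝ k) where
  open RealNumbers ℝ
  open ReachabilityTimeGame Γ

  -- Elements of L × ℝ^C.  Closures of regions are sets of points, and so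
  -- regional functions are functions of points; only their values on the
  -- closures of regions are ever meaningful.
  Point : Set
  Point = Location × RawValuation

  point : Config → Point
  point (ℓ , ν) = ℓ , at ν

  _∈F _∈S : Config → Set
  s ∈F = s ∈ᶻ F
  s ∈S = s ∈ᶻ S

  ownerOf : Config → Player
  ownerOf (ℓ , _) = owner ℓ

  ownerOfRegion : Region → Player
  ownerOfRegion (ℓ , _) = owner ℓ

  reset : (Clock → Bool) → RawValuation → RawValuation
  reset C′ ν c = if C′ c then 0# else ν c

  -- s′ is s + t; in particular s + t is defined, i.e. lies in L × V.
  Delay : Config → Carrier → Config → Set
  Delay (ℓ , ν) t (ℓ′ , ν′) = ℓ′ ≡ ℓ × (∀ c → at ν′ c ≈ at ν c + t)

  TimeStep : Config → Carrier → Config → Set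
  TimeStep s t s′ = 0# ≤ t × Delay s t s′ ×
    (∀ t′ → 0# ≤ t′ → t′ ≤ t → ∃ λ u → Delay s t′ u × u ∈S)

  ActionStep : Config → Action → Config → Set
  ActionStep s@(ℓ , ν) a s′@(ℓ′ , ν′) =
    (ℓ′ ≡ δ ℓ a × (∀ c → at ν′ c ≈ reset (ρ a) (at ν) c)) × s ∈S × s′ ∈S × s ∈ᶻ E a

  infix 4 _→*_ _→₊₁_
  _→*_ : Rel Region 0ℓ
  R →* R′ = ∃₂ λ s s′ → region s ≡ R × region s′ ≡ R′ × ∃ λ t → TimeStep s t s′

  _→₊₁_ : Rel Region 0ℓ
  R →₊₁ R′ = R →* R′ × R ≢ R′ × (∀ R″ → R →* R″ → R″ →* R′ → R″ ≡ R ⊎ R″ ≡ R′)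

  RegionAction : Region → Action → Region → Set
  RegionAction R a R′ = ∃₂ λ s s′ → region s ≡ R × region s′ ≡ R′ × ActionStep s a s′

  -- Delaying out of V also leaves [s], hence only defined s + ε are constrained.
  Thin : Pred Region 0ℓ
  Thin R = ∀ s ε u → region s ≡ R → 0# < ε → Delay s ε u → region u ≢ region s

  Bound : Set
  Bound = Fin (suc k)

  bound : Bound → Carrier
  bound b = fromℕ (toℕ b)

  BoundaryStep : Region → Bound → Clock → Region → Set
  BoundaryStep R b c R″ = Thin R″ × R →* R″ ×
    (∀ s → region s ≡ R → ∃ λ u → Delay s (bound b - at (proj₂ s) c) u × region u ≡ R″)

  SimpleTimedAction : Set
  SimpleTimedAction = Action × Bound × Clock

  delay : Config → SimpleTimedAction → Carrier
  delay (_ , ν) (_ , b , c) with at ν c ≤? bound b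
  ... | yes _ = bound b - at ν c
  ... | no  _ = 0#

  Succ : Config → SimpleTimedAction → Point
  Succ s@(ℓ , ν) α@(a , _ , _) = δ ℓ a , reset (ρ a) (λ c → at ν c + delay s α)

  Move : Set
  Move = Region × SimpleTimedAction × Region

  source : Move → Region
  source (R , _ , _) = R

  data 𝓜 : Pred Move 0ℓ where
    boundary : ∀ {R a b c R″ R′} →
      BoundaryStep R b c R″ → RegionAction R″ a R′ →
      𝓜 (R , (a , b , c) , R′)
    after : ∀ {R a b c R″ R‴ R′} → ownerOfRegion R ≡ Min →
      BoundaryStep R b c R″ → R″ →₊₁ R‴ → RegionAction R‴ a R′ →
      𝓜 (R , (a , b , c) , R′)
    before : ∀ {R a b c R″ R‴ R′} → ownerOfRegion R ≡ Max →
      BoundaryStep R b c R″ → R‴ →₊₁ R″ → RegionAction R‴ a R′ →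
      𝓜 (R , (a , b , c) , R′)

  -- ℝ ∪ {∞} and ℕ ∪ {∞}, with ⊤⁺ as ∞.
  ℝ∞ ℕ∞ : Set
  ℝ∞ = Carrier ⁺
  ℕ∞ = ℕ ⁺

  open SupEquality _≈_ using (_≈⁺_)
  open SupStrict _<_ using (_<⁺_)
  open SupNonStrict ℕ._≤_ using (_≤⁺_)

  infix 4 _≈ˡᵉˣ_ _≤ˡᵉˣ_
  _≈ˡᵉˣ_ _≤ˡᵉˣ_ : Rel (ℝ∞ × ℕ∞) 0ℓ
  _≈ˡᵉˣ_ = Pointwise _≈⁺_ _≡_
  _≤ˡᵉˣ_ = ×-Lex _≈⁺_ _<⁺_ _≤⁺_

  addTime : Carrier → ℝ∞ → ℝ∞
  addTime t [ x ] = [ t + x ]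
  addTime t ⊤⁺    = ⊤⁺

  addStep : ℕ∞ → ℕ∞
  addStep [ n ] = [ suc n ]
  addStep ⊤⁺    = ⊤⁺

  closure : Region → Pred Point 0ℓ
  closure R (ℓ , x) = ∀ ε → 0# < ε → ∃ λ s → region s ≡ R × proj₁ s ≡ ℓ ×
    (∀ c → x c - ε < at (proj₂ s) c × at (proj₂ s) c < x c + ε)

  TimeFunction StepFunction : Set
  TimeFunction = Region → Point → ℝ∞
  StepFunction = Region → Point → ℕ∞

  SimpleOn : Pred Point 0ℓ → (Point → ℝ∞) → Set
  SimpleOn X f =
    (∃ λ e → ∀ p → X p → f p ≈⁺ [ fromℤ e ]) ⊎
    (∃₂ λ e c → ∀ p → X p → f p ≈⁺ [ fromℤ e - proj₂ p c ])

  -- Simple functions are real valued; on regions from which F cannot be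
  -- enforced a regional function is identically ∞, which is admitted too.
  RegionallySimple : Pred TimeFunction 0ℓ
  RegionallySimple T = ∀ R → SimpleOn (closure R) (T R) ⊎ (∀ p → closure R p → T R p ≡ ⊤⁺)

  RegionallyConstant : Pred StepFunction 0ℓ
  RegionallyConstant D = ∀ R → ∃ λ d → ∀ p → closure R p → D R p ≡ d

  module _ (T : TimeFunction) (D : StepFunction) where

    valueAt : Config → ℝ∞ × ℕ∞
    valueAt s = T (region s) (point s) , D (region s) (point s)

    -- (T(R′)⊕_α(s) , D(R′)⊞_α(s)) for the move (R , α , R′)
    moveValue : Config → Move → ℝ∞ × ℕ∞
    moveValue s (_ , α , R′) = addTime (delay s α) (T R′ (Succ s α)) , addStep (D R′ (Succ s α))

    MovesFrom : Pred Move 0ℓ → Config → Pred Move 0ℓ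
    MovesFrom G s m = G m × source m ≡ region s

    IsMaxFrom IsMinFrom : Pred Move 0ℓ → Config → Set
    IsMaxFrom G s =
      (∃ λ m → MovesFrom G s m × valueAt s ≈ˡᵉˣ moveValue s m) ×
      (∀ m → MovesFrom G s m → moveValue s m ≤ˡᵉˣ valueAt s)
    IsMinFrom G s =
      (∃ λ m → MovesFrom G s m × valueAt s ≈ˡᵉˣ moveValue s m) ×
      (∀ m → MovesFrom G s m → valueAt s ≤ˡᵉˣ moveValue s m)

    OptMax : Pred Move 0ℓ → Set
    OptMax G =
      (∀ s → s ∈F → valueAt s ≈ˡᵉˣ ([ 0# ] , [ 0 ])) ×
      (∀ s → s ∈S → ¬ s ∈F → IsMaxFrom G s)

    OptMinMax : Pred Move 0ℓ → Set
    OptMinMax G =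
      (∀ s → s ∈F → valueAt s ≈ˡᵉˣ ([ 0# ] , [ 0 ])) ×
      (∀ s → s ∈S → ¬ s ∈F → ownerOf s ≡ Min → IsMinFrom G s) ×
      (∀ s → s ∈S → ¬ s ∈F → ownerOf s ≡ Max → IsMaxFrom G s)

    -- M_*(s,(T,D))
    BestMoves : Config → Pred Move 0ℓ
    BestMoves s m = MovesFrom 𝓜 s m ×
      (∀ m′ → MovesFrom 𝓜 s m′ → moveValue s m ≤ˡᵉˣ moveValue s m′)

  -- No positional strategy of Min exists unless Min always has a move, and
  -- Opt_Max involves the maximum of an empty set, hence has no solution,
  -- unless Max always has a move outside F.
  NonBlocking : Set
  NonBlocking =
    (∀ s → s ∈S → ownerOf s ≡ Min → ∃ λ m → 𝓜 m × source m ≡ region s) ×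
    (∀ s → s ∈S → ¬ s ∈F → ownerOf s ≡ Max → ∃ λ m → 𝓜 m × source m ≡ region s)

  -- The function Choose: as a function of the set of moves, it cannot
  -- distinguish extensionally equal predicates.
  record Choice : Set₁ where
    field
      choose      : ∀ (P : Pred Move 0ℓ) → Satisfiable P → Move
      choose-∈    : ∀ (P : Pred Move 0ℓ) (p : Satisfiable P) → P (choose P p)
      choose-cong : ∀ (P Q : Pred Move 0ℓ) (p : Satisfiable P) (q : Satisfiable Q) →
                    P ≐ Q → choose P p ≡ choose Q q

  record MinState : Set where
    constructor minState
    field
      config  : Config
      isState : config ∈S
      isMin   : ownerOf config ≡ Min
  open MinState public

  Assignment : Set
  Assignment = MinState → Move

  -- Membership in Δ_Min
  IsStrategy : Pred Assignment 0ℓ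
  IsStrategy μ = ∀ s → 𝓜 (μ s) × source (μ s) ≡ region (config s)

  IsRegionallyConstant : Pred Assignment 0ℓ
  IsRegionallyConstant μ = ∀ s s′ → region (config s) ≡ region (config s′) → μ s ≡ μ s′

  -- The moves of Γ̂↾μ, for regionally constant μ
  _↾_ : Pred Move 0ℓ → Assignment → Pred Move 0ℓ
  (G ↾ μ) m = G m × (ownerOfRegion (source m) ≡ Max ⊎
    ∃ λ s → region (config s) ≡ source m × μ s ≡ m)

------------------------------------------------------------------------
-- Min strategy improvement on the timed region graph

module StrategyImprovement
  (em : ExcludedMiddle 0ℓ) (ℝ : RealNumbers) (k : ℕ) (Γ : ReachabilityTimeGame ℝ k)
  (Choose : TimedRegionGraph.Choice ℝ k Γ) where

  open RealNumbers ℝ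
  open ReachabilityTimeGame Γ
  open TimedRegionGraph ℝ k Γ
  open Choice Choose

  -- When the set P is empty Choose is undefined and the current move is
  -- kept; M_* is nonempty at every state of Min at which Min has a move.
  keepOrChoose : (P : Pred Move 0ℓ) (m : Move) → Dec (P m) → Dec (Satisfiable P) → Move
  keepOrChoose P m (yes _) _       = m
  keepOrChoose P m (no _)  (yes p) = choose P p
  keepOrChoose P m (no _)  (no _)  = m

  Improve : Assignment → TimeFunction → StepFunction → Assignment
  Improve μ T D s = keepOrChoose M⋆ (μ s) em em
    where M⋆ = BestMoves T D (config s)

  IsFixed : Assignment → TimeFunction → StepFunction → Set
  IsFixed μ T D = ∀ s → Improve μ T D s ≡ μ s

  -- The possible results (T,D) of evaluating μ.  The last condition selects the
  -- solution produced by Max strategy improvement, in which plays that never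
  -- reach F have value (∞,∞): the equations alone also admit solutions with
  -- D ≡ ∞ and T an arbitrary constant along a cycle that takes no time, and
  -- with such solutions the iteration need not terminate.
  record Evaluation (μ : Assignment) (T : TimeFunction) (D : StepFunction) : Set where
    field
      optimal  : OptMax T D (𝓜 ↾ μ)
      simple   : RegionallySimple T
      constant : RegionallyConstant D
      infinite : ∀ s → s ∈S → proj₂ (valueAt T D s) ≡ ⊤⁺ → proj₁ (valueAt T D s) ≡ ⊤⁺

  -- Every execution of the loop starting with the strategy μ is finite, and
  -- each of its iterations can be carried out: the current strategy is a
  -- regionally constant element of Δ_Min, so that Γ̂↾μ is defined, and its
  -- evaluation has a result.
  data Terminates (μ : Assignment) : Set where
    terminates :
      IsStrategy μ → IsRegionallyConstant μ →
      ∃₂ (Evaluation μ) →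
      (∀ T D → Evaluation μ T D → ¬ IsFixed μ T D → Terminates (Improve μ T D)) →
      Terminates μ

  -- Some execution of the loop starting with the strategy μ returns (T,D).
  data Returns (μ : Assignment) (T : TimeFunction) (D : StepFunction) : Set where
    return  : Evaluation μ T D → IsFixed μ T D → Returns μ T D
    iterate : ∀ {T′ D′} → Evaluation μ T′ D′ → ¬ IsFixed μ T′ D′ →
              Returns (Improve μ T′ D′) T D → Returns μ T D

{-# OPTIONS --safe #-}
-- Simple functions compare uniformly on a region, so a value that is simple on every region is a
-- finite symbolic object, and so is the set of best moves.  Against a fixed strategy of Min the
-- game is solved by backward induction over the regions from which Max cannot avoid F, with ∞
-- elsewhere.  After an improvement of the strategy the old value is still an upper bound along
-- every remaining move.  Such a bound cannot strictly decrease around a cycle of moves, since a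
-- clock grows at most by the elapsed time, and when it stays constant the step count decreases;
-- hence moves between regions with a finite bound are well-founded, and by induction along them
-- the new solution lies below the bound.  There are finitely many strategies, so the values are
-- eventually equal, and then the strategy is fixed after one more improvement.
module Submission where

open import Defs
open import Level using (0ℓ)
open import Algebra.Bundles using (CommutativeRing)
import Algebra.Properties.Monoid.Mult as MonoidMultiples
import Algebra.Properties.Ring as RingProperties
import Algebra.Properties.Semiring.Mult as SemiringMultiples
import Algebra.Solver.Ring as RingSolver
open import Algebra.Solver.Ring.AlmostCommutativeRing
  using (AlmostCommutativeRing; fromCommutativeRing; _-Raw-AlmostCommutative⟶_)
open import Axiom.ExcludedMiddle using (ExcludedMiddle)
open import Data.Bool.Base using (Bool; true; false; if_then_else_)
open import Data.Empty using (⊥; ⊥-elim-irr)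
open import Data.Fin.Base as Fin using (Fin; toℕ; fromℕ<; funToFin; finToFun)
open import Data.Fin.Induction using (spo-wellFounded)
open import Data.Fin.Properties using (toℕ-fromℕ; toℕ-fromℕ<; finToFun-funToFin; suc-injective)
open import Data.Integer.Base as ℤ using (ℤ; +_; -[1+_]; _⊖_; _◃_)
import Data.Integer.Properties as ℤ
open import Data.List.Base as List using (List; []; _∷_; allFin; cartesianProduct; length; lookup)
open import Data.List.Membership.Propositional using (_∈_)
open import Data.List.Membership.Propositional.Properties
  using (∈-allFin; ∈-cartesianProduct⁺; ∈-map⁺; ∈-++⁺ˡ; ∈-++⁺ʳ)
open import Data.List.Properties using (length-map)
open import Data.List.Relation.Unary.Any using (here; there; index)
open import Data.List.Relation.Unary.Any.Properties using (lookup-index)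
open import Data.Maybe.Base using (Maybe; just; nothing)
open import Data.Nat.Base as ℕ using (ℕ; zero; suc; _^_; z≤n; s≤s)
import Data.Nat.Properties as ℕ
open import Data.Product.Base using (∃; ∃₂; _×_; _,_; proj₁; proj₂)
import Data.Sign.Base as Sign
open import Data.Sum.Base as Sum using (_⊎_; inj₁; inj₂)
open import Data.Unit.Base using (⊤; tt)
open import Function.Base using (_∘_; id)
open import Function.Bundles using (mk⇔; Equivalence)
open import Induction.WellFounded using (WellFounded; Acc; acc; module Subrelation)
import Relation.Binary.Construct.Add.Supremum.Equality as SupEquality
import Relation.Binary.Construct.Add.Supremum.NonStrict as SupNonStrict
import Relation.Binary.Construct.Add.Supremum.Strict as SupStrict
open import Relation.Binary.Construct.Closure.ReflexiveTransitive as Star using (Star; _◅_; _◅◅_)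
open import Relation.Binary.Core using (Rel)
open import Relation.Binary.Definitions using (Transitive; tri<; tri≈; tri>)
open import Relation.Binary.PropositionalEquality as ≡ using (_≡_; _≢_; cong; subst)
import Relation.Binary.Reasoning.Setoid as SetoidReasoning
open import Relation.Binary.Structures using (IsStrictPartialOrder; IsStrictTotalOrder)
open import Relation.Nullary using (¬_; Dec; yes; no; contradiction)
open import Relation.Nullary.Construct.Add.Supremum using ([_]; ⊤⁺)
open import Relation.Unary using (Pred; _⊆_; _≐_; Satisfiable)

-- Ordered fields

-- The obstacle that shapes the proof is that a move lands only in the closure of its target region:
-- the delay ends exactly on a boundary region, whereas the action may be enabled just after or just
-- before it. Weak inequalities between simple functions persist on a closure, strict ones may
-- collapse there, so lexicographic comparisons do not travel along moves. For this reason times are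
-- compared on all regions before steps are considered at all, and a strict decrease is exploited
-- only at a configuration inside the region where a cycle is made to start. A function may have
-- several symbolic forms on a region (a constant, or `e - x(c)` where the clock `c` is constant),
-- so solutions are unique only up to mutual `_≼_`. The order that proves termination is therefore
-- placed on codes of strategies, which form a finite set, and not on symbolic values.

module RealArithmetic (ℝ : RealNumbers) where
  open RealNumbers ℝ
  open CommutativeRing commutativeRing using
    ( refl; sym; trans; +-cong; +-congˡ; +-congʳ; *-congˡ; *-congʳ; -‿cong
    ; *-identityˡ; distribʳ; +-identityˡ; +-identityʳ; +-comm; +-assoc; *-identityʳ; distribˡ;
        setoid; semiring; ring; +-monoid; -‿inverseʳ) public
  open IsStrictTotalOrder isStrictTotalOrder
    using () renaming
      (trans to <-trans; <-respˡ-≈ to <-respˡ; <-respʳ-≈ to <-respʳ; irrefl to <-irrefl) public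
  open RingProperties ring using (-0#≈0#; -‿involutive; -‿+-comm; -‿distribˡ-*; -‿distribʳ-*)
  open MonoidMultiples +-monoid using (×-homo-+)
  open SemiringMultiples semiring using (×1-homo-*)
  open SetoidReasoning setoid

  fromℤ-⊖ : ∀ m n → fromℤ (m ⊖ n) ≈ fromℕ m - fromℕ n
  fromℤ-⊖ m zero = sym (trans (+-congˡ -0#≈0#) (+-identityʳ _))
  fromℤ-⊖ zero (suc n) = sym (+-identityˡ _)
  fromℤ-⊖ (suc m) (suc n) = begin
    fromℤ (suc m ⊖ suc n)                  ≡⟨ cong fromℤ (ℤ.[1+m]⊖[1+n]≡m⊖n m n) ⟩
    fromℤ (m ⊖ n)                          ≈⟨ fromℤ-⊖ m n ⟩
    fromℕ m - fromℕ n                      ≈⟨ +-congʳ (+-identityʳ _) ⟨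
    (fromℕ m + 0#) - fromℕ n               ≈⟨ +-congʳ (+-congˡ (-‿inverseʳ 1#)) ⟨
    (fromℕ m + (1# - 1#)) - fromℕ n        ≈⟨ +-congʳ (+-assoc _ _ _) ⟨
    ((fromℕ m + 1#) - 1#) - fromℕ n        ≈⟨ +-assoc _ _ _ ⟩
    (fromℕ m + 1#) + (- 1# - fromℕ n)      ≈⟨ +-cong (+-comm _ _) (-‿+-comm _ _) ⟩
    fromℕ (suc m) - fromℕ (suc n)          ∎

  fromℤ-+ : ∀ i j → fromℤ (i ℤ.+ j) ≈ fromℤ i + fromℤ j
  fromℤ-+ (+ m) (+ n) = ×-homo-+ 1# m n
  fromℤ-+ (+ m) -[1+ n ] = fromℤ-⊖ m (suc n)
  fromℤ-+ -[1+ m ] (+ n) = trans (fromℤ-⊖ n (suc m)) (+-comm _ _)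
  fromℤ-+ -[1+ m ] -[1+ n ] = begin
    - (1# + fromℕ (suc (m ℕ.+ n)))   ≈⟨ -‿cong (+-congˡ (×-homo-+ 1# (suc m) n)) ⟩
    - (1# + (fromℕ (suc m) + fromℕ n)) ≈⟨ -‿cong (+-comm _ _) ⟩
    - ((fromℕ (suc m) + fromℕ n) + 1#) ≈⟨ -‿cong (+-assoc _ _ _) ⟩
    - (fromℕ (suc m) + (fromℕ n + 1#)) ≈⟨ -‿cong (+-congˡ (+-comm _ _)) ⟩
    - (fromℕ (suc m) + fromℕ (suc n))  ≈⟨ -‿+-comm _ _ ⟨
    - fromℕ (suc m) - fromℕ (suc n)    ∎

  fromℤ-neg : ∀ i → fromℤ (ℤ.- i) ≈ - fromℤ i
  fromℤ-neg (+ zero)   = sym -0#≈0#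
  fromℤ-neg (+ suc n)  = refl
  fromℤ-neg -[1+ n ]   = sym (-‿involutive _)

  fromℤ-◃+ : ∀ n → fromℤ (Sign.+ ◃ n) ≈ fromℕ n
  fromℤ-◃+ zero    = refl
  fromℤ-◃+ (suc n) = refl

  fromℤ-◃- : ∀ n → fromℤ (Sign.- ◃ n) ≈ - fromℕ n
  fromℤ-◃- zero    = sym -0#≈0#
  fromℤ-◃- (suc n) = refl

  fromℤ-* : ∀ i j → fromℤ (i ℤ.* j) ≈ fromℤ i * fromℤ j
  fromℤ-* (+ m) (+ n) = trans (fromℤ-◃+ (m ℕ.* n)) (×1-homo-* m n)
  fromℤ-* (+ m) -[1+ n ] =
    trans (fromℤ-◃- (m ℕ.* suc n)) (trans (-‿cong (×1-homo-* m (suc n))) (-‿distribʳ-* _ _))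
  fromℤ-* -[1+ m ] (+ n) =
    trans (fromℤ-◃- (suc m ℕ.* n)) (trans (-‿cong (×1-homo-* (suc m) n)) (-‿distribˡ-* _ _))
  fromℤ-* -[1+ m ] -[1+ n ] = begin
    fromℤ (Sign.+ ◃ (suc m ℕ.* suc n))   ≈⟨ ×1-homo-* (suc m) (suc n) ⟩
    fromℕ (suc m) * fromℕ (suc n)        ≈⟨ *-congʳ (-‿involutive _) ⟨
    (- (- fromℕ (suc m))) * fromℕ (suc n) ≈⟨ -‿distribˡ-* _ _ ⟨
    - ((- fromℕ (suc m)) * fromℕ (suc n)) ≈⟨ -‿distribʳ-* _ _ ⟩
    (- fromℕ (suc m)) * (- fromℕ (suc n)) ∎

  private
    almostRing : AlmostCommutativeRing _ _
    almostRing = fromCommutativeRing commutativeRing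

    -- Constants of the abstract field do not compute; integer coefficients let the solver normalise
    -- them.
    ℤ-coefficients : ℤ.+-*-rawRing -Raw-AlmostCommutative⟶ almostRing
    ℤ-coefficients = record
      { ⟦_⟧    = fromℤ
      ; +-homo = fromℤ-+
      ; *-homo = fromℤ-*
      ; -‿homo = fromℤ-neg
      ; 0-homo = refl
      ; 1-homo = +-identityʳ 1#
      }

    _coeff≟_ : ∀ i j → Maybe (fromℤ i ≈ fromℤ j)
    i coeff≟ j with i ℤ.≟ j
    ... | yes ≡.refl = just refl
    ... | no _       = nothing

  open RingSolver ℤ.+-*-rawRing almostRing ℤ-coefficients _coeff≟_ public
    using (solve; _:=_; _:+_; _:-_; :-_; con)

  ≤-reflexive : ∀ {x y} → x ≈ y → x ≤ y
  ≤-reflexive = inj₂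

  ≤-refl : ∀ {x} → x ≤ x
  ≤-refl = inj₂ refl

  <-≤-trans : ∀ {x y z} → x < y → y ≤ z → x < z
  <-≤-trans x<y (inj₁ y<z) = <-trans x<y y<z
  <-≤-trans x<y (inj₂ y≈z) = <-respʳ y≈z x<y

  ≤-<-trans : ∀ {x y z} → x ≤ y → y < z → x < z
  ≤-<-trans (inj₁ x<y) y<z = <-trans x<y y<z
  ≤-<-trans (inj₂ x≈y) y<z = <-respˡ (sym x≈y) y<z

  ≤-trans : ∀ {x y z} → x ≤ y → y ≤ z → x ≤ z
  ≤-trans (inj₁ x<y) y≤z = inj₁ (<-≤-trans x<y y≤z)
  ≤-trans (inj₂ x≈y) (inj₁ y<z) = inj₁ (<-respˡ (sym x≈y) y<z)
  ≤-trans (inj₂ x≈y) (inj₂ y≈z) = inj₂ (trans x≈y y≈z)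

  <⇒≱ : ∀ {x y} → x < y → ¬ (y ≤ x)
  <⇒≱ x<y y≤x = <-irrefl refl (<-≤-trans x<y y≤x)

  ≤-antisym : ∀ {x y} → x ≤ y → y ≤ x → x ≈ y
  ≤-antisym (inj₁ x<y) y≤x = contradiction y≤x (<⇒≱ x<y)
  ≤-antisym (inj₂ x≈y) _   = x≈y

  ≤-or-> : ∀ x y → x ≤ y ⊎ y < x
  ≤-or-> x y with compare x y
  ... | tri< x<y _ _ = inj₁ (inj₁ x<y)
  ... | tri≈ _ x≈y _ = inj₁ (inj₂ x≈y)
  ... | tri> _ _ y<x = inj₂ y<x

  ≰⇒> : ∀ {x y} → ¬ (x ≤ y) → y < x
  ≰⇒> {x} {y} x≰y with ≤-or-> x y
  ... | inj₁ x≤y = contradiction x≤y x≰y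
  ... | inj₂ y<x = y<x

  ≮⇒≥ : ∀ {x y} → ¬ (x < y) → y ≤ x
  ≮⇒≥ {x} {y} x≮y with ≤-or-> y x
  ... | inj₁ y≤x = y≤x
  ... | inj₂ x<y = contradiction x<y x≮y

  ≤-resp : ∀ {x x′ y y′} → x ≈ x′ → y ≈ y′ → x ≤ y → x′ ≤ y′
  ≤-resp p q x≤y = ≤-trans (inj₂ (sym p)) (≤-trans x≤y (inj₂ q))

  <-resp : ∀ {x x′ y y′} → x ≈ x′ → y ≈ y′ → x < y → x′ < y′
  <-resp p q x<y = <-respʳ q (<-respˡ p x<y)

  +-monoˡ-≤ : ∀ z {x y} → x ≤ y → x + z ≤ y + z
  +-monoˡ-≤ z (inj₁ x<y) = inj₁ (+-monoˡ-< z x<y)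
  +-monoˡ-≤ z (inj₂ x≈y) = inj₂ (+-congʳ x≈y)

  +-monoʳ-≤ : ∀ z {x y} → x ≤ y → z + x ≤ z + y
  +-monoʳ-≤ z x≤y = ≤-resp (+-comm _ _) (+-comm _ _) (+-monoˡ-≤ z x≤y)

  infixl 6 _⊕≤_ _⊕<_
  _⊕≤_ : ∀ {x y u v} → x ≤ y → u ≤ v → x + u ≤ y + v
  x≤y ⊕≤ u≤v = ≤-trans (+-monoˡ-≤ _ x≤y) (+-monoʳ-≤ _ u≤v)

  _⊕<_ : ∀ {x y u v} → x ≤ y → u < v → x + u < y + v
  x≤y ⊕< u<v = ≤-<-trans (+-monoˡ-≤ _ x≤y) (<-resp (+-comm _ _) (+-comm _ _) (+-monoˡ-< _ u<v))

  private
    cancelled : ∀ {a b p q} → p + b ≈ q + a → (a + (p - a)) ≈ p × (b + (p - a)) ≈ q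
    cancelled {a} {b} {p} {q} e =
      solve 2 (λ a p → a :+ (p :- a) := p) refl a p ,
      (begin
        b + (p - a)  ≈⟨ solve 3 (λ a b p → b :+ (p :- a) := (p :+ b) :- a) refl a b p ⟩
        (p + b) - a  ≈⟨ +-congʳ e ⟩
        (q + a) - a  ≈⟨ solve 2 (λ a q → (q :+ a) :- a := q) refl a q ⟩
        q            ∎)

  -- The equation says q - p = b - a, written without subtraction.
  linear≤ : ∀ {a b p q} → a ≤ b → p + b ≈ q + a → p ≤ q
  linear≤ {a} {b} {p} a≤b e =
    ≤-resp (proj₁ (cancelled {a} {b} e)) (proj₂ (cancelled e)) (+-monoˡ-≤ (p - a) a≤b)

  linear< : ∀ {a b p q} → a < b → p + b ≈ q + a → p < q
  linear< {a} {b} {p} a<b e =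
    <-resp (proj₁ (cancelled {a} {b} e)) (proj₂ (cancelled e)) (+-monoˡ-< (p - a) a<b)

  fromℕ-mono-≤ : ∀ {m n} → m ℕ.≤ n → fromℕ m ≤ fromℕ n
  fromℕ-mono-≤ {n = zero}  z≤n = ≤-refl
  fromℕ-mono-≤ {n = suc n} z≤n =
    linear≤ (inj₁ 0<1 ⊕≤ fromℕ-mono-≤ {n = n} z≤n)
      (solve 2 (λ o x → con ℤ.0ℤ :+ (o :+ x) := (o :+ x) :+ (con ℤ.0ℤ :+ con ℤ.0ℤ)) refl 1#
        (fromℕ n))
  fromℕ-mono-≤ {suc m} {suc n} (s≤s m≤n) = +-monoʳ-≤ 1# (fromℕ-mono-≤ {m} {n} m≤n)

  n<1+n : ∀ n → fromℕ n < fromℕ (suc n)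
  n<1+n n = linear< 0<1 (trans (+-comm _ _) (sym (+-identityʳ _)))

  fromℕ-mono-< : ∀ {m n} → m ℕ.< n → fromℕ m < fromℕ n
  fromℕ-mono-< {m} m<n = <-≤-trans (n<1+n m) (fromℕ-mono-≤ {suc m} m<n)

  0≤fromℕ : ∀ n → 0# ≤ fromℕ n
  0≤fromℕ n = fromℕ-mono-≤ {0} {n} z≤n

  half : ∀ {ε} → 0# < ε → ∃ λ δ → 0# < δ × δ + δ ≈ ε
  half {ε} 0<ε with inverse (1# + 1#) 2≉0
    where
    0<2 : 0# < 1# + 1#
    0<2 = <-respˡ (+-identityˡ 0#) (inj₁ 0<1 ⊕< 0<1)
    2≉0 : ¬ (1# + 1# ≈ 0#)
    2≉0 e = <-irrefl (sym e) 0<2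
  ... | h , 2h≈1 = ε * h , ≰⇒> ε*h≰0 , double
    where
    double : ε * h + ε * h ≈ ε
    double = begin
      ε * h + ε * h                     ≈⟨ distribˡ ε h h ⟨
      ε * (h + h)                       ≈⟨ *-congˡ (+-cong (*-identityˡ h) (*-identityˡ h)) ⟨
      ε * (1# * h + 1# * h)             ≈⟨ *-congˡ (distribʳ h 1# 1#) ⟨
      ε * ((1# + 1#) * h)               ≈⟨ *-congˡ 2h≈1 ⟩
      ε * 1#                            ≈⟨ *-identityʳ ε ⟩
      ε                                 ∎
    ε*h≰0 : ¬ (ε * h ≤ 0#)
    ε*h≰0 p = <⇒≱ 0<ε (≤-resp double (+-identityˡ 0#) (p ⊕≤ p))

  positive-min : ∀ {x y} → 0# < x → 0# < y → ∃ λ z → 0# < z × z ≤ x × z ≤ y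
  positive-min {x} {y} 0<x 0<y with ≤-or-> x y
  ... | inj₁ x≤y = x , 0<x , ≤-refl , x≤y
  ... | inj₂ y<x = y , 0<y , inj₁ y<x , ≤-refl

-- Regions, resets and short delays

module RegionGeometry (ℝ : RealNumbers) (k : ℕ) (Γ : ReachabilityTimeGame ℝ k) where
  open RealNumbers ℝ
  open RealArithmetic ℝ
  open ReachabilityTimeGame Γ
  open TimedRegionGraph ℝ k Γ

  -- A clock, or (as nothing) the constant 0.
  Offset : Set
  Offset = Maybe Clock

  infixl 9 _⟨_⟩
  _⟨_⟩ : RawValuation → Offset → Carrier
  x ⟨ nothing ⟩ = 0#
  x ⟨ just c ⟩  = x c

  val : Config → RawValuation
  val s = at (proj₂ s)

  module _ (ν : Valuation) where
    offset-≥0 : ∀ d → 0# ≤ at ν ⟨ d ⟩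
    offset-≥0 nothing  = ≤-refl
    offset-≥0 (just c) = proj₁ (bounded ν c)

    offset-≤k : ∀ d → at ν ⟨ d ⟩ ≤ fromℕ k
    offset-≤k nothing  = 0≤fromℕ k
    offset-≤k (just c) = proj₂ (bounded ν c)

    difference-≤k : ∀ d d′ → at ν ⟨ d ⟩ - at ν ⟨ d′ ⟩ ≤ fromℕ k
    difference-≤k d d′ = linear≤ (offset-≤k d ⊕≤ offset-≥0 d′)
      (solve 3 (λ x y m → (x :- y) :+ (m :+ y) := m :+ (x :+ con ℤ.0ℤ)) refl (at ν ⟨ d ⟩)
        (at ν ⟨ d′ ⟩) (fromℕ k))

  -- One-sided, and for weak comparisons only: a strict comparison is the negation of a weak one, so
  -- it transfers by agreement in the opposite direction.
  Agree : Valuation → Valuation → (RawValuation → Carrier) → Set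
  Agree ν ν′ f = ∀ (i : Bound) →
    (f (at ν) ≤ bound i → f (at ν′) ≤ bound i) × (bound i ≤ f (at ν) → bound i ≤ f (at ν′))

  region-constraint : ∀ ν ν′ → clockRegion ν ≡ clockRegion ν′ → ∀ g → at ν ⊨ g → at ν′ ⊨ g
  region-constraint ν ν′ p g = Equivalence.to (Equivalence.to (clockRegion-≡ ν ν′) p g)

  agree⇒≡ : ∀ ν ν′ → (∀ t → Agree ν ν′ (λ x → evalTerm x t)) →
    (∀ t → Agree ν′ ν (λ x → evalTerm x t)) →
            clockRegion ν ≡ clockRegion ν′
  agree⇒≡ ν ν′ h h′ =
    Equivalence.from (clockRegion-≡ ν ν′) (λ g → mk⇔ (transfer ν ν′ h h′ g) (transfer ν′ ν h′ h g))
    where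
    transfer : ∀ ν ν′ → (∀ t → Agree ν ν′ (λ x → evalTerm x t)) →
               (∀ t → Agree ν′ ν (λ x → evalTerm x t)) → ∀ g → at ν ⊨ g → at ν′ ⊨ g
    transfer ν ν′ h h′ (t , lt , i) p = ≰⇒> (λ q → <⇒≱ p (proj₂ (h′ t i) q))
    transfer ν ν′ h h′ (t , gt , i) p = ≰⇒> (λ q → <⇒≱ p (proj₁ (h′ t i) q))
    transfer ν ν′ h h′ (t , eq , i) p =
      ≤-antisym (proj₁ (h t i) (≤-reflexive p)) (proj₂ (h t i) (≤-reflexive (sym p)))
    transfer ν ν′ h h′ (t , le , i) p = proj₁ (h t i) p
    transfer ν ν′ h h′ (t , ge , i) p = proj₂ (h t i) p

  ≈⇒clockRegion-≡ : ∀ ν ν′ → (∀ c → at ν c ≈ at ν′ c) → clockRegion ν ≡ clockRegion ν′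
  ≈⇒clockRegion-≡ ν ν′ h =
    agree⇒≡ ν ν′ (λ t → agree (evalTerm-cong h t)) (λ t → agree (sym (evalTerm-cong h t)))
    where
    evalTerm-cong : ∀ {x y : RawValuation} → (∀ c → x c ≈ y c) → ∀ t → evalTerm x t ≈ evalTerm y t
    evalTerm-cong h (clock c)             = h c
    evalTerm-cong h (difference (c , c′)) = +-cong (h c) (-‿cong (h c′))
    agree : ∀ {x y} → x ≈ y → ∀ (i : Bound) →
      (x ≤ bound i → y ≤ bound i) × (bound i ≤ x → bound i ≤ y)
    agree e i = ≤-resp e refl , ≤-resp refl e

  module _ (ν ν′ : Valuation) (ν∼ν′ : clockRegion ν ≡ clockRegion ν′) where
    private
      constraint : ∀ g → at ν ⊨ g → at ν′ ⊨ g
      constraint = region-constraint ν ν′ ν∼ν′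

      x-0 : ∀ {x} → x ≈ x - 0#
      x-0 = solve 1 (λ x → x := x :- con ℤ.0ℤ) refl _

    -- Reading `nothing` as a clock fixed at 0 turns single-clock constraints into differences. The
    -- form `0 - x c′` is not itself a constraint, but it lies below every bound, and above a bound
    -- only if both are 0.
    difference-agree : ∀ d d′ → Agree ν ν′ (λ x → x ⟨ d ⟩ - x ⟨ d′ ⟩)
    difference-agree (just c) (just c′) i =
      constraint (difference (c , c′) , le , i) , constraint (difference (c , c′) , ge , i)
    difference-agree (just c) nothing i =
      ≤-resp x-0 refl ∘ constraint (clock c , le , i) ∘ ≤-resp (sym x-0) refl ,
      ≤-resp refl x-0 ∘ constraint (clock c , ge , i) ∘ ≤-resp refl (sym x-0)
    difference-agree nothing nothing i = id , id
    difference-agree nothing (just c′) i =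
      (λ _ → linear≤ (0≤fromℕ (toℕ i) ⊕≤ offset-≥0 ν′ (just c′))
               (solve 2 (λ x n → (con ℤ.0ℤ :- x) :+ (n :+ x) := n :+ (con ℤ.0ℤ :+ con ℤ.0ℤ))
                 refl _ _)) ,
      nonpositive i
      where
      -- n ≤ - x c with x c ≥ 0 forces n = 0.
      nonpositive : ∀ i → bound i ≤ 0# - at ν c′ → bound i ≤ 0# - at ν′ c′
      nonpositive Fin.zero p = linear≤ (constraint (clock c′ , le , Fin.zero) (linear≤ p
        (solve 1 (λ x → x :+ (con ℤ.0ℤ :- x) := con ℤ.0ℤ :+ con ℤ.0ℤ) refl _)))
        (solve 1 (λ x → con ℤ.0ℤ :+ con ℤ.0ℤ := (con ℤ.0ℤ :- x) :+ x) refl _)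
      nonpositive (Fin.suc i) p = contradiction
        (linear≤ (p ⊕≤ offset-≥0 ν (just c′))
           (solve 2 (λ n x → n :+ ((con ℤ.0ℤ :- x) :+ x) := con ℤ.0ℤ :+ (n :+ con ℤ.0ℤ)) refl _ _))
        (<⇒≱ (fromℕ-mono-< {0} {toℕ (Fin.suc i)} (s≤s z≤n)))

    -- Constraints mention only the integers up to `k`. Larger ones impose nothing, since a
    -- difference of clocks is at most `k`; by the same bound those below `- k` are never met; the
    -- other negative ones become constraints on the reversed difference.
    difference-≤ : ∀ d d′ i → at ν ⟨ d ⟩ - at ν ⟨ d′ ⟩ ≤ fromℤ i →
      at ν′ ⟨ d ⟩ - at ν′ ⟨ d′ ⟩ ≤ fromℤ i
    difference-≤ d d′ (+ n) p with n ℕ.≤? k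
    ... | yes n≤k = subst (λ m → _ ≤ fromℕ m) e
                      (proj₁ (difference-agree d d′ i) (subst (λ m → _ ≤ fromℕ m) (≡.sym e) p))
      where
      i : Bound
      i = fromℕ< (s≤s n≤k)
      e : toℕ i ≡ n
      e = toℕ-fromℕ< (s≤s n≤k)
    ... | no n≰k = ≤-trans (difference-≤k ν′ d d′) (fromℕ-mono-≤ {k} {n} (ℕ.<⇒≤ (ℕ.≰⇒> n≰k)))
    difference-≤ d d′ -[1+ m ] p with suc m ℕ.≤? k
    ... | yes m<k =
      flip- {at ν′ ⟨ d ⟩} {at ν′ ⟨ d′ ⟩} (subst (λ m → fromℕ m ≤ at ν′ ⟨ d′ ⟩ - at ν′ ⟨ d ⟩) e
                      (proj₂ (difference-agree d′ d i)
                        (subst (λ m → fromℕ m ≤ at ν ⟨ d′ ⟩ - at ν ⟨ d ⟩) (≡.sym e)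
                        (flip+ {at ν ⟨ d ⟩} {at ν ⟨ d′ ⟩} p))))
      where
      i : Bound
      i = fromℕ< (s≤s m<k)
      e : toℕ i ≡ suc m
      e = toℕ-fromℕ< (s≤s m<k)
      flip+ : ∀ {x y n} → x - y ≤ - n → n ≤ y - x
      flip+ {x} {y} {n} p =
        linear≤ p (solve 3 (λ x y n → n :+ (:- n) := (y :- x) :+ (x :- y)) refl x y n)
      flip- : ∀ {x y n} → n ≤ y - x → x - y ≤ - n
      flip- {x} {y} {n} p =
        linear≤ p (solve 3 (λ x y n → (x :- y) :+ (y :- x) := (:- n) :+ n) refl x y n)
    ... | no m≮k = contradiction
      (linear≤ (p ⊕≤ difference-≤k ν d′ d)
        (solve 4 (λ n m x y → n :+ ((:- n) :+ m) := m :+ ((x :- y) :+ (y :- x))) refl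
          (fromℕ (suc m)) (fromℕ k) (at ν ⟨ d ⟩) (at ν ⟨ d′ ⟩)))
      (<⇒≱ (fromℕ-mono-< {k} {suc m} (ℕ.≰⇒> m≮k)))

  -- (e , d) stands for the simple function x ↦ e - x(d).
  Simple : Set
  Simple = ℤ × Offset

  ⟦_⟧ : Simple → RawValuation → Carrier
  ⟦ e , d ⟧ x = fromℤ e - x ⟨ d ⟩

  -- `e - x(d) ≤ e′ - x(d′)` is the difference constraint `x(d′) - x(d) ≤ e′ - e`, which a region
  -- decides. Hence one sample configuration suffices to compare simple functions on a region.
  simple-≤ : ∀ s s′ → region s ≡ region s′ → ∀ f g → ⟦ f ⟧ (val s) ≤ ⟦ g ⟧ (val s) →
    ⟦ f ⟧ (val s′) ≤ ⟦ g ⟧ (val s′)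
  simple-≤ s s′ s∼s′ (e , d) (e′ , d′) p =
    linear≤ (≤-resp refl diff
      (difference-≤ (proj₂ s) (proj₂ s′) (cong proj₂ s∼s′) d′ d (e′ ℤ.- e) (≤-resp refl (sym diff)
      (linear≤ p (solve 4 (λ a b x y → (y :- x) :+ (b :- y) := (b :- a) :+ (a :- x))
        refl (fromℤ e) (fromℤ e′) (val s ⟨ d ⟩) (val s ⟨ d′ ⟩))))))
      (solve 4 (λ a b x y → (a :- x) :+ (b :- a) := (b :- y) :+ (y :- x)) refl (fromℤ e) (fromℤ e′)
        (val s′ ⟨ d ⟩) (val s′ ⟨ d′ ⟩))
    where
    diff : fromℤ (e′ ℤ.- e) ≈ fromℤ e′ - fromℤ e
    diff = trans (fromℤ-+ e′ (ℤ.- e)) (+-congˡ (fromℤ-neg e))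

  -- Resetting

  afterReset : (Clock → Bool) → Clock → Offset
  afterReset C c = if C c then nothing else just c

  reset-offset : ∀ C x c → reset C x c ≡ x ⟨ afterReset C c ⟩
  reset-offset C x c with C c
  ... | true  = ≡.refl
  ... | false = ≡.refl

  reset-cong : ∀ C {x y : RawValuation} → (∀ c → x c ≈ y c) → ∀ c → reset C x c ≈ reset C y c
  reset-cong C h c with C c
  ... | true  = refl
  ... | false = h c

  -- After the reset every term is a difference of two offsets of the old valuation, with `nothing`
  -- for the clocks that were reset, so `difference-agree` applies.
  reset-region : ∀ C ν ν′ μ μ′ → clockRegion ν ≡ clockRegion ν′ →
    (∀ c → at μ c ≈ reset C (at ν) c) → (∀ c → at μ′ c ≈ reset C (at ν′) c) →
      clockRegion μ ≡ clockRegion μ′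
  reset-region C ν ν′ μ μ′ p h h′ =
    agree⇒≡ μ μ′ (agree ν ν′ μ μ′ p h h′) (agree ν′ ν μ′ μ (≡.sym p) h′ h)
    where
    ≡⇒≈ : ∀ {x y} → x ≡ y → x ≈ y
    ≡⇒≈ ≡.refl = refl
    after-reset : ∀ c ν μ → (∀ c → at μ c ≈ reset C (at ν) c) → at μ c ≈ at ν ⟨ afterReset C c ⟩
    after-reset c ν μ h = trans (h c) (≡⇒≈ (reset-offset C (at ν) c))
    term : ∀ t → ∃₂ λ d d′ →
      ∀ ν μ → (∀ c → at μ c ≈ reset C (at ν) c) → evalTerm (at μ) t ≈ at ν ⟨ d ⟩ - at ν ⟨ d′ ⟩
    term (clock c) = afterReset C c , nothing , λ ν μ h →
      trans (after-reset c ν μ h) (solve 1 (λ x → x := x :- con ℤ.0ℤ) refl _)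
    term (difference (c , c′)) = afterReset C c , afterReset C c′ , λ ν μ h →
      +-cong (after-reset c ν μ h) (-‿cong (after-reset c′ ν μ h))
    agree : ∀ ν ν′ μ μ′ → clockRegion ν ≡ clockRegion ν′ →
      (∀ c → at μ c ≈ reset C (at ν) c) → (∀ c → at μ′ c ≈ reset C (at ν′) c) →
      ∀ t → Agree μ μ′ (λ x → evalTerm x t)
    agree ν ν′ μ μ′ p h h′ t i with term t
    ... | d , d′ , e =
      ≤-resp (sym (e ν′ μ′ h′)) refl ∘ proj₁ (difference-agree ν ν′ p d d′ i) ∘
        ≤-resp (e ν μ h) refl ,
      ≤-resp refl (sym (e ν′ μ′ h′)) ∘ proj₂ (difference-agree ν ν′ p d d′ i) ∘
        ≤-resp refl (e ν μ h)

  -- Short delays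

  -- Both directions of time are covered, so that one `gap` serves for leaving a region and for
  -- stepping back out of it.
  ShortAt : Valuation → Clock → Bound → Carrier → Set
  ShortAt ν c i t =
    (at ν c < bound i → at ν c + t < bound i) × (bound i < at ν c → bound i < at ν c - t)

  Short : Valuation → Carrier → Set
  Short ν t = ∀ c i → ShortAt ν c i t

  shortAt-mono : ∀ ν c i {t t′} → t′ ≤ t → ShortAt ν c i t → ShortAt ν c i t′
  shortAt-mono ν c i t′≤t h =
    (λ p → ≤-<-trans (+-monoʳ-≤ _ t′≤t) (proj₁ h p)) ,
    (λ p → <-≤-trans (proj₂ h p)
      (linear≤ t′≤t (solve 3 (λ x a b → (x :- b) :+ b := (x :- a) :+ a) refl _ _ _)))

  short-mono : ∀ ν {t t′} → t′ ≤ t → Short ν t → Short ν t′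
  short-mono ν t′≤t h c i = shortAt-mono ν c i t′≤t (h c i)

  -- Downward closure lets the smallest of finitely many witnesses serve for all.
  finite-positive : ∀ n (P : Fin n → Carrier → Set) → (∀ i {x y} → x ≤ y → P i y → P i x) →
    (∀ i → ∃ λ x → 0# < x × P i x) → ∃ λ x → 0# < x × ∀ i → P i x
  finite-positive zero P down h = 1# , 0<1 , λ ()
  finite-positive (suc n) P down h with h Fin.zero | finite-positive n (P ∘ Fin.suc)
    (λ i → down (Fin.suc i)) (h ∘ Fin.suc)
  ... | x , 0<x , p | y , 0<y , q with positive-min 0<x 0<y
  ...   | z , 0<z , z≤x , z≤y = z , 0<z , λ where
            Fin.zero    → down Fin.zero z≤x p
            (Fin.suc i) → down (Fin.suc i) z≤y (q i)

  gap : ∀ ν → ∃ λ t → 0# < t × Short ν t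
  gap ν = finite-positive nC (λ c t → ∀ i → ShortAt ν c i t)
    (λ c t≤ h i → shortAt-mono ν c i t≤ (h i))
    (λ c → finite-positive (suc k) (ShortAt ν c) (λ i → shortAt-mono ν c i) (single c))
    where
    between : ∀ {x y} → x < y → ∃ λ t → 0# < t × x + t < y × x < y - t
    between {x} {y} x<y with half {y - x}
      (linear< x<y (solve 2 (λ x y → con ℤ.0ℤ :+ y := (y :- x) :+ x) refl x y))
    ... | t , 0<t , e = t , 0<t ,
      linear< (≤-reflexive e ⊕< 0<t)
        (solve 3 (λ x y t → (x :+ t) :+ ((y :- x) :+ t) := y :+ ((t :+ t) :+ con ℤ.0ℤ))
          refl x y t) ,
      linear< (≤-reflexive e ⊕< 0<t)
        (solve 3 (λ x y t → x :+ ((y :- x) :+ t) := (y :- t) :+ ((t :+ t) :+ con ℤ.0ℤ)) refl x y t)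
    single : ∀ c i → ∃ λ t → 0# < t × ShortAt ν c i t
    single c i with compare (at ν c) (bound i)
    ... | tri< p ¬q ¬r = let t , 0<t , q , _ = between p in
      t , 0<t , (λ _ → q) , (λ r → contradiction r ¬r)
    ... | tri≈ ¬p _ ¬r = 1# , 0<1 , (λ p → contradiction p ¬p) , (λ r → contradiction r ¬r)
    ... | tri> ¬p _ r = let t , 0<t , _ , q = between r in
      t , 0<t , (λ p → contradiction p ¬p) , (λ _ → q)

  module _ (ν ν′ : Valuation) (ν∼ν′ : clockRegion ν ≡ clockRegion ν′) where
    private
      constraint : ∀ g → at ν ⊨ g → at ν′ ⊨ g
      constraint = region-constraint ν ν′ ν∼ν′

    -- After a short positive delay a clock is at most `i` exactly if it was strictly below before,
    -- and at least `i` exactly if it already was; differences of clocks do not change. These are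
    -- conditions on the starting region, not on the delay.
    soon-agree : ∀ {t t′} μ μ′ → 0# < t → Short ν t → Short ν′ t′ →
      (∀ c → at μ c ≈ at ν c + t) → (∀ c → at μ′ c ≈ at ν′ c + t′) → 0# < t′ →
      ∀ τ → Agree μ μ′ (λ x → evalTerm x τ)
    soon-agree {t} {t′} μ μ′ 0<t u u′ h h′ 0<t′ (clock c) i =
      (λ p → inj₁ (<-resp (sym (h′ c)) refl (proj₁ (u′ c i) (constraint (clock c , lt , i)
        (<-≤-trans (linear< 0<t (solve 2 (λ x t → x :+ t := (x :+ t) :+ con ℤ.0ℤ) refl _ _))
          (≤-resp (h c) refl p)))))) ,
      (λ p → ≤-trans
        (constraint (clock c , ge , i) (≮⇒≥ (λ q → <⇒≱ (proj₁ (u c i) q) (≤-resp refl (h c) p))))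
        (≤-resp refl (sym (h′ c))
          (linear≤ (inj₁ 0<t′) (solve 2 (λ x t → x :+ t := (x :+ t) :+ con ℤ.0ℤ) refl _ _))))
    soon-agree {t} {t′} μ μ′ 0<t u u′ h h′ 0<t′ (difference (c , c′)) i =
      (λ p → ≤-resp (sym (shift ν′ μ′ h′)) refl
        (constraint (difference (c , c′) , le , i) (≤-resp (shift ν μ h) refl p))) ,
      (λ p → ≤-resp refl (sym (shift ν′ μ′ h′))
        (constraint (difference (c , c′) , ge , i) (≤-resp refl (shift ν μ h) p)))
      where
      shift : ∀ ν μ {t} → (∀ c → at μ c ≈ at ν c + t) → at μ c - at μ c′ ≈ at ν c - at ν c′
      shift ν μ h =
        trans (+-cong (h c) (-‿cong (h c′)))
        (solve 3 (λ x y t → (x :+ t) :- (y :+ t) := x :- y) refl _ _ _)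

    -- Mirror image of `soon-agree`: after a short step back, at least `i` means strictly above
    -- before, and at most `i` means the same as before.
    recent-agree : ∀ {t t′} μ μ′ → 0# < t → Short ν t → Short ν′ t′ →
      (∀ c → at μ c ≈ at ν c - t) → (∀ c → at μ′ c ≈ at ν′ c - t′) → 0# < t′ →
      ∀ τ → Agree μ μ′ (λ x → evalTerm x τ)
    recent-agree {t} {t′} μ μ′ 0<t u u′ h h′ 0<t′ (clock c) i =
      (λ p → ≤-trans
        (≤-resp (sym (h′ c)) refl
        (linear≤ (inj₁ 0<t′) (solve 2 (λ x t → (x :- t) :+ t := x :+ con ℤ.0ℤ) refl _ _)))
        (constraint (clock c , le , i) (≮⇒≥ (λ q → <⇒≱ (proj₂ (u c i) q) (≤-resp (h c) refl p))))) ,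
      (λ p → inj₁ (<-resp refl (sym (h′ c)) (proj₂ (u′ c i) (constraint (clock c , gt , i)
        (≤-<-trans (≤-resp refl (h c) p)
          (linear< 0<t (solve 2 (λ x t → (x :- t) :+ t := x :+ con ℤ.0ℤ) refl _ _)))))))
    recent-agree {t} {t′} μ μ′ 0<t u u′ h h′ 0<t′ (difference (c , c′)) i =
      (λ p → ≤-resp (sym (shift ν′ μ′ h′)) refl
        (constraint (difference (c , c′) , le , i) (≤-resp (shift ν μ h) refl p))) ,
      (λ p → ≤-resp refl (sym (shift ν′ μ′ h′))
        (constraint (difference (c , c′) , ge , i) (≤-resp refl (shift ν μ h) p)))
      where
      shift : ∀ ν μ {t} → (∀ c → at μ c ≈ at ν c - t) → at μ c - at μ c′ ≈ at ν c - at ν c′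
      shift ν μ h =
        trans (+-cong (h c) (-‿cong (h c′)))
        (solve 3 (λ x y t → (x :- t) :- (y :- t) := x :- y) refl _ _ _)

-- Closures of regions and the points where moves land

module MoveGeometry (ℝ : RealNumbers) (k : ℕ) (Γ : ReachabilityTimeGame ℝ k) where
  open RealNumbers ℝ
  open RealArithmetic ℝ
  open ReachabilityTimeGame Γ
  open TimedRegionGraph ℝ k Γ
  open RegionGeometry ℝ k Γ

  -- Closures of regions

  Near : Carrier → RawValuation → RawValuation → Set
  Near ε x y = ∀ c → x c - ε < y c × y c < x c + ε

  Closure : Region → RawValuation → Set
  Closure R x = ∀ ε → 0# < ε → ∃ λ s → region s ≡ R × Near ε x (val s)

  Closure⇒closure : ∀ {R x} → Closure R x → closure R (proj₁ R , x)
  Closure⇒closure x∈ ε 0<ε = let s , e , n = x∈ ε 0<ε in s , e , cong proj₁ e , n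

  near-≈ : ∀ {ε x y} → 0# < ε → (∀ c → x c ≈ y c) → Near ε x y
  near-≈ 0<ε h c =
    linear< (≤-reflexive (h c) ⊕< 0<ε)
      (solve 3 (λ x y e → (x :- e) :+ (y :+ e) := y :+ (x :+ con ℤ.0ℤ)) refl _ _ _) ,
    linear< (≤-reflexive (sym (h c)) ⊕< 0<ε)
      (solve 3 (λ x y e → y :+ (x :+ e) := (x :+ e) :+ (y :+ con ℤ.0ℤ)) refl _ _ _)

  region⊆Closure : ∀ s → Closure (region s) (val s)
  region⊆Closure s ε 0<ε = s , ≡.refl , near-≈ 0<ε (λ _ → refl)

  near-offset : ∀ {ε x y} → 0# < ε → Near ε x y → ∀ d →
    x ⟨ d ⟩ - ε < y ⟨ d ⟩ × y ⟨ d ⟩ < x ⟨ d ⟩ + ε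
  near-offset 0<ε n (just c) = n c
  near-offset 0<ε n nothing  =
    linear< 0<ε (solve 1 (λ e → (con ℤ.0ℤ :- e) :+ e := con ℤ.0ℤ :+ con ℤ.0ℤ) refl _) ,
    linear< 0<ε (solve 1 (λ e → con ℤ.0ℤ :+ e := (con ℤ.0ℤ :+ e) :+ con ℤ.0ℤ) refl _)

  -- If the inequality failed at `x` by 2ε, then at a configuration of `R` within ε of `x` each side
  -- would have changed by less than ε, and it would fail there too.
  closure-≤ : ∀ {R} f g → (∀ s → region s ≡ R → ⟦ f ⟧ (val s) ≤ ⟦ g ⟧ (val s)) →
              ∀ {x} → Closure R x → ⟦ f ⟧ x ≤ ⟦ g ⟧ x
  closure-≤ (e , d) (e′ , d′) h {x} x∈ = ≮⇒≥ absurd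
    where
    absurd : ¬ (fromℤ e′ - x ⟨ d′ ⟩ < fromℤ e - x ⟨ d ⟩)
    absurd p with half (linear< p (solve 2 (λ u v → con ℤ.0ℤ :+ v := (v :- u) :+ u) refl _ _))
    ... | ε , 0<ε , 2ε with x∈ ε 0<ε
    ...   | s , s∈R , n = <⇒≱
      (linear< (inj₁ (proj₂ (near-offset {x = x} 0<ε n d)) ⊕≤ ≤-reflexive 2ε
          ⊕< proj₁ (near-offset {x = x} 0<ε n d′))
        (solve 7 (λ a b u v y z ε →
           (b :- z) :+ ((u :+ ε) :+ ((a :- u) :- (b :- v)) :+ z) :=
           (a :- y) :+ (y :+ (ε :+ ε) :+ (v :- ε)))
          refl (fromℤ e) (fromℤ e′) (x ⟨ d ⟩) (x ⟨ d′ ⟩) (val s ⟨ d ⟩) (val s ⟨ d′ ⟩) ε))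
      (h s s∈R)

  -- The successor of x under (a , b , c), without truncating the delay b - x(c).
  succ : SimpleTimedAction → RawValuation → RawValuation
  succ (a , b , c) x = reset (ρ a) (λ c′ → x c′ + (bound b - x c))

  delay-≡ : ∀ s {a b c} → val s c ≤ bound b → delay s (a , b , c) ≡ bound b - val s c
  delay-≡ (_ , ν) {b = b} {c} p with at ν c ≤? bound b
  ... | yes _  = ≡.refl
  ... | no  ≰b = contradiction p ≰b

  Succ-≡ : ∀ s {a b c} → val s c ≤ bound b → Succ s (a , b , c) ≡
    (δ (proj₁ s) a , succ (a , b , c) (val s))
  Succ-≡ s {a} p = cong (λ t → δ (proj₁ s) a , reset (ρ a) (λ c → val s c + t)) (delay-≡ s {a} p)

  near-reset : ∀ C {ε x y} → 0# < ε → Near ε x y → Near ε (reset C x) (reset C y)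
  near-reset C 0<ε n c with C c
  ... | true  =
    near-offset {x = λ _ → 0#} {y = λ _ → 0#} 0<ε (near-≈ {y = λ _ → 0#} 0<ε (λ _ → refl)) nothing
  ... | false = n c

  near-trans : ∀ {ε δ x y z} → Near ε x y → Near δ y z → Near (ε + δ) x z
  near-trans n m c =
    linear< (inj₁ (proj₁ (n c)) ⊕< proj₁ (m c))
      (solve 5 (λ x y z e d → (x :- (e :+ d)) :+ (y :+ z) := z :+ ((x :- e) :+ (y :- d)))
        refl _ _ _ _ _) ,
    linear< (inj₁ (proj₂ (n c)) ⊕< proj₂ (m c))
      (solve 5 (λ x y z e d → z :+ ((x :+ e) :+ (y :+ d)) := (x :+ (e :+ d)) :+ (y :+ z))
        refl _ _ _ _ _)

  near-mono : ∀ {ε δ x y} → ε ≤ δ → Near ε x y → Near δ x y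
  near-mono e≤d n c =
    linear< (e≤d ⊕< proj₁ (n c))
      (solve 4 (λ x y e d → (x :- d) :+ (d :+ y) := y :+ (e :+ (x :- e))) refl _ _ _ _) ,
    linear< (e≤d ⊕< proj₂ (n c))
      (solve 4 (λ x y e d → y :+ (d :+ (x :+ e)) := (x :+ d) :+ (e :+ y)) refl _ _ _ _)

  -- The delay depends on the point as well, so the errors of two clocks add up.
  near-succ : ∀ α {ε x y} → 0# < ε → Near ε x y → Near (ε + ε) (succ α x) (succ α y)
  near-succ (a , b , c) 0<ε n =
    near-reset (ρ a) (<-resp (+-identityˡ _) refl (inj₁ 0<ε ⊕< 0<ε)) λ c′ →
    linear< (inj₁ (proj₁ (n c′)) ⊕< proj₂ (n c))
      (solve 6 (λ x y e b u v → ((x :+ (b :- u)) :- (e :+ e)) :+ (y :+ (u :+ e)) := (y :+ (b :- v))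
        :+ ((x :- e) :+ v)) refl _ _ _ _ _ _) ,
    linear< (inj₁ (proj₂ (n c′)) ⊕< proj₁ (n c))
      (solve 6 (λ x y e b u v → (y :+ (b :- v)) :+ ((x :+ e) :+ v) := ((x :+ (b :- u)) :+ (e :+ e))
        :+ (y :+ (u :- e))) refl _ _ _ _ _ _)

  -- `near-succ` doubles the error, so a distance of ε/4 costs ε/2; the other half is for
  -- approximating `succ α (val s)` from within `R′`.
  succ-Closure : ∀ {R R′} α → (∀ s → region s ≡ R → Closure R′ (succ α (val s))) →
                 ∀ {x} → Closure R x → Closure R′ (succ α x)
  succ-Closure α h {x} x∈ ε 0<ε =
    let ε₂ , 0<ε₂ , 2ε₂ = half 0<ε
        ε₄ , 0<ε₄ , 2ε₄ = half 0<ε₂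
        s , s∈R , n = x∈ ε₄ 0<ε₄
        s′ , s′∈R′ , n′ = h s s∈R ε₂ 0<ε₂
    in s′ , s′∈R′ , near-mono {x = succ α x} {y = val s′} (≤-reflexive (trans (+-congʳ 2ε₄) 2ε₂))
         (near-trans {x = succ α x} {y = succ α (val s)} {z = val s′}
           (near-succ α {x = x} {y = val s} 0<ε₄ n) n′)

  -- Moves of the timed region graph

  _∈Sᴿ _∈Fᴿ : Region → Set
  (ℓ , P) ∈Sᴿ = Zone.regions S ℓ P
  (ℓ , P) ∈Fᴿ = Zone.regions F ℓ P

  delay-region : ∀ {s t u} → Delay s t u → t ≈ 0# → region u ≡ region s
  delay-region {ℓ , ν} {t} {.ℓ , ν′} (≡.refl , h) t≈0 =
    cong (ℓ ,_) (≈⇒clockRegion-≡ ν′ ν (λ c → trans (h c) (trans (+-congˡ t≈0) (+-identityʳ _))))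

  -- The path condition, taken at the delays 0 and `t`, yields states of `S` that equal the end
  -- points only up to `_≈_`; this is enough for them to lie in the same regions.
  →*⇒∈S : ∀ {R R′} → R →* R′ → R ∈Sᴿ × R′ ∈Sᴿ
  →*⇒∈S {R} {R′} (s , s′ , s∈R , s′∈R′ , t , 0≤t , sts′ , stay) =
    subst _∈Sᴿ (≡.trans
      (delay-region {s} {0#} {proj₁ (stay 0# ≤-refl 0≤t)} (proj₁ (proj₂ (stay 0# ≤-refl 0≤t))) refl)
      s∈R) (proj₂ (proj₂ (stay 0# ≤-refl 0≤t))) ,
    subst _∈Sᴿ (≡.trans end s′∈R′) (proj₂ (proj₂ (stay t 0≤t ≤-refl)))
    where
    u : Config
    u = proj₁ (stay t 0≤t ≤-refl)
    stu : Delay s t u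
    stu = proj₁ (proj₂ (stay t 0≤t ≤-refl))
    end : region u ≡ region s′
    end = delay-region {s′} {0#} {u} (≡.trans (proj₁ stu) (≡.sym (proj₁ sts′)) ,
      λ c → trans (proj₂ stu c) (trans (sym (proj₂ sts′ c)) (sym (+-identityʳ _)))) refl

  →*-location : ∀ {R R′} → R →* R′ → proj₁ R′ ≡ proj₁ R
  →*-location (s , s′ , ≡.refl , ≡.refl , t , _ , sts′ , _) = proj₁ sts′

  -- Some delay `t ≥ 0` leads from `s₀` into `R″`, and so does the delay `b - s₀(c)`. Were `t` the
  -- larger, the thin region `R″` would contain two configurations a positive delay apart. So
  -- `0 ≤ t ≤ b - s₀(c)`, and the guard, being a clock constraint, holds on all of `R`.
  boundary-guard : ∀ {R b c R″} → BoundaryStep R b c R″ → ∀ s → region s ≡ R → val s c ≤ bound b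
  boundary-guard {R} {b} {c} (thin , (s₀ , s₀′ , s₀∈R , s₀′∈R″ , t , 0≤t , delay₀ , _) , uniform) s
    s∈R =
    region-constraint (proj₂ s₀) (proj₂ s) (cong proj₂ (≡.trans s₀∈R (≡.sym s∈R)))
      (clock c , le , b) guard₀
    where
    guard₀ : val s₀ c ≤ bound b
    guard₀ with uniform s₀ s₀∈R
    ... | u , delayᵤ , u∈R″ with ≤-or-> t (bound b - val s₀ c)
    ...   | inj₁ t≤ =
      linear≤ (≤-trans 0≤t t≤) (solve 2 (λ x b → x :+ (b :- x) := b :+ con ℤ.0ℤ) refl _ _)
    ...   | inj₂ <t = contradiction (≡.trans s₀′∈R″ (≡.sym u∈R″))
      (thin u (t - (bound b - val s₀ c)) s₀′ u∈R″
        (linear< <t (solve 2 (λ x t → con ℤ.0ℤ :+ t := (t :- x) :+ x) refl _ _))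
        (≡.trans (proj₁ delay₀) (≡.sym (proj₁ delayᵤ)) , λ c′ → trans (proj₂ delay₀ c′)
          (trans (solve 3 (λ x t y → x :+ t := (x :+ y) :+ (t :- y)) refl (val s₀ c′) t _)
            (+-congʳ (sym (proj₂ delayᵤ c′))))))

  -- `RegionAction` provides a single transition. Its target region is nevertheless reached by the
  -- reset from each `u` in `R`, because the region after a reset depends only on the region before.
  action-reset : ∀ {R a R′} → RegionAction R a R′ → ∀ u → region u ≡ R →
    ∃ λ s′ → region s′ ≡ R′ × (∀ c → val s′ c ≈ reset (ρ a) (val u) c)
  action-reset {a = a} ((ℓ , ν) , (ℓ′ , ν′) , s∈R , s′∈R′ , (ℓ≡ , h) , _) u u∈R =
    (ℓ′ , μ) , ≡.trans
      (cong (ℓ′ ,_)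
      (reset-region (ρ a) (proj₂ u) ν μ ν′ (cong proj₂ (≡.trans u∈R (≡.sym s∈R))) (λ _ → refl) h))
      s′∈R′ , λ _ → refl
    where
    μ : Valuation
    μ = valuation (reset (ρ a) (val u)) between
      where
      between : ∀ c → 0# ≤ reset (ρ a) (val u) c × reset (ρ a) (val u) c ≤ fromℕ k
      between c with ρ a c
      ... | true  = ≤-refl , 0≤fromℕ k
      ... | false = bounded (proj₂ u) c

  action-facts : ∀ {R a R′} → RegionAction R a R′ → R′ ∈Sᴿ × proj₁ R′ ≡ δ (proj₁ R) a
  action-facts (s , s′ , ≡.refl , ≡.refl , (ℓ≡ , _) , _ , s′∈S , _) = s′∈S , ℓ≡

  positive-delay : ∀ {s t s′} → 0# ≤ t → Delay s t s′ → region s ≢ region s′ → 0# < t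
  positive-delay (inj₁ 0<t) _ _ = 0<t
  positive-delay {s} {t} {s′} (inj₂ 0≈t) d ≢ =
    contradiction (≡.sym (delay-region {s} {t} {s′} d (sym 0≈t))) ≢

  split : ∀ {s s′ t t₁} → TimeStep s t s′ → 0# ≤ t₁ → t₁ ≤ t → ∃ λ w →
    TimeStep s t₁ w × TimeStep w (t - t₁) s′
  split {s} {s′} {t} {t₁} (0≤t , d , stay) 0≤t₁ t₁≤t with stay t₁ 0≤t₁ t₁≤t
  ... | w , dw , _ = w ,
    (0≤t₁ , dw , λ t′ 0≤t′ t′≤ → stay t′ 0≤t′ (≤-trans t′≤ t₁≤t)) ,
    (linear≤ t₁≤t (solve 2 (λ t u → con ℤ.0ℤ :+ t := (t :- u) :+ u) refl t t₁) ,
     (≡.trans (proj₁ d) (≡.sym (proj₁ dw)) , λ c → trans (proj₂ d c)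
       (trans (solve 3 (λ x t u → x :+ t := (x :+ u) :+ (t :- u)) refl (val s c) t t₁)
         (+-congʳ (sym (proj₂ dw c))))) ,
     λ t′ 0≤t′ t′≤ → later t′ (stay (t₁ + t′) (≤-resp (+-identityˡ 0#) refl (0≤t₁ ⊕≤ 0≤t′))
       (linear≤ t′≤ (solve 3 (λ t u v → (u :+ v) :+ (t :- u) := t :+ v) refl t t₁ t′))))
    where
    later : ∀ t′ → (∃ λ u → Delay s (t₁ + t′) u × u ∈S) → ∃ λ u → Delay w t′ u × u ∈S
    later t′ (u , du , u∈S) = u , (≡.trans (proj₁ du) (≡.sym (proj₁ dw)) , λ c → trans (proj₂ du c)
      (trans (sym (+-assoc _ _ _)) (+-congʳ (sym (proj₂ dw c))))) , u∈S

  between-neighbours : ∀ {R R′} → R →₊₁ R′ → ∀ {s s′ t t₁} → region s ≡ R → region s′ ≡ R′ →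
    TimeStep s t s′ → 0# ≤ t₁ → t₁ ≤ t →
    ∃ λ w → Delay s t₁ w × Delay w (t - t₁) s′ × (region w ≡ R ⊎ region w ≡ R′)
  between-neighbours (_ , _ , only) {s} {s′} {t} {t₁} s∈R s′∈R′ step 0≤t₁ t₁≤t =
    let w , step₁ , step₂ = split {s} {s′} step 0≤t₁ t₁≤t in
    w , proj₁ (proj₂ step₁) , proj₁ (proj₂ step₂) ,
    only (region w) (s , w , s∈R , ≡.refl , _ , step₁) (w , s′ , ≡.refl , s′∈R′ , _ , step₂)

  -- The constraints satisfied shortly after (or before) a point depend only on its region.
  soon : ∀ s u w {t} → region u ≡ region s → 0# < t → Short (proj₂ s) t → Delay s t w →
    ∀ {ε} → 0# < ε → ∃ λ v → region v ≡ region w × Near ε (val u) (val v)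
  soon (ℓ′ , μ) (ℓ , ν) (ℓ″ , ω) {t} u∼s 0<t short (ℓ″≡ℓ′ , sw) {ε} 0<ε =
    v , ≡.cong₂ _,_ (≡.trans (cong proj₁ u∼s) (≡.sym ℓ″≡ℓ′)) v∼w , near
    where
    g = gap ν
    h = half 0<ε
    -- Short for `ν`, and at most ε/2, hence strictly less than ε.
    m = positive-min (proj₁ (proj₂ g)) (proj₁ (proj₂ h))
    t′ : Carrier
    t′ = proj₁ m
    0<t′ : 0# < t′
    0<t′ = proj₁ (proj₂ m)
    short′ : Short ν t′
    short′ = short-mono ν (proj₁ (proj₂ (proj₂ m))) (proj₂ (proj₂ g))
    ν∼μ : clockRegion ν ≡ clockRegion μ
    ν∼μ = cong proj₂ u∼s
    k-bound : Bound
    k-bound = Fin.fromℕ k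
    bound-k : bound k-bound ≡ fromℕ k
    bound-k = cong fromℕ (toℕ-fromℕ k)
    -- The delayed valuation must stay bounded by `k`. As `s` can delay by a positive time, its
    -- clocks are strictly below `k`, and the common region carries this over to `u`.
    below-k : ∀ c → at ν c < bound k-bound
    below-k c = region-constraint μ ν (≡.sym ν∼μ) (clock c , lt , k-bound)
      (subst (at μ c <_) (≡.sym bound-k)
        (<-≤-trans (linear< 0<t (solve 2 (λ x t → x :+ t := (x :+ t) :+ con ℤ.0ℤ) refl (at μ c) t))
        (≤-resp (sw c) refl (proj₂ (bounded ω c)))))
    v : Config
    v = ℓ , valuation (λ c → at ν c + t′) (λ c →
      ≤-resp (+-identityˡ 0#) refl (proj₁ (bounded ν c) ⊕≤ inj₁ 0<t′) ,
      inj₁ (subst (at ν c + t′ <_) bound-k (proj₁ (short′ c k-bound) (below-k c))))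
    v∼w : clockRegion (proj₂ v) ≡ clockRegion ω
    v∼w = agree⇒≡ (proj₂ v) ω
      (soon-agree ν μ ν∼μ (proj₂ v) ω 0<t′ short′ short (λ _ → refl) sw 0<t)
      (soon-agree μ ν (≡.sym ν∼μ) ω (proj₂ v) 0<t short short′ sw (λ _ → refl) 0<t′)
    t′<ε : t′ < ε
    t′<ε = linear< (proj₂ (proj₂ (proj₂ m)) ⊕≤ ≤-reflexive (proj₂ (proj₂ h)) ⊕< proj₁ (proj₂ h))
      (solve 3 (λ t h e → t :+ (h :+ e :+ h) := e :+ (t :+ (h :+ h) :+ con ℤ.0ℤ))
        refl t′ (proj₁ h) ε)
    near : Near ε (at ν) (val v)
    near c =
      linear< (inj₁ 0<ε ⊕< 0<t′)
        (solve 3 (λ x e t → (x :- e) :+ (e :+ t) := (x :+ t) :+ (con ℤ.0ℤ :+ con ℤ.0ℤ)) refl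
        (at ν c) ε t′) ,
      linear< t′<ε (solve 3 (λ x e t → (x :+ t) :+ e := (x :+ e) :+ t) refl (at ν c) ε t′)

  recently : ∀ s u w {t} → region u ≡ region s → 0# < t → Short (proj₂ s) t → Delay w t s →
    ∀ {ε} → 0# < ε → ∃ λ v → region v ≡ region w × Near ε (val u) (val v)
  recently (ℓ′ , μ) (ℓ , ν) (ℓ″ , ω) {t} u∼s 0<t short (ℓ′≡ℓ″ , ws) {ε} 0<ε =
    v , ≡.cong₂ _,_ (≡.trans (cong proj₁ u∼s) ℓ′≡ℓ″) v∼w , near
    where
    g = gap ν
    h = half 0<ε
    m = positive-min (proj₁ (proj₂ g)) (proj₁ (proj₂ h))
    t′ : Carrier
    t′ = proj₁ m
    0<t′ : 0# < t′
    0<t′ = proj₁ (proj₂ m)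
    short′ : Short ν t′
    short′ = short-mono ν (proj₁ (proj₂ (proj₂ m))) (proj₂ (proj₂ g))
    ν∼μ : clockRegion ν ≡ clockRegion μ
    ν∼μ = cong proj₂ u∼s
    w≈ : ∀ c → at ω c ≈ at μ c - t
    w≈ c = trans (solve 2 (λ x t → x := (x :+ t) :- t) refl (at ω c) t) (+-congʳ (sym (ws c)))
    -- `s` arises from `w` by a positive delay, so its clocks are positive, and so are those of `u`;
    -- this leaves room for going back.
    above-0 : ∀ c → 0# < at ν c
    above-0 c = region-constraint μ ν (≡.sym ν∼μ) (clock c , gt , Fin.zero)
      (<-resp (+-identityˡ 0#) (sym (ws c)) (proj₁ (bounded ω c) ⊕< 0<t))
    v : Config
    v = ℓ , valuation (λ c → at ν c - t′) (λ c →
      inj₁ (proj₂ (short′ c Fin.zero) (above-0 c)) ,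
      linear≤ (proj₂ (bounded ν c) ⊕≤ inj₁ 0<t′)
        (solve 3 (λ x t m → (x :- t) :+ (m :+ t) := m :+ (x :+ con ℤ.0ℤ)) refl (at ν c) t′
        (fromℕ k)))
    v∼w : clockRegion (proj₂ v) ≡ clockRegion ω
    v∼w = agree⇒≡ (proj₂ v) ω
      (recent-agree ν μ ν∼μ (proj₂ v) ω 0<t′ short′ short (λ _ → refl) w≈ 0<t)
      (recent-agree μ ν (≡.sym ν∼μ) ω (proj₂ v) 0<t short short′ w≈ (λ _ → refl) 0<t′)
    t′<ε : t′ < ε
    t′<ε = linear< (proj₂ (proj₂ (proj₂ m)) ⊕≤ ≤-reflexive (proj₂ (proj₂ h)) ⊕< proj₁ (proj₂ h))
      (solve 3 (λ t h e → t :+ (h :+ e :+ h) := e :+ (t :+ (h :+ h) :+ con ℤ.0ℤ))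
        refl t′ (proj₁ h) ε)
    near : Near ε (at ν) (val v)
    near c =
      linear< t′<ε (solve 3 (λ x e t → (x :- e) :+ e := (x :- t) :+ t) refl (at ν c) ε t′) ,
      linear< (inj₁ 0<ε ⊕< 0<t′)
        (solve 3 (λ x e t → (x :- t) :+ (e :+ t) := (x :+ e) :+ (con ℤ.0ℤ :+ con ℤ.0ℤ)) refl
        (at ν c) ε t′)

  -- A positive delay from `s` cannot stay in the thin region `R`, and on the way to `s′` it can
  -- only be in `R` or `R′`; so an arbitrarily short one already ends in `R′`. `soon` imitates it
  -- from `u`.
  after-thin : ∀ {R R′} → Thin R → R →₊₁ R′ → ∀ u → region u ≡ R → ∀ ε → 0# < ε →
    ∃ λ v → region v ≡ R′ × Near ε (val u) (val v)
  after-thin {R} {R′} thin R→R′@((s , s′ , s∈R , s′∈R′ , t , step) , R≢R′ , _) u u∈R ε 0<ε =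
    shorten (gap (proj₂ s)) (positive-delay {s} {t} {s′} (proj₁ step) (proj₁ (proj₂ step))
      (λ e → R≢R′ (≡.trans (≡.sym s∈R) (≡.trans e s′∈R′))))
    where
    Target : Set
    Target = ∃ λ v → region v ≡ R′ × Near ε (val u) (val v)
    target : ∀ t₁ → 0# < t₁ → Short (proj₂ s) t₁ →
      (∃ λ w → Delay s t₁ w × Delay w (t - t₁) s′ × (region w ≡ R ⊎ region w ≡ R′)) → Target
    target t₁ 0<t₁ short (w , sw , _ , inj₁ w∈R)  =
      contradiction (≡.trans w∈R (≡.sym s∈R)) (thin s t₁ w s∈R 0<t₁ sw)
    target t₁ 0<t₁ short (w , sw , _ , inj₂ w∈R′) =
      let v , v∼w , n = soon s u w {t₁} (≡.trans u∈R (≡.sym s∈R)) 0<t₁ short sw 0<ε in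
      v , ≡.trans v∼w w∈R′ , n
    shorten : (∃ λ g → 0# < g × Short (proj₂ s) g) → 0# < t → Target
    shorten (g , 0<g , short) 0<t =
      let t₁ , 0<t₁ , t₁≤g , t₁≤t = positive-min 0<g 0<t in
      target t₁ 0<t₁ (short-mono (proj₂ s) {g} {t₁} t₁≤g short)
        (between-neighbours R→R′ {s} {s′} s∈R s′∈R′ step (inj₁ 0<t₁) t₁≤t)

  -- A short step back from `s` leaves `R`, since `R` is thin, and so ends in its predecessor `R′`;
  -- `recently` imitates it from `u`.
  before-thin : ∀ {R R′} → Thin R → R′ →₊₁ R → ∀ u → region u ≡ R → ∀ ε → 0# < ε →
    ∃ λ v → region v ≡ R′ × Near ε (val u) (val v)
  before-thin {R} {R′} thin R′→R@((s′ , s , s′∈R′ , s∈R , t , step) , R′≢R , _) u u∈R ε 0<ε =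
    shorten (gap (proj₂ s)) (positive-delay {s′} {t} {s} (proj₁ step) (proj₁ (proj₂ step))
      (λ e → R′≢R (≡.trans (≡.sym s′∈R′) (≡.trans e s∈R))))
    where
    Target : Set
    Target = ∃ λ v → region v ≡ R′ × Near ε (val u) (val v)
    target : ∀ t₁ → 0# < t₁ → Short (proj₂ s) t₁ →
      (∃ λ w → Delay s′ (t - t₁) w × Delay w (t - (t - t₁)) s × (region w ≡ R′ ⊎ region w ≡ R)) →
        Target
    target t₁ 0<t₁ short (w , _ , ws , w∈) = decide w∈
      where
      ws′ : Delay w t₁ s
      ws′ = proj₁ ws , λ c →
        trans (proj₂ ws c) (+-congˡ (solve 2 (λ t u → t :- (t :- u) := u) refl t t₁))
      decide : region w ≡ R′ ⊎ region w ≡ R → Target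
      decide (inj₁ w∈R′) =
        let v , v∼w , n = recently s u w {t₁} (≡.trans u∈R (≡.sym s∈R)) 0<t₁ short ws′ 0<ε in
        v , ≡.trans v∼w w∈R′ , n
      decide (inj₂ w∈R) = contradiction (≡.trans s∈R (≡.sym w∈R)) (thin w t₁ s w∈R 0<t₁ ws′)
    shorten : (∃ λ g → 0# < g × Short (proj₂ s) g) → 0# < t → Target
    shorten (g , 0<g , short) 0<t =
      let t₁ , 0<t₁ , t₁≤g , t₁≤t = positive-min 0<g 0<t in
      target t₁ 0<t₁ (short-mono (proj₂ s) {g} {t₁} t₁≤g short)
        (between-neighbours R′→R {s′} {s} s′∈R′ s∈R step
          (linear≤ t₁≤t (solve 2 (λ t u → con ℤ.0ℤ :+ t := (t :- u) :+ u) refl t t₁))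
          (linear≤ (inj₁ 0<t₁) (solve 2 (λ t u → (t :- u) :+ u := t :+ con ℤ.0ℤ) refl t t₁)))

  -- All of the geometry of a move that is used afterwards, common to its three kinds.
  record MoveFacts (R : Region) (α : SimpleTimedAction) (R′ : Region) : Set where
    field
      source∈S : R ∈Sᴿ
      target∈S : R′ ∈Sᴿ
      location : proj₁ R′ ≡ δ (proj₁ R) (proj₁ α)
      guard    : ∀ s → region s ≡ R → val s (proj₂ (proj₂ α)) ≤ bound (proj₁ (proj₂ α))
      lands    : ∀ s → region s ≡ R → Closure R′ (succ α (val s))

  private
    -- Q, the region in which the action is taken, is R″ or one of its neighbours.
    move-facts : ∀ {R a b c R″ Q R′} → BoundaryStep R b c R″ → Q →* R″ ⊎ R″ →* Q →
      (∀ u → region u ≡ R″ → ∀ ε → 0# < ε → ∃ λ v → region v ≡ Q × Near ε (val u) (val v)) →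
      RegionAction Q a R′ → MoveFacts R (a , b , c) R′
    move-facts {R} {a} {b} {c} {R″} {Q} {R′} step@(_ , R→R″ , uniform) adjacent nearby act = record
      { source∈S = proj₁ (→*⇒∈S R→R″)
      ; target∈S = proj₁ (action-facts act)
      ; location = ≡.trans (proj₂ (action-facts act))
          (cong (λ ℓ → δ ℓ a) (≡.trans (same-location adjacent) (→*-location R→R″)))
      ; guard    = boundary-guard {R} {b} {c} step
      ; lands    = lands
      }
      where
      same-location : Q →* R″ ⊎ R″ →* Q → proj₁ Q ≡ proj₁ R″
      same-location (inj₁ Q→) = ≡.sym (→*-location Q→)
      same-location (inj₂ →Q) = →*-location →Q
      lands : ∀ s → region s ≡ R → Closure R′ (succ (a , b , c) (val s))
      lands s s∈R ε 0<ε =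
        let u , d , u∈R″ = uniform s s∈R
            ε₂ , 0<ε₂ , 2ε₂ = half 0<ε
            v , v∈Q , n = nearby u u∈R″ ε₂ 0<ε₂
            s′ , s′∈R′ , h = action-reset act v v∈Q
        in s′ , s′∈R′ , near-mono {x = succ (a , b , c) (val s)} {y = val s′} (≤-reflexive 2ε₂)
          (near-trans {x = succ (a , b , c) (val s)} {y = reset (ρ a) (val v)} {z = val s′}
            (λ c′ →
              let l , r = near-reset (ρ a) {x = val u} {y = val v} 0<ε₂ n c′
                  e     = reset-cong (ρ a) (proj₂ d) c′
              in <-resp (+-congʳ e) refl l , <-resp refl (+-congʳ e) r)
            (near-≈ 0<ε₂ (λ c′ → sym (h c′))))

  𝓜-facts : ∀ {R α R′} → 𝓜 (R , α , R′) → MoveFacts R α R′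
  𝓜-facts {α = a , b , c} (boundary step act) =
    move-facts step (inj₂ (R″→R″ {b = b} {c} step)) (λ u u∈ ε 0<ε → u , u∈ ,
    near-≈ 0<ε (λ _ → refl)) act
    where
    -- The remainder of a step after its full length: a delay of 0 at `R″`, which stays in `S` as
    -- `_→*_` requires.
    R″→R″ : ∀ {R b c R″} → BoundaryStep R b c R″ → R″ →* R″
    R″→R″ (_ , (s , s′ , _ , s′∈R″ , t , step) , _) =
      let w , _ , 0≤ , d , stay = split {s} {s′} step (proj₁ step) ≤-refl in
      w , s′ , ≡.trans (≡.sym (delay-region {w} {t - t} {s′} d (-‿inverseʳ t))) s′∈R″ , s′∈R″ ,
        t - t , 0≤ , d , stay
  𝓜-facts (after _ step R″→R‴ act) =
    move-facts step (inj₂ (proj₁ R″→R‴)) (after-thin (proj₁ step) R″→R‴) act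
  𝓜-facts (before _ step R‴→R″ act) =
    move-facts step (inj₁ (proj₁ R‴→R″)) (before-thin (proj₁ step) R‴→R″) act

-- Finiteness

-- Every element is the entry of `xs` at some index, so the order can be pulled back to a strict
-- order on `Fin`.
finite⇒wellFounded : ∀ {A : Set} (xs : List A) → (∀ x → x ∈ xs) → {_<_ : Rel A 0ℓ} →
  Transitive _<_ → (∀ x → ¬ x < x) → WellFounded _<_
finite⇒wellFounded xs complete {_<_} trans irrefl x =
  subst (Acc _<_) (≡.sym (lookup-index (complete x)))
    (lift (spo-wellFounded {_⊏_ = _⊏_} isSPO (index (complete x))))
  where
  _⊏_ : Rel (Fin (length xs)) 0ℓ
  i ⊏ j = lookup xs i < lookup xs j
  isSPO : IsStrictPartialOrder _≡_ _⊏_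
  isSPO = record
    { isEquivalence = ≡.isEquivalence
    ; irrefl        = λ where ≡.refl → irrefl _
    ; trans         = trans
    ; <-resp-≈      = (λ where ≡.refl p → p) , (λ where ≡.refl p → p)
    }
  lift : ∀ {i} → Acc _⊏_ i → Acc _<_ (lookup xs i)
  lift {i} (acc rs) = acc λ {y} y<i → subst (Acc _<_) (≡.sym (lookup-index (complete y)))
    (lift (rs (subst (_< lookup xs i) (lookup-index (complete y)) y<i)))

tables : ℕ → List (List Bool)
tables zero    = [] ∷ []
tables (suc n) = List.map (true ∷_) (tables n) List.++ List.map (false ∷_) (tables n)

∈-tables : ∀ t → t ∈ tables (length t)
∈-tables []          = here ≡.refl
∈-tables (true ∷ t)  = ∈-++⁺ˡ (∈-map⁺ _ (∈-tables t))
∈-tables (false ∷ t) = ∈-++⁺ʳ (List.map (true ∷_) (tables (length t))) (∈-map⁺ _ (∈-tables t))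

module FiniteGraph (em : ExcludedMiddle 0ℓ) (ℝ : RealNumbers) (k : ℕ) (Γ : ReachabilityTimeGame ℝ k)
  where
  open RealNumbers ℝ
  open ReachabilityTimeGame Γ
  open TimedRegionGraph ℝ k Γ

  abstract
    -- The proof that a table is realised is irrelevant and cannot be inspected. Excluded middle
    -- decides the question afresh, and its negative answer contradicts the irrelevant proof.
    realisable : List (List Bool) → List ClockRegion
    realisable [] = []
    realisable (t ∷ ts) with em {∃ λ ν → signature (at ν) ≡ t}
    ... | yes r = mkClockRegion t r ∷ realisable ts
    ... | no _  = realisable ts

    ∈-realisable : ∀ {t ts} .(r : ∃ λ ν → signature (at ν) ≡ t) → t ∈ ts →
      mkClockRegion t r ∈ realisable ts
    ∈-realisable {t} r (here ≡.refl) with em {∃ λ ν → signature (at ν) ≡ t}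
    ... | yes _ = here ≡.refl
    ... | no ¬r = ⊥-elim-irr (¬r r)
    ∈-realisable {ts = t′ ∷ _} r (there p) with em {∃ λ ν → signature (at ν) ≡ t′}
    ... | yes _ = there (∈-realisable r p)
    ... | no _  = ∈-realisable r p

    clockRegions : List ClockRegion
    clockRegions = realisable (tables (length allConstraints))

    ∈-clockRegions : ∀ P → P ∈ clockRegions
    ∈-clockRegions (mkClockRegion t r) = complete em
      where
      complete : Dec (∃ λ ν → signature (at ν) ≡ t) → mkClockRegion t r ∈ clockRegions
      complete (no ¬r) = ⊥-elim-irr (¬r r)
      complete (yes (ν , e)) = ∈-realisable r (subst (λ n → t ∈ tables n)
        (≡.trans (cong length (≡.sym e)) (length-map _ allConstraints)) (∈-tables t))

    regions : List Region
    regions = cartesianProduct (allFin nL) clockRegions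

    ∈-regions : ∀ R → R ∈ regions
    ∈-regions (ℓ , P) = ∈-cartesianProduct⁺ (∈-allFin ℓ) (∈-clockRegions P)

    moves : List Move
    moves = cartesianProduct regions (cartesianProduct
      (cartesianProduct (allFin nA) (cartesianProduct (allFin (suc k)) (allFin nC))) regions)

    ∈-moves : ∀ m → m ∈ moves
    ∈-moves (R , (a , b , c) , R′) = ∈-cartesianProduct⁺ (∈-regions R) (∈-cartesianProduct⁺
      (∈-cartesianProduct⁺ (∈-allFin a) (∈-cartesianProduct⁺ (∈-allFin b) (∈-allFin c)))
        (∈-regions R′))

    inhabited : ∀ R → ∃ λ s → region s ≡ R
    inhabited (ℓ , mkClockRegion t r) = inhabited′ em
      where
      cong-table : ∀ {t t′} .{r : ∃ λ ν → signature (at ν) ≡ t}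
        .{r′ : ∃ λ ν → signature (at ν) ≡ t′} →
                   t ≡ t′ → mkClockRegion t r ≡ mkClockRegion t′ r′
      cong-table ≡.refl = ≡.refl
      inhabited′ : Dec (∃ λ ν → signature (at ν) ≡ t) → ∃ λ s → region s ≡ (ℓ , mkClockRegion t r)
      inhabited′ (yes (ν , e)) = (ℓ , ν) , cong (ℓ ,_) (cong-table e)
      inhabited′ (no ¬r)       = ⊥-elim-irr (¬r r)

-- Symbolic values

module SymbolicValues (em : ExcludedMiddle 0ℓ) (ℝ : RealNumbers) (k : ℕ)
  (Γ : ReachabilityTimeGame ℝ k) where
  open RealNumbers ℝ
  open RealArithmetic ℝ
  open ReachabilityTimeGame Γ
  open TimedRegionGraph ℝ k Γ
  open RegionGeometry ℝ k Γ
  open MoveGeometry ℝ k Γ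
  open FiniteGraph em ℝ k Γ

  -- just (f , n) stands for the pair (f , n) of functions on a region, nothing for (∞ , ∞).
  Value : Set
  Value = Maybe (Simple × ℕ)

  infix 4 _⊑[_]_ _≤ᵗ[_]_
  _⊑[_]_ _≤ᵗ[_]_ : Value → RawValuation → Value → Set
  _            ⊑[ x ] nothing      = ⊤
  nothing      ⊑[ x ] just _       = ⊥
  just (f , m) ⊑[ x ] just (g , n) = ⟦ f ⟧ x < ⟦ g ⟧ x ⊎ (⟦ f ⟧ x ≈ ⟦ g ⟧ x × m ℕ.≤ n)

  _            ≤ᵗ[ x ] nothing      = ⊤
  nothing      ≤ᵗ[ x ] just _       = ⊥
  just (f , _) ≤ᵗ[ x ] just (g , _) = ⟦ f ⟧ x ≤ ⟦ g ⟧ x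

  ⊑⇒≤ᵗ : ∀ {x} v w → v ⊑[ x ] w → v ≤ᵗ[ x ] w
  ⊑⇒≤ᵗ _        nothing  _              = tt
  ⊑⇒≤ᵗ (just _) (just _) (inj₁ p)       = inj₁ p
  ⊑⇒≤ᵗ (just _) (just _) (inj₂ (p , _)) = inj₂ p

  ⊑-refl : ∀ {x} v → v ⊑[ x ] v
  ⊑-refl nothing  = tt
  ⊑-refl (just _) = inj₂ (refl , ℕ.≤-refl)

  ⊑-trans : ∀ {x} u v w → u ⊑[ x ] v → v ⊑[ x ] w → u ⊑[ x ] w
  ⊑-trans u v nothing _ _ = tt
  ⊑-trans (just _) (just _) (just _) (inj₁ p) (inj₁ q) = inj₁ (<-trans p q)
  ⊑-trans (just _) (just _) (just _) (inj₁ p) (inj₂ (q , _)) = inj₁ (<-respʳ q p)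
  ⊑-trans (just _) (just _) (just _) (inj₂ (p , _)) (inj₁ q) = inj₁ (<-respˡ (sym p) q)
  ⊑-trans (just _) (just _) (just _) (inj₂ (p , m)) (inj₂ (q , n)) =
    inj₂ (trans p q , ℕ.≤-trans m n)

  ⊑-total : ∀ x v w → v ⊑[ x ] w ⊎ w ⊑[ x ] v
  ⊑-total x _ nothing = inj₁ tt
  ⊑-total x nothing (just _) = inj₂ tt
  ⊑-total x (just (f , m)) (just (g , n)) with compare (⟦ f ⟧ x) (⟦ g ⟧ x)
  ... | tri< p _ _ = inj₁ (inj₁ p)
  ... | tri> _ _ p = inj₂ (inj₁ p)
  ... | tri≈ _ p _ with ℕ.≤-total m n
  ...   | inj₁ q = inj₁ (inj₂ (p , q))
  ...   | inj₂ q = inj₂ (inj₂ (sym p , q))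

  ≤ᵗ-trans : ∀ {x} u v w → u ≤ᵗ[ x ] v → v ≤ᵗ[ x ] w → u ≤ᵗ[ x ] w
  ≤ᵗ-trans u v nothing _ _ = tt
  ≤ᵗ-trans (just _) (just _) (just _) p q = ≤-trans p q

  -- At points of a closure only the time components can be compared:
  -- strict inequalities on a region may become equalities on its boundary.
  ≤ᵗ-closure : ∀ {R} v w → (∀ s → region s ≡ R → v ≤ᵗ[ val s ] w) → ∀ {x} → Closure R x →
    v ≤ᵗ[ x ] w
  ≤ᵗ-closure _ nothing _ _ = tt
  ≤ᵗ-closure {R} nothing (just _) h _ = let s , s∈R = inhabited R in h s s∈R
  ≤ᵗ-closure (just (f , _)) (just (g , _)) h x∈ = closure-≤ f g h x∈

  ⊑-region : ∀ s s′ → region s ≡ region s′ → ∀ v w → v ⊑[ val s ] w → v ⊑[ val s′ ] w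
  ⊑-region s s′ e _ nothing _ = tt
  ⊑-region s s′ e (just (f , _)) (just (g , _)) (inj₁ p) =
    inj₁ (≰⇒> (λ q → <⇒≱ p (simple-≤ s′ s (≡.sym e) g f q)))
  ⊑-region s s′ e (just (f , _)) (just (g , _)) (inj₂ (p , q)) =
    inj₂ (≤-antisym (simple-≤ s s′ e f g (≤-reflexive p))
      (simple-≤ s s′ e g f (≤-reflexive (sym p))) , q)

  -- Simple functions are closed under adding the delay `b - x(c)` of a move. If `c′` is reset, the
  -- value after the move is the integer `e` and the delay is added to it; if not, `c′` has itself
  -- grown by the delay, which cancels.
  shiftSimple : SimpleTimedAction → Simple → Simple
  shiftSimple (a , b , c) (e , nothing) = (+ toℕ b) ℤ.+ e , just c
  shiftSimple (a , b , c) (e , just c′) =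
    if ρ a c′ then ((+ toℕ b) ℤ.+ e , just c) else (e , just c′)

  shift-⟦⟧ : ∀ a b c f x → ⟦ shiftSimple (a , b , c) f ⟧ x ≈ (bound b - x c) + ⟦ f ⟧
    (succ (a , b , c) x)
  shift-⟦⟧ a b c (e , nothing) x = trans (+-congʳ (fromℤ-+ (+ toℕ b) e))
    (solve 3 (λ b e x → (b :+ e) :- x := (b :- x) :+ (e :- con ℤ.0ℤ)) refl (bound b) (fromℤ e)
      (x c))
  shift-⟦⟧ a b c (e , just c′) x with ρ a c′
  ... | true  = trans (+-congʳ (fromℤ-+ (+ toℕ b) e))
    (solve 3 (λ b e x → (b :+ e) :- x := (b :- x) :+ (e :- con ℤ.0ℤ)) refl (bound b) (fromℤ e)
      (x c))
  ... | false =
    solve 4 (λ b e x y → e :- y := (b :- x) :+ (e :- (y :+ (b :- x)))) refl (bound b) (fromℤ e)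
    (x c) (x c′)

  shift : SimpleTimedAction → Value → Value
  shift α nothing        = nothing
  shift α (just (f , n)) = just (shiftSimple α f , suc n)

  shift-≤ᵗ : ∀ α {x} v w → v ≤ᵗ[ succ α x ] w → shift α v ≤ᵗ[ x ] shift α w
  shift-≤ᵗ α v nothing _ = tt
  shift-≤ᵗ (a , b , c) {x} (just (f , _)) (just (g , _)) p =
    ≤-resp (sym (shift-⟦⟧ a b c f x)) (sym (shift-⟦⟧ a b c g x)) (+-monoʳ-≤ _ p)

  Valuing : Set
  Valuing = Region → Value

  target : Move → Region
  target (_ , _ , R′) = R′

  moveVal : Valuing → Move → Value
  moveVal W (_ , α , R′) = shift α (W R′)

  -- Zero need not have the symbol `0`: on a region where the clock `c` equals `e`, the function
  -- `e - x(c)` vanishes as well.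
  record Final (W : Valuing) (R : Region) : Set where
    constructor final
    field
      {zeroᶠ} : Simple
      W≡      : W R ≡ just (zeroᶠ , 0)
      ≈0      : ∀ s → region s ≡ R → ⟦ zeroᶠ ⟧ (val s) ≈ 0#

  -- The upper half of the optimality equations for Max; this half survives when moves of Min are
  -- replaced by better ones.
  record Bounding (G : Pred Move 0ℓ) (W : Valuing) : Set where
    field
      atFinal : ∀ R → R ∈Fᴿ → Final W R
      bounds  : ∀ m → G m → ¬ source m ∈Fᴿ → ∀ s → region s ≡ source m →
        moveVal W m ⊑[ val s ] W (source m)

  record Solves (G : Pred Move 0ℓ) (W : Valuing) : Set where
    field
      bounding : Bounding G W
      attained : ∀ R → R ∈Sᴿ → ¬ R ∈Fᴿ → ∃ λ m → G m × source m ≡ R ×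
                 (∀ s → region s ≡ R → W R ⊑[ val s ] moveVal W m)
    open Bounding bounding public

  closure-nonneg : ∀ {R x} → Closure R x → ∀ c → 0# ≤ x c
  closure-nonneg {x = x} x∈ c = linear≤ (closure-≤ (+ 0 , just c) (+ 0 , nothing)
      (λ s _ → linear≤ (proj₁ (bounded (proj₂ s) c))
        (solve 1 (λ x → (con ℤ.0ℤ :- x) :+ x := (con ℤ.0ℤ :- con ℤ.0ℤ) :+ con ℤ.0ℤ) refl (val s c)))
        x∈)
    (solve 1 (λ x → con ℤ.0ℤ :+ (con ℤ.0ℤ :- con ℤ.0ℤ) := x :+ (con ℤ.0ℤ :- x)) refl (x c))

  module _ {R a b c R′} (facts : MoveFacts R (a , b , c) R′) {x} (x∈R : Closure R x) where
    open MoveFacts facts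

    target-Closure : Closure R′ (succ (a , b , c) x)
    target-Closure = succ-Closure (a , b , c) lands x∈R

    delay-nonneg : 0# ≤ bound b - x c
    delay-nonneg = ≤-resp (solve 0 (con ℤ.0ℤ :- con ℤ.0ℤ := con ℤ.0ℤ) refl) refl
      (closure-≤ (+ 0 , nothing) (+ toℕ b , just c)
        (λ s s∈R → linear≤ (guard s s∈R)
          (solve 2 (λ x b → (con ℤ.0ℤ :- con ℤ.0ℤ) :+ b := (b :- x) :+ x) refl (val s c) (bound b)))
          x∈R)

    succ-≤ : ∀ c′ → succ (a , b , c) x c′ ≤ x c′ + (bound b - x c)
    succ-≤ c′ with ρ a c′
    ... | true  = ≤-resp (+-identityˡ 0#) refl (closure-nonneg x∈R c′ ⊕≤ delay-nonneg)
    ... | false = ≤-refl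

  -- Upper bounds along moves

  module Descent {G : Pred Move 0ℓ} (G⊆𝓜 : G ⊆ 𝓜) {W : Valuing} (bounding : Bounding G W) where
    open Bounding bounding

    Edge : Rel Region 0ℓ
    Edge R R′ = ∃ λ α → G (R , α , R′) × ¬ R ∈Fᴿ × ∃ λ v → W R ≡ just v

    -- The default 0 is harmless, since an edge has finite values at both ends.
    rank : Region → ℕ
    rank R with W R
    ... | just (_ , n) = n
    ... | nothing      = 0

    rank-≡ : ∀ {R f n} → W R ≡ just (f , n) → rank R ≡ n
    rank-≡ {R} e with W R
    rank-≡ ≡.refl | _ = ≡.refl

    record Strict (R R′ : Region) : Set where
      field
        {action} : SimpleTimedAction
        move     : G (R , action , R′)
        ¬final   : ¬ R ∈Fᴿ
        {f f′}   : Simple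
        {n n′}   : ℕ
        W≡       : W R ≡ just (f , n)
        W′≡      : W R′ ≡ just (f′ , n′)
        strict   : ∀ s → region s ≡ R → ⟦ shiftSimple action f′ ⟧ (val s) < ⟦ f ⟧ (val s)

    -- The lexicographic bound at one configuration is either strict in time, and then strict on the
    -- whole region by `simple-≤`, or an equality in time, and then the step added by `shift` forces
    -- a smaller count at the target.
    strict-or-lower : ∀ {R R′} → Edge R R′ → Strict R R′ ⊎ rank R′ ℕ.< rank R
    strict-or-lower {R} {R′} (α , g , ¬F , (f , n) , W≡) = compareTo (W R′) ≡.refl
      where
      s = proj₁ (inhabited R)
      s∈R = proj₂ (inhabited R)
      bound′ : ∀ {v} → W R′ ≡ v → shift α v ⊑[ val s ] just (f , n)
      bound′ e = ≡.subst₂ (λ v w → shift α v ⊑[ val s ] w) e W≡ (bounds _ g ¬F s s∈R)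
      decide : ∀ f′ n′ → W R′ ≡ just (f′ , n′) → shift α (just (f′ , n′)) ⊑[ val s ] just (f , n) →
        Strict R R′ ⊎ rank R′ ℕ.< rank R
      decide f′ n′ W′≡ (inj₁ p) = inj₁ (record
        { move = g ; ¬final = ¬F ; W≡ = W≡ ; W′≡ = W′≡
        ; strict = λ s′ s′∈R →
            ≰⇒> (λ q → <⇒≱ p (simple-≤ s′ s (≡.trans s′∈R (≡.sym s∈R)) f (shiftSimple α f′) q)) })
      decide f′ n′ W′≡ (inj₂ (_ , n′<n)) =
        inj₂ (≡.subst₂ ℕ._<_ (≡.sym (rank-≡ W′≡)) (≡.sym (rank-≡ W≡)) n′<n)
      compareTo : ∀ v → W R′ ≡ v → Strict R R′ ⊎ rank R′ ℕ.< rank R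
      compareTo nothing e with () ← bound′ e
      compareTo (just (f′ , n′)) e = decide f′ n′ e (bound′ e)

    -- What is kept of a path once its intermediate points are forgotten; each inequality composes.
    -- They are weak because after a move the point is known only to lie in a closure.
    record Reaches (x : RawValuation) (f : Simple) (R′ : Region) : Set where
      field
        {x′}  : RawValuation
        {t}   : Carrier
        {f′}  : Simple
        {n′}  : ℕ
        x′∈   : Closure R′ x′
        W′≡   : W R′ ≡ just (f′ , n′)
        0≤t   : 0# ≤ t
        value : t + ⟦ f′ ⟧ x′ ≤ ⟦ f ⟧ x
        grows : ∀ c → x′ c ≤ x c + t

    step : ∀ {R R′ f n x} → Edge R R′ → Closure R x → W R ≡ just (f , n) → Reaches x f R′
    step {R} {R′} {f} {n} {x} (α@(a , b , c) , g , ¬F , _) x∈R W≡ = finite (W R′) ≡.refl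
      where
      facts : MoveFacts R α R′
      facts = 𝓜-facts (G⊆𝓜 g)
      bound′ : shift α (W R′) ≤ᵗ[ x ] just (f , n)
      bound′ = ≤ᵗ-closure (shift α (W R′)) (just (f , n))
        (λ s s∈R → subst (shift α (W R′) ≤ᵗ[ val s ]_) W≡
          (⊑⇒≤ᵗ (shift α (W R′)) (W R) (bounds _ g ¬F s s∈R))) x∈R
      finite : ∀ v → W R′ ≡ v → Reaches x f R′
      finite nothing e with () ← subst (λ v → shift α v ≤ᵗ[ x ] just (f , n)) e bound′
      finite (just (f′ , n′)) e = record
        { x′∈   = target-Closure facts x∈R
        ; W′≡   = e
        ; 0≤t   = delay-nonneg facts x∈R
        ; value = ≤-resp (shift-⟦⟧ a b c f′ x) refl
            (subst (λ v → shift α v ≤ᵗ[ x ] just (f , n)) e bound′)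
        ; grows = succ-≤ facts x∈R
        }

    reaches-trans : ∀ {x f R R′} (P : Reaches x f R) → Reaches (Reaches.x′ P) (Reaches.f′ P) R′ →
      Reaches x f R′
    reaches-trans {x} {f} P Q = record
      { x′∈   = Q.x′∈
      ; W′≡   = Q.W′≡
      ; 0≤t   = ≤-resp (+-identityˡ 0#) refl (P.0≤t ⊕≤ Q.0≤t)
      ; value = linear≤ (P.value ⊕≤ Q.value)
          (solve 5 (λ t u y z w → ((t :+ u) :+ w) :+ (y :+ z) := y :+ ((t :+ z) :+ (u :+ w))) refl
                  P.t Q.t (⟦ f ⟧ x) (⟦ P.f′ ⟧ P.x′) (⟦ Q.f′ ⟧ Q.x′))
      ; grows = λ c →
          linear≤ (P.grows c ⊕≤ Q.grows c)
          (solve 5 (λ t u x y z → z :+ ((x :+ t) :+ (y :+ u)) := (x :+ (t :+ u)) :+ (y :+ z)) refl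
                  P.t Q.t (x c) (P.x′ c) (Q.x′ c))
      }
      where
      module P = Reaches P
      module Q = Reaches Q

    path : ∀ {R R′ f n x} → Star Edge R R′ → Closure R x → W R ≡ just (f , n) → Reaches x f R′
    path {x = x} Star.ε x∈R W≡ = record
      { x′∈   = x∈R
      ; W′≡   = W≡
      ; 0≤t   = ≤-refl {0#}
      ; value = ≤-reflexive (+-identityˡ _)
      ; grows = λ c → ≤-reflexive (sym (+-identityʳ (x c)))
      }
    path (e ◅ es) x∈R W≡ = reaches-trans P (path es (Reaches.x′∈ P) (Reaches.W′≡ P))
      where P = step e x∈R W≡

    -- A simple function decreases by at most t along a delay of t, with resets,
    -- so that its value plus the elapsed time cannot decrease around a cycle.
    drops-≤ : ∀ {x f′ R′} (P : Reaches x f′ R′) f →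
      ⟦ f ⟧ x ≤ Reaches.t P + ⟦ f ⟧ (Reaches.x′ P)
    drops-≤ {x = x} P (e , d) = linear≤ (grows-offset d)
      (solve 4 (λ e x x′ t → (e :- x) :+ (x :+ t) := (t :+ (e :- x′)) :+ x′) refl (fromℤ e)
        (x ⟨ d ⟩) (x′ ⟨ d ⟩) t)
      where
      open Reaches P
      grows-offset : ∀ d → x′ ⟨ d ⟩ ≤ x ⟨ d ⟩ + t
      grows-offset (just c) = grows c
      grows-offset nothing  = ≤-resp refl (sym (+-identityˡ _)) 0≤t

    -- Back at `R` the bound is the same symbolic function `f`. The elapsed time plus its new value
    -- would be strictly below `⟦ f ⟧ x`, contradicting `drops-≤`.
    no-return : ∀ {R R₁ f n x} → W R ≡ just (f , n) → (P : Reaches x f R₁) →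
      Reaches.t P + ⟦ Reaches.f′ P ⟧ (Reaches.x′ P) < ⟦ f ⟧ x →
        ¬ Reaches (Reaches.x′ P) (Reaches.f′ P) R
    no-return {f = f} {x = x} W≡ P drop Q with ≡.trans (≡.sym W≡) (Reaches.W′≡ Q)
    ... | ≡.refl = <⇒≱
      (linear< (Q.value ⊕< drop)
        (solve 5 (λ t u y z w → ((t :+ u) :+ z) :+ (w :+ y) := y :+ ((u :+ z) :+ (t :+ w))) refl
        P.t Q.t (⟦ f ⟧ x) (⟦ f ⟧ Q.x′) (⟦ P.f′ ⟧ P.x′)))
      (drops-≤ (reaches-trans P Q) f)
      where
      module P = Reaches P
      module Q = Reaches Q

    -- The cycle is run from a configuration inside `R`, where the strict inequality is available;
    -- the remaining moves need only preserve it weakly.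
    no-strict-cycle : ∀ {R R₁} → Strict R R₁ → ¬ Star Edge R₁ R
    no-strict-cycle {R} {R₁} st es =
      no-return W≡ P drop (path es (target-Closure facts x∈R) W′≡)
      where
      open Strict st renaming (f to f₀; f′ to f₁; action to α)
      s = proj₁ (inhabited R)
      s∈R = proj₂ (inhabited R)
      x = val s
      a = proj₁ α
      b = proj₁ (proj₂ α)
      c = proj₂ (proj₂ α)
      facts : MoveFacts R α R₁
      facts = 𝓜-facts (G⊆𝓜 move)
      x∈R : Closure R x
      x∈R = subst (λ R → Closure R x) s∈R (region⊆Closure s)
      drop : (bound b - x c) + ⟦ f₁ ⟧ (succ α x) < ⟦ f₀ ⟧ x
      drop = <-resp (shift-⟦⟧ a b c f₁ x) refl (strict s s∈R)
      P : Reaches x f₀ R₁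
      P = record
        { x′∈   = target-Closure facts x∈R
        ; W′≡   = W′≡
        ; 0≤t   = delay-nonneg facts x∈R
        ; value = inj₁ drop
        ; grows = succ-≤ facts x∈R
        }

    strict-or-lower* : ∀ {R R′} → Star Edge R R′ →
      (∃₂ λ A B → Star Edge R A × Strict A B × Star Edge B R′) ⊎ rank R′ ℕ.≤ rank R
    strict-or-lower* Star.ε = inj₂ ℕ.≤-refl
    strict-or-lower* {R} (e ◅ es) with strict-or-lower e
    ... | inj₁ st = inj₁ (R , _ , Star.ε , st , es)
    ... | inj₂ lower with strict-or-lower* es
    ...   | inj₁ (A , B , p , st , q) = inj₁ (A , B , e ◅ p , st , q)
    ...   | inj₂ q = inj₂ (ℕ.≤-trans q (ℕ.<⇒≤ lower))

    no-cycle : ∀ {R R₁} → Edge R R₁ → ¬ Star Edge R₁ R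
    no-cycle e es with strict-or-lower e
    ... | inj₁ st = no-strict-cycle st es
    ... | inj₂ lower with strict-or-lower* es
    -- A strict edge further along: the cycle is rotated so as to begin with it.
    ...   | inj₁ (A , B , p , st , q) = no-strict-cycle st (q ◅◅ (e ◅ p))
    ...   | inj₂ q = ℕ.<⇒≱ lower q

    _≺_ : Rel Region 0ℓ
    R′ ≺ R = Edge R R′

    -- Absence of cycles makes the transitive closure a strict order on a finite set.
    ≺-wellFounded : WellFounded _≺_
    ≺-wellFounded = Subrelation.wellFounded {_<₁_ = _≺_} {_<₂_ = _≺⁺_} (λ e → _ , e , Star.ε)
      (finite⇒wellFounded regions ∈-regions {_≺⁺_} (λ (_ , e , es) (_ , e′ , es′) → _ , e′ ,
        es′ ◅◅ (e ◅ es)) (λ R (_ , e , es) → no-cycle e es))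
      where
      _≺⁺_ : Rel Region 0ℓ
      R′ ≺⁺ R = ∃ λ R₁ → Edge R R₁ × Star Edge R₁ R′

  -- Comparing solutions

  TimeLe LexLe : Rel Valuing 0ℓ
  TimeLe W W′ = ∀ R → R ∈Sᴿ → ∀ s → region s ≡ R → W R ≤ᵗ[ val s ] W′ R
  LexLe  W W′ = ∀ R → R ∈Sᴿ → ∀ s → region s ≡ R → W R ⊑[ val s ] W′ R

  -- Lexicographic improvement is not monotone along moves (see ≤ᵗ-closure);
  -- instead all times are compared first, and the step counts only if the times agree everywhere.
  infix 4 _≼_
  _≼_ : Rel Valuing 0ℓ
  W ≼ W′ = TimeLe W W′ × (TimeLe W′ W → LexLe W W′)

  -- If the outer times agree, the middle ones are squeezed between them, so both step comparisons
  -- become available.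
  ≼-trans : ∀ {W W′ W″} → W ≼ W′ → W′ ≼ W″ → W ≼ W″
  ≼-trans {W} {W′} {W″} (p , p′) (q , q′) = timeLe , λ r R R∈S s s∈R →
    ⊑-trans (W R) (W′ R) (W″ R)
      (p′ (λ R R∈S s s∈R → ≤ᵗ-trans (W′ R) (W″ R) (W R) (q R R∈S s s∈R) (r R R∈S s s∈R))
        R R∈S s s∈R)
      (q′ (λ R R∈S s s∈R → ≤ᵗ-trans (W″ R) (W R) (W′ R) (r R R∈S s s∈R) (p R R∈S s s∈R))
        R R∈S s s∈R)
    where
    timeLe : TimeLe W W″
    timeLe R R∈S s s∈R = ≤ᵗ-trans (W R) (W′ R) (W″ R) (p R R∈S s s∈R) (q R R∈S s s∈R)

  final-⊑ : ∀ {W W′ R} → Final W R → Final W′ R → ∀ s → region s ≡ R → W R ⊑[ val s ] W′ R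
  final-⊑ F F′ s s∈R = ≡.subst₂ (_⊑[ val s ]_) (≡.sym F.W≡) (≡.sym F′.W≡)
    (inj₂ (trans (F.≈0 s s∈R) (sym (F′.≈0 s s∈R)) , z≤n))
    where
    module F = Final F
    module F′ = Final F′

  -- Equality of times on `R` consists of two weak inequalities and so extends to the closure; this
  -- is what allows steps to be compared at a point reached by a move.
  shift-⊑ : ∀ α v w {R x} → (∀ s → region s ≡ R → v ⊑[ val s ] w) →
    (∀ s → region s ≡ R → w ≤ᵗ[ val s ] v) →
    Closure R (succ α x) → shift α v ⊑[ x ] shift α w
  shift-⊑ α v nothing _ _ _ = tt
  shift-⊑ α nothing (just _) {R} h _ _ = let s , s∈R = inhabited R in h s s∈R
  shift-⊑ (a , b , c) (just (f , m)) (just (g , n)) {R} {x} h h′ x∈ = inj₂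
    (trans (shift-⟦⟧ a b c f x) (trans (+-congˡ (≤-antisym
       (closure-≤ f g (λ s s∈R → ⊑⇒≤ᵗ (just (f , m)) (just (g , n)) (h s s∈R)) x∈)
         (closure-≤ g f h′ x∈))) (sym (shift-⟦⟧ a b c g x))) ,
     s≤s (let s , s∈R = inhabited R in steps (h s s∈R) (h′ s s∈R)))
    where
    steps : ∀ {y z} → y < z ⊎ (y ≈ z × m ℕ.≤ n) → z ≤ y → m ℕ.≤ n
    steps (inj₁ y<z) z≤y = contradiction z≤y (<⇒≱ y<z)
    steps (inj₂ (_ , m≤n)) _ = m≤n

  -- Each pass follows the move that attains `W′`, but the induction is well-founded because `W` is
  -- finite at its source; where `W` is ∞ there is nothing to show. The second pass may assume that
  -- all times agree. Applied to two solutions of one graph, this is also uniqueness up to `_≼_`.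
  solution-least : ∀ {G W W′} → G ⊆ 𝓜 → Bounding G W → Solves G W′ → W′ ≼ W
  solution-least {G} {W} {W′} G⊆𝓜 bounding solves =
    (λ R R∈S s s∈R → timeLe R (≺-wellFounded R) R∈S s s∈R) ,
      (λ W≤W′ R R∈S s s∈R → lexLe W≤W′ R (≺-wellFounded R) R∈S s s∈R)
    where
    open Descent G⊆𝓜 bounding
    module B = Bounding bounding
    module V = Solves solves

    edge? : ∀ R v → W R ≡ v → v ≡ nothing ⊎ ∃ λ u → W R ≡ just u
    edge? R nothing  e = inj₁ ≡.refl
    edge? R (just u) e = inj₂ (u , e)

    ⊑-∞ : ∀ {x} v {w} → w ≡ nothing → v ⊑[ x ] w
    ⊑-∞ v ≡.refl = tt

    timeLe : ∀ R → Acc _≺_ R → R ∈Sᴿ → ∀ s → region s ≡ R → W′ R ≤ᵗ[ val s ] W R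
    timeLe R (acc rs) R∈S s s∈R = cases (em {R ∈Fᴿ}) (edge? R (W R) ≡.refl)
      where
      cases : Dec (R ∈Fᴿ) → W R ≡ nothing ⊎ (∃ λ u → W R ≡ just u) → W′ R ≤ᵗ[ val s ] W R
      cases (yes R∈F) _ = ⊑⇒≤ᵗ (W′ R) (W R) (final-⊑ (V.atFinal R R∈F) (B.atFinal R R∈F) s s∈R)
      cases (no _) (inj₁ e) = ⊑⇒≤ᵗ (W′ R) (W R) (⊑-∞ (W′ R) e)
      cases (no R∉F) (inj₂ u) with V.attained R R∈S R∉F
      ... | m@(.R , α , R′) , g , ≡.refl , W′≤ =
        ≤ᵗ-trans (W′ R) (moveVal W′ m) (W R) (⊑⇒≤ᵗ (W′ R) (moveVal W′ m) (W′≤ s s∈R))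
          (≤ᵗ-trans (moveVal W′ m) (moveVal W m) (W R)
            (shift-≤ᵗ α (W′ R′) (W R′)
              (≤ᵗ-closure (W′ R′) (W R′) (timeLe R′ (rs (α , g , R∉F , u)) target∈S) (lands s s∈R)))
            (⊑⇒≤ᵗ (moveVal W m) (W R) (B.bounds m g R∉F s s∈R)))
        where open MoveFacts (𝓜-facts (G⊆𝓜 g))

    lexLe : TimeLe W W′ → ∀ R → Acc _≺_ R → R ∈Sᴿ → ∀ s → region s ≡ R → W′ R ⊑[ val s ] W R
    lexLe W≤W′ R (acc rs) R∈S s s∈R = cases (em {R ∈Fᴿ}) (edge? R (W R) ≡.refl)
      where
      cases : Dec (R ∈Fᴿ) → W R ≡ nothing ⊎ (∃ λ u → W R ≡ just u) → W′ R ⊑[ val s ] W R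
      cases (yes R∈F) _ = final-⊑ (V.atFinal R R∈F) (B.atFinal R R∈F) s s∈R
      cases (no _) (inj₁ e) = ⊑-∞ (W′ R) e
      cases (no R∉F) (inj₂ u) with V.attained R R∈S R∉F
      ... | m@(.R , α , R′) , g , ≡.refl , W′≤ =
        ⊑-trans (W′ R) (moveVal W′ m) (W R) (W′≤ s s∈R)
          (⊑-trans (moveVal W′ m) (moveVal W m) (W R)
            (shift-⊑ α (W′ R′) (W R′) (lexLe W≤W′ R′ (rs (α , g , R∉F , u)) target∈S)
              (W≤W′ R′ target∈S) (lands s s∈R))
            (B.bounds m g R∉F s s∈R))
        where open MoveFacts (𝓜-facts (G⊆𝓜 g))

-- Regional functions and their symbolic values

module Representation (em : ExcludedMiddle 0ℓ) (ℝ : RealNumbers) (k : ℕ)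
  (Γ : ReachabilityTimeGame ℝ k) where
  open RealNumbers ℝ
  open RealArithmetic ℝ
  open ReachabilityTimeGame Γ
  open TimedRegionGraph ℝ k Γ
  open RegionGeometry ℝ k Γ
  open MoveGeometry ℝ k Γ
  open FiniteGraph em ℝ k Γ
  open SymbolicValues em ℝ k Γ

  ⟪_⟫ : Value → RawValuation → ℝ∞ × ℕ∞
  ⟪ nothing ⟫      x = ⊤⁺ , ⊤⁺
  ⟪ just (f , n) ⟫ x = [ ⟦ f ⟧ x ] , [ n ]

  module _ {x : RawValuation} where
    ⊑⇒≤ˡᵉˣ : ∀ {a b} v w → a ≈ˡᵉˣ ⟪ v ⟫ x → b ≈ˡᵉˣ ⟪ w ⟫ x → v ⊑[ x ] w → a ≤ˡᵉˣ b
    ⊑⇒≤ˡᵉˣ nothing nothing (SupEquality.⊤⁺≈⊤⁺ , ≡.refl) (SupEquality.⊤⁺≈⊤⁺ , ≡.refl) _ =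
      inj₂ (SupEquality.⊤⁺≈⊤⁺ , (⊤⁺ SupNonStrict.≤⊤⁺))
    ⊑⇒≤ˡᵉˣ (just _) nothing (SupEquality.[ p ] , ≡.refl) (SupEquality.⊤⁺≈⊤⁺ , ≡.refl) _ =
      inj₁ SupStrict.[ _ ]<⊤⁺
    ⊑⇒≤ˡᵉˣ (just _) (just _) (SupEquality.[ p ] , ≡.refl) (SupEquality.[ q ] , ≡.refl) (inj₁ r) =
      inj₁ SupStrict.[ <-resp (sym p) (sym q) r ]
    ⊑⇒≤ˡᵉˣ (just _) (just _) (SupEquality.[ p ] , ≡.refl) (SupEquality.[ q ] , ≡.refl)
      (inj₂ (r , l)) =
      inj₂ (SupEquality.[ trans p (trans r (sym q)) ] , SupNonStrict.[ l ])

    ≤ˡᵉˣ⇒⊑ : ∀ {a b} v w → a ≈ˡᵉˣ ⟪ v ⟫ x → b ≈ˡᵉˣ ⟪ w ⟫ x → a ≤ˡᵉˣ b → v ⊑[ x ] w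
    ≤ˡᵉˣ⇒⊑ _ nothing _ _ _ = tt
    ≤ˡᵉˣ⇒⊑ nothing (just _) (SupEquality.⊤⁺≈⊤⁺ , ≡.refl) (SupEquality.[ q ] , ≡.refl) (inj₁ ())
    ≤ˡᵉˣ⇒⊑ nothing (just _) (SupEquality.⊤⁺≈⊤⁺ , ≡.refl) (SupEquality.[ q ] , ≡.refl)
      (inj₂ (() , _))
    ≤ˡᵉˣ⇒⊑ (just _) (just _) (SupEquality.[ p ] , ≡.refl) (SupEquality.[ q ] , ≡.refl)
      (inj₁ SupStrict.[ r ]) =
      inj₁ (<-resp p q r)
    ≤ˡᵉˣ⇒⊑ (just _) (just _) (SupEquality.[ p ] , ≡.refl) (SupEquality.[ q ] , ≡.refl)
      (inj₂ (SupEquality.[ r ] , SupNonStrict.[ l ])) =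
      inj₂ (trans (sym p) (trans r q) , l)

    ⊑-antisym : ∀ {a b} v w → a ≈ˡᵉˣ ⟪ v ⟫ x → b ≈ˡᵉˣ ⟪ w ⟫ x → v ⊑[ x ] w → w ⊑[ x ] v → a ≈ˡᵉˣ b
    ⊑-antisym nothing nothing (SupEquality.⊤⁺≈⊤⁺ , ≡.refl) (SupEquality.⊤⁺≈⊤⁺ , ≡.refl) _ _ =
      SupEquality.⊤⁺≈⊤⁺ , ≡.refl
    ⊑-antisym (just u) (just u′) (SupEquality.[ p ] , ≡.refl) (SupEquality.[ q ] , ≡.refl) r r′ =
      SupEquality.[ trans p (trans (proj₁ (equal r r′)) (sym q)) ] , cong [_] (proj₂ (equal r r′))
      where
      equal : just u ⊑[ x ] just u′ → just u′ ⊑[ x ] just u → ⟦ proj₁ u ⟧ x ≈ ⟦ proj₁ u′ ⟧ x ×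
        proj₂ u ≡ proj₂ u′
      equal (inj₁ p) q = contradiction (⊑⇒≤ᵗ (just u′) (just u) q) (<⇒≱ p)
      equal (inj₂ (e , _)) (inj₁ q) = contradiction (≤-reflexive e) (<⇒≱ q)
      equal (inj₂ (e , l)) (inj₂ (_ , l′)) = e , ℕ.≤-antisym l l′

    ≈ˡᵉˣ⇒⊑ : ∀ {a b} v w → a ≈ˡᵉˣ ⟪ v ⟫ x → b ≈ˡᵉˣ ⟪ w ⟫ x → a ≈ˡᵉˣ b → v ⊑[ x ] w
    ≈ˡᵉˣ⇒⊑ _ nothing _ _ _ = tt
    ≈ˡᵉˣ⇒⊑ nothing (just _) (SupEquality.⊤⁺≈⊤⁺ , ≡.refl) (SupEquality.[ q ] , ≡.refl) (() , _)
    ≈ˡᵉˣ⇒⊑ (just _) (just _) (SupEquality.[ p ] , ≡.refl) (SupEquality.[ q ] , ≡.refl)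
      (SupEquality.[ r ] , ≡.refl) =
      inj₂ (trans (sym p) (trans r q) , ℕ.≤-refl)

  -- Required on closures, since moves evaluate the functions there, and only at regions of `S`,
  -- since the optimality equations say nothing about the others.
  Represents : Valuing → TimeFunction → StepFunction → Set
  Represents W T D = ∀ R → R ∈Sᴿ → ∀ p → closure R p → (T R p , D R p) ≈ˡᵉˣ ⟪ W R ⟫ (proj₂ p)

  point∈closure : ∀ s → closure (region s) (point s)
  point∈closure s = Closure⇒closure (region⊆Closure s)

  Succ∈closure : ∀ {R a b c R′} → MoveFacts R (a , b , c) R′ → ∀ s → region s ≡ R →
    closure R′ (Succ s (a , b , c))
  Succ∈closure {a = a} {b} {c} {R′} facts s ≡.refl =
    subst (closure R′)
      (≡.trans (cong (λ ℓ → ℓ , succ (a , b , c) (val s)) location)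
      (≡.sym (Succ-≡ s (guard s ≡.refl))))
      (Closure⇒closure (lands s ≡.refl))
    where open MoveFacts facts

  module _ (W : Valuing) (T : TimeFunction) (D : StepFunction) (rep : Represents W T D) where
    valueAt-represents : ∀ s → s ∈S → valueAt T D s ≈ˡᵉˣ ⟪ W (region s) ⟫ (val s)
    valueAt-represents s s∈S = rep (region s) s∈S (point s) (point∈closure s)

    moveValue-represents : ∀ s m → 𝓜 m → source m ≡ region s →
      moveValue T D s m ≈ˡᵉˣ ⟪ moveVal W m ⟫ (val s)
    moveValue-represents s (_ , α@(a , b , c) , R′) g ≡.refl =
      add (W R′) (rep R′ target∈S (Succ s α) (Succ∈closure facts s ≡.refl))
      where
      facts = 𝓜-facts g
      open MoveFacts facts
      add : ∀ {y n} v → (y , n) ≈ˡᵉˣ ⟪ v ⟫ (proj₂ (Succ s α)) →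
        (addTime (delay s α) y , addStep n) ≈ˡᵉˣ ⟪ shift α v ⟫ (val s)
      add nothing (SupEquality.⊤⁺≈⊤⁺ , ≡.refl) = SupEquality.⊤⁺≈⊤⁺ , ≡.refl
      add (just (f , _)) (SupEquality.[ p ] , ≡.refl) = SupEquality.[ trans (+-cong
        (subst (λ t → t ≈ bound b - val s c) (≡.sym (delay-≡ s {a} (guard s ≡.refl))) refl)
        (trans p (subst (λ q → ⟦ f ⟧ (proj₂ q) ≈ ⟦ f ⟧ (succ α (val s)))
          (≡.sym (Succ-≡ s {a} (guard s ≡.refl))) refl)))
        (sym (shift-⟦⟧ a b c f (val s))) ] , ≡.refl

  F⊆Sᴿ : ∀ {R} → R ∈Fᴿ → R ∈Sᴿ
  F⊆Sᴿ {R} R∈F = let s , s∈R = inhabited R in subst _∈Sᴿ s∈R (F⊆S s (subst _∈Fᴿ (≡.sym s∈R) R∈F))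

  -- Solutions of Opt_Max and symbolic solutions

  module _ {G : Pred Move 0ℓ} (G⊆𝓜 : G ⊆ 𝓜) {T : TimeFunction} {D : StepFunction}
    (opt : OptMax T D G) where
    represents⇒solves : ∀ {W} → Represents W T D → Solves G W
    represents⇒solves {W} rep = record
      { bounding = record
        { atFinal = λ R R∈F → let s , s∈R = inhabited R in finalAt R R∈F s s∈R
        ; bounds  = λ m g ∉F s s∈ → bounds m g ∉F s s∈
        }
      ; attained = λ R R∈S R∉F → let s , s∈R = inhabited R in attain R R∈S R∉F s s∈R
      }
      where
      finalAt : ∀ R → R ∈Fᴿ → ∀ s → region s ≡ R → Final W R
      finalAt R R∈F s s∈R = result (W R) ≡.refl
        where
        at-zero : ∀ v → W R ≡ v → ∀ s → region s ≡ R → ([ 0# ] , [ 0 ]) ≈ˡᵉˣ ⟪ v ⟫ (val s)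
        at-zero v e s ≡.refl = subst (λ v → ([ 0# ] , [ 0 ]) ≈ˡᵉˣ ⟪ v ⟫ (val s)) e
          (transfer (W R) (valueAt-represents W T D rep s (F⊆Sᴿ R∈F)) (proj₁ opt s R∈F))
          where
          transfer : ∀ {a} v → a ≈ˡᵉˣ ⟪ v ⟫ (val s) → a ≈ˡᵉˣ ([ 0# ] , [ 0 ]) →
            ([ 0# ] , [ 0 ]) ≈ˡᵉˣ ⟪ v ⟫ (val s)
          transfer nothing (SupEquality.⊤⁺≈⊤⁺ , ≡.refl) (() , _)
          transfer (just _) (SupEquality.[ p ] , ≡.refl) (SupEquality.[ q ] , ≡.refl) =
            SupEquality.[ trans (sym q) p ] , ≡.refl
        result : ∀ v → W R ≡ v → Final W R
        result nothing e with () ← proj₂ (at-zero nothing e s s∈R)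
        result (just (f , n)) e with at-zero (just (f , n)) e
        ... | z with ≡.refl ← proj₂ (z s s∈R) = final e λ s s∈R → drop (proj₁ (z s s∈R))
          where
          drop : ∀ {y z} → SupEquality._≈⁺_ _≈_ [ y ] [ z ] → z ≈ y
          drop SupEquality.[ p ] = sym p

      bounds : ∀ m → G m → ¬ source m ∈Fᴿ → ∀ s → region s ≡ source m →
        moveVal W m ⊑[ val s ] W (source m)
      bounds m g ∉F s ≡.refl = ≤ˡᵉˣ⇒⊑ (moveVal W m) (W (source m))
        (moveValue-represents W T D rep s m (G⊆𝓜 g) ≡.refl) (valueAt-represents W T D rep s s∈S)
        (proj₂ (proj₂ opt s s∈S ∉F) m (g , ≡.refl))
        where
        s∈S : s ∈S
        s∈S = MoveFacts.source∈S (𝓜-facts (G⊆𝓜 g))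

      attain : ∀ R → R ∈Sᴿ → ¬ R ∈Fᴿ → ∀ s → region s ≡ R →
        ∃ λ m → G m × source m ≡ R × (∀ s → region s ≡ R → W R ⊑[ val s ] moveVal W m)
      attain R R∈S R∉F s ≡.refl with proj₁ (proj₂ opt s R∈S R∉F)
      ... | m , (g , e) , same = m , g , e , λ s′ s′∈R →
        ⊑-region s s′ (≡.sym s′∈R) (W R) (moveVal W m)
        (≈ˡᵉˣ⇒⊑ (W R) (moveVal W m) (valueAt-represents W T D rep s R∈S)
          (moveValue-represents W T D rep s m (G⊆𝓜 g) e) same)

    module _ (simple : RegionallySimple T) (constant : RegionallyConstant D) where

      -- The attaining move would lead to the same situation with one step fewer, `T` being ∞ on the
      -- whole target region once it is ∞ at a point of the closure. This descent can end neither in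
      -- `F`, where the time is 0, nor at 0 steps outside `F`, since a move adds a step.
      finite-steps⇒finite-time : ∀ n s → s ∈S → D (region s) (point s) ≡ [ n ] →
        T (region s) (point s) ≢ ⊤⁺
      finite-steps⇒finite-time n s s∈S D≡ T≡ = cases (em {s ∈F})
        where
        no-final : ∀ {y n} → y ≡ ⊤⁺ → ¬ ((y , n) ≈ˡᵉˣ ([ 0# ] , [ 0 ]))
        no-final ≡.refl (() , _)
        predecessor : ∀ {t y d n y′ d′} → (y , d) ≈ˡᵉˣ (addTime t y′ , addStep d′) → y ≡ ⊤⁺ →
          d ≡ [ n ] →
          y′ ≡ ⊤⁺ × ∃ λ n′ → n ≡ suc n′ × d′ ≡ [ n′ ]
        predecessor {y′ = ⊤⁺} {[ n′ ]} (_ , ≡.refl) ≡.refl ≡.refl = ≡.refl , n′ , ≡.refl , ≡.refl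
        predecessor {y′ = [ _ ]} (() , _) ≡.refl _
        cases : Dec (s ∈F) → ⊥
        cases (yes s∈F) = no-final T≡ (proj₁ opt s s∈F)
        cases (no s∉F) with proj₁ (proj₂ opt s s∈S s∉F)
        ... | (_ , α@(a , b , c) , R′) , (g , e) , same with predecessor same T≡ D≡
        ...   | T′≡ , n′ , ≡.refl , D′≡ = everywhere (simple R′)
          where
          facts = 𝓜-facts (G⊆𝓜 g)
          p∈ : closure R′ (Succ s α)
          p∈ = Succ∈closure facts s (≡.sym e)
          s′ = proj₁ (inhabited R′)
          s′∈ = proj₂ (inhabited R′)
          finite-∞ : ∀ {y z} → y ≡ ⊤⁺ → ¬ SupEquality._≈⁺_ _≈_ y [ z ]
          finite-∞ ≡.refl ()
          everywhere : SimpleOn (closure R′) (T R′) ⊎ (∀ p → closure R′ p → T R′ p ≡ ⊤⁺) → ⊥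
          everywhere (inj₁ (inj₁ (e , h)))     = finite-∞ T′≡ (h (Succ s α) p∈)
          everywhere (inj₁ (inj₂ (e , c , h))) = finite-∞ T′≡ (h (Succ s α) p∈)
          everywhere (inj₂ h) =
            finite-steps⇒finite-time n′ s′ (subst _∈Sᴿ (≡.sym s′∈) (MoveFacts.target∈S facts))
            (subst (λ R → D R (point s′) ≡ [ n′ ]) (≡.sym s′∈)
              (≡.trans (proj₂ (constant R′) (point s′) s′∈cl)
                (≡.trans (≡.sym (proj₂ (constant R′) (Succ s α) p∈)) D′≡)))
            (subst (λ R → T R (point s′) ≡ ⊤⁺) (≡.sym s′∈) (h (point s′) s′∈cl))
            where
            s′∈cl : closure R′ (point s′)
            s′∈cl = subst (λ R → closure R (point s′)) s′∈ (point∈closure s′)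

      -- A symbolic value has both components finite or both infinite: `finite-steps⇒finite-time`
      -- excludes one mixed case, the hypothesis the other.
      representation : (∀ s → s ∈S → proj₂ (valueAt T D s) ≡ ⊤⁺ → proj₁ (valueAt T D s) ≡ ⊤⁺) →
        ∃ λ W → Represents W T D
      representation infinite = (λ R → choose R em) , λ R R∈S → chosen R R∈S em
        where
        Rep : Region → Value → Set
        Rep R v = ∀ p → closure R p → (T R p , D R p) ≈ˡᵉˣ ⟪ v ⟫ (proj₂ p)
        finite-∞ : ∀ {y z} → y ≡ ⊤⁺ → ¬ SupEquality._≈⁺_ _≈_ y [ z ]
        finite-∞ ≡.refl ()
        at-region : ∀ R → R ∈Sᴿ → ∃ (Rep R)
        at-region R R∈S = cases (simple R) (constant R)
          where
          s = proj₁ (inhabited R)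
          s∈R = proj₂ (inhabited R)
          s∈cl : closure R (point s)
          s∈cl = subst (λ R → closure R (point s)) s∈R (point∈closure s)
          s∈S : s ∈S
          s∈S = subst _∈Sᴿ (≡.sym s∈R) R∈S
          infinite′ : D R (point s) ≡ ⊤⁺ → T R (point s) ≡ ⊤⁺
          infinite′ h =
            subst (λ R → T R (point s) ≡ ⊤⁺) s∈R
            (infinite s s∈S (subst (λ R → D R (point s) ≡ ⊤⁺) (≡.sym s∈R) h))
          cases : SimpleOn (closure R) (T R) ⊎ (∀ p → closure R p → T R p ≡ ⊤⁺) →
            (∃ λ d → ∀ p → closure R p → D R p ≡ d) → ∃ (Rep R)
          cases (inj₁ (inj₁ (e , h))) ([ n ] , h′) = just ((e , nothing) , n) , λ p p∈ →
            SupEquality.≈⁺-trans _≈_ trans (h p p∈) SupEquality.[ solve 1 (λ e → e := e :- con ℤ.0ℤ)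
              refl (fromℤ e) ] , h′ p p∈
          cases (inj₁ (inj₂ (e , c , h))) ([ n ] , h′) =
            just ((e , just c) , n) , λ p p∈ → h p p∈ , h′ p p∈
          cases (inj₁ (inj₁ (e , h))) (⊤⁺ , h′) =
            contradiction (h (point s) s∈cl) (finite-∞ (infinite′ (h′ (point s) s∈cl)))
          cases (inj₁ (inj₂ (e , c , h))) (⊤⁺ , h′) =
            contradiction (h (point s) s∈cl) (finite-∞ (infinite′ (h′ (point s) s∈cl)))
          cases (inj₂ h) (⊤⁺ , h′) =
            nothing , λ p p∈ → SupEquality.≈⁺-trans _≈_ trans (≈⁺-reflexive (h p p∈))
            SupEquality.⊤⁺≈⊤⁺ , h′ p p∈
            where
            ≈⁺-reflexive : ∀ {y z} → y ≡ z → SupEquality._≈⁺_ _≈_ y z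
            ≈⁺-reflexive ≡.refl = SupEquality.≈⁺-refl _≈_ refl
          cases (inj₂ h) ([ n ] , h′) = contradiction
            (subst (λ R → T R (point s) ≡ ⊤⁺) (≡.sym s∈R) (h (point s) s∈cl))
            (finite-steps⇒finite-time n s s∈S
              (subst (λ R → D R (point s) ≡ [ n ]) (≡.sym s∈R) (h′ (point s) s∈cl)))
        choose : ∀ R → Dec (R ∈Sᴿ) → Value
        choose R (yes R∈S) = proj₁ (at-region R R∈S)
        choose R (no _)    = nothing
        chosen : ∀ R → R ∈Sᴿ → (d : Dec (R ∈Sᴿ)) → Rep R (choose R d)
        chosen R R∈S (yes p) = proj₂ (at-region R p)
        chosen R R∈S (no ¬p) = contradiction R∈S ¬p

  timeOf : Valuing → TimeFunction
  timeOf W R p = proj₁ (⟪ W R ⟫ (proj₂ p))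

  stepsOf : Valuing → StepFunction
  stepsOf W R p = proj₂ (⟪ W R ⟫ (proj₂ p))

  represents-itself : ∀ W → Represents W (timeOf W) (stepsOf W)
  represents-itself W R _ p _ = SupEquality.≈⁺-refl _≈_ refl , ≡.refl

  solves⇒optMax : ∀ {G W} → G ⊆ 𝓜 → Solves G W → OptMax (timeOf W) (stepsOf W) G
  solves⇒optMax {G} {W} G⊆𝓜 sol = atF , atS
    where
    open Solves sol
    rep = represents-itself W
    atF : ∀ s → s ∈F → valueAt (timeOf W) (stepsOf W) s ≈ˡᵉˣ ([ 0# ] , [ 0 ])
    atF s s∈F = subst (λ v → ⟪ v ⟫ (val s) ≈ˡᵉˣ ([ 0# ] , [ 0 ])) (≡.sym (Final.W≡ z))
      (SupEquality.[ Final.≈0 z s ≡.refl ] , ≡.refl)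
      where z = atFinal (region s) s∈F
    atS : ∀ s → s ∈S → ¬ s ∈F → IsMaxFrom (timeOf W) (stepsOf W) G s
    atS s s∈S s∉F with attained (region s) s∈S s∉F
    ... | m , g , e , h =
      (m , (g , e) , ⊑-antisym (W (region s)) (moveVal W m)
        (valueAt-represents W (timeOf W) (stepsOf W) rep s s∈S)
        (moveValue-represents W (timeOf W) (stepsOf W) rep s m (G⊆𝓜 g) e)
        (h s ≡.refl) (upper m g e)) ,
      λ m′ (g′ , e′) → ⊑⇒≤ˡᵉˣ (moveVal W m′) (W (region s))
        (moveValue-represents W (timeOf W) (stepsOf W) rep s m′ (G⊆𝓜 g′) e′)
        (valueAt-represents W (timeOf W) (stepsOf W) rep s s∈S) (upper m′ g′ e′)
      where
      upper : ∀ m → G m → source m ≡ region s → moveVal W m ⊑[ val s ] W (region s)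
      upper m g e =
        subst (λ R → moveVal W m ⊑[ val s ] W R) e
        (bounds m g (λ p → s∉F (subst _∈Fᴿ e p)) s (≡.sym e))

  timeOf-simple : ∀ W → RegionallySimple (timeOf W)
  timeOf-simple W R = cases (W R)
    where
    cases : ∀ v → SimpleOn (closure R) (λ p → proj₁ (⟪ v ⟫ (proj₂ p))) ⊎
      (∀ p → closure R p → proj₁ (⟪ v ⟫ (proj₂ p)) ≡ ⊤⁺)
    cases nothing = inj₂ λ _ _ → ≡.refl
    cases (just ((e , nothing) , _)) =
      inj₁ (inj₁ (e , λ _ _ → SupEquality.[ solve 1 (λ e → e :- con ℤ.0ℤ := e) refl (fromℤ e) ]))
    cases (just ((e , just c) , _))  = inj₁ (inj₂ (e , c , λ _ _ → SupEquality.[ refl ]))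

  stepsOf-constant : ∀ W → RegionallyConstant (stepsOf W)
  stepsOf-constant W R = cases (W R)
    where
    cases : ∀ v → ∃ λ d → ∀ p → closure R p → proj₂ (⟪ v ⟫ (proj₂ p)) ≡ d
    cases nothing        = ⊤⁺ , λ _ _ → ≡.refl
    cases (just (_ , n)) = [ n ] , λ _ _ → ≡.refl

  ⟪⟫-infinite : ∀ v {x} → proj₂ (⟪ v ⟫ x) ≡ ⊤⁺ → proj₁ (⟪ v ⟫ x) ≡ ⊤⁺
  ⟪⟫-infinite nothing _ = ≡.refl

  -- Existence of solutions

  module Existence {G : Pred Move 0ℓ} (G⊆𝓜 : G ⊆ 𝓜)
    (total : ∀ R → R ∈Sᴿ → ¬ R ∈Fᴿ → ∃ λ m → G m × source m ≡ R) where

    Outgoing : Region → Move → Set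
    Outgoing R m = G m × source m ≡ R × ¬ R ∈Fᴿ × R ∈Sᴿ

    -- The accessible regions are those from which every play reaches F (or leaves S).
    _≺_ : Rel Region 0ℓ
    R′ ≺ R = ∃ λ m → Outgoing R m × target m ≡ R′

    larger : RawValuation → Value → Value → Value
    larger x v w with ⊑-total x v w
    ... | inj₁ _ = w
    ... | inj₂ _ = v

    larger-upper : ∀ x v w → v ⊑[ x ] larger x v w × w ⊑[ x ] larger x v w
    larger-upper x v w with ⊑-total x v w
    ... | inj₁ p = p , ⊑-refl w
    ... | inj₂ p = ⊑-refl v , p

    larger-selective : ∀ x v w → larger x v w ≡ v ⊎ larger x v w ≡ w
    larger-selective x v w with ⊑-total x v w
    ... | inj₁ _ = inj₂ ≡.refl
    ... | inj₂ _ = inj₁ ≡.refl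

    -- Where `bellman` calls it, the empty list with its default ∞ occurs only at regions outside
    -- `S`; at the others `total` provides a move.
    greatest : RawValuation → List Value → Value
    greatest x []                = nothing
    greatest x (v ∷ [])          = v
    greatest x (v ∷ vs@(_ ∷ _)) = larger x v (greatest x vs)

    greatest-upper : ∀ x vs {v} → v ∈ vs → v ⊑[ x ] greatest x vs
    greatest-upper x (v ∷ [])          (here ≡.refl) = ⊑-refl v
    greatest-upper x (v ∷ vs@(_ ∷ _)) (here ≡.refl) = proj₁ (larger-upper x v (greatest x vs))
    greatest-upper x (v ∷ vs@(_ ∷ _)) {u} (there u∈) =
      ⊑-trans u (greatest x vs) (larger x v (greatest x vs))
      (greatest-upper x vs u∈) (proj₂ (larger-upper x v (greatest x vs)))

    greatest-∈ : ∀ x vs {v} → v ∈ vs → greatest x vs ∈ vs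
    greatest-∈ x (v ∷ [])          _ = here ≡.refl
    greatest-∈ x (v ∷ vs@(_ ∷ _)) _ =
      Sum.[ here , (λ e → there (subst (_∈ vs) (≡.sym e) (greatest-∈ x vs (here ≡.refl)))) ]′
        (larger-selective x v (greatest x vs))

    module _ {R : Region} where
      values : (∀ m → Outgoing R m → Value) → List Move → List Value
      values rec [] = []
      values rec (m ∷ ms) with em {Outgoing R m}
      ... | yes p = shift (proj₁ (proj₂ m)) (rec m p) ∷ values rec ms
      ... | no _  = values rec ms

      values-cong : ∀ {rec rec′} → (∀ m p → rec m p ≡ rec′ m p) → ∀ ms →
        values rec ms ≡ values rec′ ms
      values-cong h [] = ≡.refl
      values-cong h (m ∷ ms) with em {Outgoing R m}
      ... | yes p = ≡.cong₂ (λ v vs → shift (proj₁ (proj₂ m)) v ∷ vs) (h m p) (values-cong h ms)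
      ... | no _  = values-cong h ms

      ∈-values : ∀ (W : Valuing) {m ms} → Outgoing R m → m ∈ ms →
        moveVal W m ∈ values (λ m _ → W (target m)) ms
      ∈-values W {m} p (here ≡.refl) with em {Outgoing R m}
      ... | yes _ = here ≡.refl
      ... | no ¬p = contradiction p ¬p
      ∈-values W {ms = m′ ∷ _} p (there m∈) with em {Outgoing R m′}
      ... | yes _ = there (∈-values W p m∈)
      ... | no _  = ∈-values W p m∈

      values-∈ : ∀ (W : Valuing) ms {v} → v ∈ values (λ m _ → W (target m)) ms → ∃ λ m →
        Outgoing R m × v ≡ moveVal W m
      values-∈ W (m ∷ ms) v∈ with em {Outgoing R m}
      values-∈ W (m ∷ ms) (here ≡.refl) | yes p = m , p , ≡.refl
      values-∈ W (m ∷ ms) (there v∈)    | yes p = values-∈ W ms v∈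
      values-∈ W (m ∷ ms) v∈            | no _  = values-∈ W ms v∈

    -- The maximum is taken at one sample configuration; by `⊑-region` the same value is greatest
    -- throughout the region.
    bellman : ∀ R → Dec (R ∈Fᴿ) → (∀ m → Outgoing R m → Value) → Value
    bellman R (yes _) rec = just ((+ 0 , nothing) , 0)
    bellman R (no _)  rec = greatest (val (proj₁ (inhabited R))) (values rec moves)

    bellman-cong : ∀ R d {rec rec′} → (∀ m p → rec m p ≡ rec′ m p) →
      bellman R d rec ≡ bellman R d rec′
    bellman-cong R (yes _) h = ≡.refl
    bellman-cong R (no _)  h = cong (greatest _) (values-cong h moves)

    value : ∀ R → Acc _≺_ R → Value
    value R (acc rs) = bellman R em (λ m p → value (target m) (rs (m , p , ≡.refl)))

    -- The recursion passes down one proof of accessibility, while `solution` obtains another from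
    -- excluded middle.
    value-irrelevant : ∀ R a a′ → value R a ≡ value R a′
    value-irrelevant R (acc rs) (acc rs′) = bellman-cong R em λ m p →
      value-irrelevant (target m) (rs (m , p , ≡.refl)) (rs′ (m , p , ≡.refl))

    solution : Valuing
    solution R = decide em
      where
      decide : Dec (Acc _≺_ R) → Value
      decide (yes a) = value R a
      decide (no _)  = nothing

    solution-accessible : ∀ R a → solution R ≡ value R a
    solution-accessible R a with em {Acc _≺_ R}
    ... | yes a′ = value-irrelevant R a′ a
    ... | no ¬a  = contradiction a ¬a

    solution-inaccessible : ∀ R → ¬ Acc _≺_ R → solution R ≡ nothing
    solution-inaccessible R ¬a with em {Acc _≺_ R}
    ... | yes a = contradiction a ¬a
    ... | no _  = ≡.refl

    solution-bellman : ∀ R → Acc _≺_ R → solution R ≡ bellman R em (λ m _ → solution (target m))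
    solution-bellman R (acc rs) = ≡.trans (solution-accessible R (acc rs))
      (bellman-cong R em λ m p → ≡.sym (solution-accessible (target m) (rs (m , p , ≡.refl))))

    private
      W : Valuing
      W = solution

    solution-final : ∀ R → R ∈Fᴿ → Final W R
    solution-final R R∈F = final (≡.trans (solution-bellman R accessible) (reduce em)) λ s _ →
      solve 0 (con ℤ.0ℤ :- con ℤ.0ℤ := con ℤ.0ℤ) refl
      where
      accessible : Acc _≺_ R
      accessible = acc λ where (_ , (_ , _ , R∉F , _) , _) → contradiction R∈F R∉F
      reduce : ∀ d → bellman R d (λ m _ → W (target m)) ≡ just ((+ 0 , nothing) , 0)
      reduce (yes _)  = ≡.refl
      reduce (no R∉F) = contradiction R∈F R∉F

    solution-greatest : ∀ R → Acc _≺_ R → ¬ R ∈Fᴿ → W R ≡ greatest (val (proj₁ (inhabited R)))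
      (values {R} (λ m _ → W (target m)) moves)
    solution-greatest R a R∉F = ≡.trans (solution-bellman R a) (reduce em)
      where
      reduce : ∀ d → bellman R d (λ m _ → W (target m)) ≡ greatest (val (proj₁ (inhabited R)))
        (values {R} (λ m _ → W (target m)) moves)
      reduce (yes R∈F) = contradiction R∈F R∉F
      reduce (no _)    = ≡.refl

    solution-bounds : ∀ m → G m → ¬ source m ∈Fᴿ → ∀ s → region s ≡ source m →
      moveVal W m ⊑[ val s ] W (source m)
    solution-bounds m g ∉F s s∈R = cases (em {Acc _≺_ (source m)})
      where
      r = proj₁ (inhabited (source m))
      cases : Dec (Acc _≺_ (source m)) → moveVal W m ⊑[ val s ] W (source m)
      cases (no ¬a) =
        subst (moveVal W m ⊑[ val s ]_) (≡.sym (solution-inaccessible (source m) ¬a)) tt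
      cases (yes a) =
        ⊑-region r s (≡.trans (proj₂ (inhabited (source m))) (≡.sym s∈R)) (moveVal W m)
        (W (source m))
        (subst (moveVal W m ⊑[ val r ]_) (≡.sym (solution-greatest (source m) a ∉F))
          (greatest-upper (val r) _
            (∈-values W (g , ≡.refl , ∉F , MoveFacts.source∈S (𝓜-facts (G⊆𝓜 g))) (∈-moves m))))

    solution-attained : ∀ R → R ∈Sᴿ → ¬ R ∈Fᴿ →
      ∃ λ m → G m × source m ≡ R × (∀ s → region s ≡ R → W R ⊑[ val s ] moveVal W m)
    solution-attained R R∈S R∉F = cases (em {Acc _≺_ R})
      where
      cases : Dec (Acc _≺_ R) → ∃ λ m → G m × source m ≡ R ×
        (∀ s → region s ≡ R → W R ⊑[ val s ] moveVal W m)
      cases (yes a) with total R R∈S R∉F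
      ... | m₀ , g₀ ,
        e₀ with values-∈ {R} W moves
        (greatest-∈ (val (proj₁ (inhabited R))) _ (∈-values W (g₀ , e₀ , R∉F , R∈S) (∈-moves m₀)))
      ...   | m , (g , e , _) , same = m , g , e , λ s _ →
              subst (_⊑[ val s ] moveVal W m) (≡.sym (≡.trans (solution-greatest R a R∉F) same))
                (⊑-refl (moveVal W m))
      cases (no ¬a) = escape em
        where
        -- An inaccessible region has an inaccessible successor, as otherwise it would be
        -- accessible; moving there attains ∞.
        escape : Dec (∃ λ m → Outgoing R m × ¬ Acc _≺_ (target m)) →
          ∃ λ m → G m × source m ≡ R × (∀ s → region s ≡ R → W R ⊑[ val s ] moveVal W m)
        escape (yes (m@(_ , α , _) , (g , e , _) , ¬a′)) = m , g , e , λ s _ →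
          subst (λ v → W R ⊑[ val s ] shift α v) (≡.sym (solution-inaccessible (target m) ¬a′)) tt
        escape (no none) = contradiction (acc λ where (m , p , ≡.refl) → stays m p em) ¬a
          where
          stays : ∀ m → Outgoing R m → Dec (Acc _≺_ (target m)) → Acc _≺_ (target m)
          stays m p (yes a) = a
          stays m p (no ¬a) = contradiction (m , p , ¬a) none

    solves : Solves G solution
    solves = record
      { bounding = record { atFinal = solution-final ; bounds = solution-bounds }
      ; attained = solution-attained
      }

-- The strategy iteration: improvement, termination, correctness

module Iteration (em : ExcludedMiddle 0ℓ) (ℝ : RealNumbers) (k : ℕ) (Γ : ReachabilityTimeGame ℝ k)
  (nonBlocking : TimedRegionGraph.NonBlocking ℝ k Γ) (Choose : TimedRegionGraph.Choice ℝ k Γ) where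
  open ReachabilityTimeGame Γ
  open TimedRegionGraph ℝ k Γ
  open StrategyImprovement em ℝ k Γ Choose
  open Choice Choose
  open RegionGeometry ℝ k Γ
  open MoveGeometry ℝ k Γ
  open FiniteGraph em ℝ k Γ
  open SymbolicValues em ℝ k Γ
  open Representation em ℝ k Γ

  -- The set of moves from a state depends only on its region, and `choose` only on that set, so
  -- choosing everywhere is regionally constant.
  initial : ∃ λ μ → IsStrategy μ × IsRegionallyConstant μ
  initial = (λ s → choose (From s) (some s)) , (λ s → choose-∈ (From s) (some s)) , λ s s′ e →
    choose-cong (From s) (From s′) (some s) (some s′)
      ((λ (g , h) → g , ≡.trans h e) , (λ (g , h) → g , ≡.trans h (≡.sym e)))
    where
    From : MinState → Pred Move 0ℓ
    From s m = 𝓜 m × source m ≡ region (config s)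
    some : ∀ s → Satisfiable (From s)
    some s = proj₁ nonBlocking (config s) (isState s) (isMin s)

  ↾⊆𝓜 : ∀ μ → (𝓜 ↾ μ) ⊆ 𝓜
  ↾⊆𝓜 μ = proj₁

  played : ∀ {μ} → IsStrategy μ → ∀ s → (𝓜 ↾ μ) (μ s)
  played str s = proj₁ (str s) , inj₂ (s , ≡.sym (proj₂ (str s)) , ≡.refl)

  ↾-total : ∀ {μ} → IsStrategy μ → ∀ R → R ∈Sᴿ → ¬ R ∈Fᴿ → ∃ λ m → (𝓜 ↾ μ) m × source m ≡ R
  ↾-total {μ} str R R∈S R∉F = cases (inhabited R) (owner (proj₁ R)) ≡.refl
    where
    cases : (∃ λ s → region s ≡ R) → ∀ o → owner (proj₁ R) ≡ o → ∃ λ m → (𝓜 ↾ μ) m × source m ≡ R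
    cases (s , ≡.refl) Min o = let st = minState s R∈S o in μ st , played str st , proj₂ (str st)
    cases (s , ≡.refl) Max o = let m , g , e = proj₂ nonBlocking s R∈S R∉F o in
      m , (g , inj₁ (≡.trans (cong ownerOfRegion e) o)) , e

  solved : ∀ {μ} → IsStrategy μ → ∃ (Solves (𝓜 ↾ μ))
  solved {μ} str = _ , Existence.solves (↾⊆𝓜 μ) (↾-total str)

  evaluated : ∀ {μ} → IsStrategy μ → ∃₂ (Evaluation μ)
  evaluated {μ} str = let W , sol = solved str in timeOf W , stepsOf W , record
    { optimal  = solves⇒optMax (↾⊆𝓜 μ) sol
    ; simple   = timeOf-simple W
    ; constant = stepsOf-constant W
    ; infinite = λ s _ → ⟪⟫-infinite (W (region s))
    }

  symbolic : ∀ {μ T D} → Evaluation μ T D → ∃ λ W → Represents W T D × Solves (𝓜 ↾ μ) W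
  symbolic {μ} ev =
    let open Evaluation ev
        W , rep = representation (↾⊆𝓜 μ) optimal simple constant infinite
    in W , rep , represents⇒solves (↾⊆𝓜 μ) optimal rep

  -- `BestMoves` in symbolic form, where dependence on the region alone is visible.
  Best : Valuing → Region → Pred Move 0ℓ
  Best W R m = (𝓜 m × source m ≡ R) ×
    (∀ m′ → 𝓜 m′ × source m′ ≡ R → ∀ s → region s ≡ R → moveVal W m ⊑[ val s ] moveVal W m′)

  module _ (W : Valuing) (T : TimeFunction) (D : StepFunction) (rep : Represents W T D) where
    best⇒Best : ∀ s {m} → BestMoves T D s m → Best W (region s) m
    best⇒Best s {m} ((g , e) , h) = (g , e) , λ m′ (g′ , e′) s′ s′∼s →
      ⊑-region s s′ (≡.sym s′∼s) (moveVal W m) (moveVal W m′)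
      (≤ˡᵉˣ⇒⊑ (moveVal W m) (moveVal W m′) (moveValue-represents W T D rep s m g e)
        (moveValue-represents W T D rep s m′ g′ e′) (h m′ (g′ , e′)))

    Best⇒best : ∀ s {m} → Best W (region s) m → BestMoves T D s m
    Best⇒best s {m} ((g , e) , h) = (g , e) , λ m′ (g′ , e′) →
      ⊑⇒≤ˡᵉˣ (moveVal W m) (moveVal W m′) (moveValue-represents W T D rep s m g e)
        (moveValue-represents W T D rep s m′ g′ e′)
        (h m′ (g′ , e′) s ≡.refl)

  least : ∀ x (v : Move → Value) (P : Pred Move 0ℓ) ms →
    (∃ λ m → P m × m ∈ ms) → ∃ λ m → P m × (∀ m′ → P m′ → m′ ∈ ms → v m ⊑[ x ] v m′)
  least x v P (m ∷ ms) (m₀ , p₀ , m₀∈) = cases em em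
    where
    Least : Set
    Least = ∃ λ m₁ → P m₁ × (∀ m′ → P m′ → m′ ∈ (m ∷ ms) → v m₁ ⊑[ x ] v m′)
    tail-only : ¬ P m → m₀ ∈ (m ∷ ms) → ∃ λ m → P m × m ∈ ms
    tail-only ¬p (here ≡.refl) = contradiction p₀ ¬p
    tail-only ¬p (there m₀∈)   = m₀ , p₀ , m₀∈
    cases : Dec (P m) → Dec (∃ λ m → P m × m ∈ ms) → Least
    cases (yes p) (no none) = m , p , λ where
      m′ p′ (here ≡.refl) → ⊑-refl (v m)
      m′ p′ (there m′∈)   → contradiction (m′ , p′ , m′∈) none
    cases (no ¬p) (no none) = contradiction (tail-only ¬p m₀∈) none
    cases (no ¬p) (yes some) = let m₁ , p₁ , h = least x v P ms some in m₁ , p₁ , λ where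
      m′ p′ (here ≡.refl) → contradiction p′ ¬p
      m′ p′ (there m′∈)   → h m′ p′ m′∈
    cases (yes p) (yes some) = compare (least x v P ms some)
      where
      compare : (∃ λ m → P m × (∀ m′ → P m′ → m′ ∈ ms → v m ⊑[ x ] v m′)) → Least
      compare (m₁ , p₁ , h) = choose₂ (⊑-total x (v m) (v m₁))
        where
        choose₂ : v m ⊑[ x ] v m₁ ⊎ v m₁ ⊑[ x ] v m → Least
        choose₂ (inj₁ q) = m , p , λ where
          m′ p′ (here ≡.refl) → ⊑-refl (v m)
          m′ p′ (there m′∈)   → ⊑-trans (v m) (v m₁) (v m′) q (h m′ p′ m′∈)
        choose₂ (inj₂ q) = m₁ , p₁ , λ where
          m′ p′ (here ≡.refl) → q
          m′ p′ (there m′∈)   → h m′ p′ m′∈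

  best-exists : ∀ W s → (∃ λ m → 𝓜 m × source m ≡ region s) → ∃ (Best W (region s))
  best-exists W s (m₀ , p₀) =
    let m , p , h =
          least (val s) (moveVal W) (λ m → 𝓜 m × source m ≡ region s) moves (m₀ , p₀ , ∈-moves m₀)
          in
    m , p , λ m′ p′ s′ s′∼s → ⊑-region s s′ (≡.sym s′∼s) (moveVal W m) (moveVal W m′)
      (h m′ p′ (∈-moves m′))

  keepOrChoose-∈ : ∀ P m d e → Satisfiable P → P (keepOrChoose P m d e)
  keepOrChoose-∈ P m (yes p) _       _ = p
  keepOrChoose-∈ P m (no _)  (yes p) _ = choose-∈ P p
  keepOrChoose-∈ P m (no _)  (no ¬p) p = contradiction p ¬p

  keepOrChoose-keep : ∀ P m d e → P m → keepOrChoose P m d e ≡ m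
  keepOrChoose-keep P m (yes _) _ _ = ≡.refl
  keepOrChoose-keep P m (no ¬p) _ p = contradiction p ¬p

  -- Excluded middle is consulted separately for `P` and `Q`, so mixed verdicts have to be refuted;
  -- when both sides choose anew, `choose-cong` applies.
  keepOrChoose-cong : ∀ P Q {m m′} d e d′ e′ → P ≐ Q → m ≡ m′ →
    keepOrChoose P m d e ≡ keepOrChoose Q m′ d′ e′
  keepOrChoose-cong P Q (yes _) _ (yes _) _ _ ≡.refl = ≡.refl
  keepOrChoose-cong P Q (yes p) _ (no ¬q) _ P≐Q ≡.refl = contradiction (proj₁ P≐Q p) ¬q
  keepOrChoose-cong P Q (no ¬p) _ (yes q) _ P≐Q ≡.refl = contradiction (proj₂ P≐Q q) ¬p
  keepOrChoose-cong P Q (no _) (yes p) (no _) (yes q) P≐Q ≡.refl = choose-cong P Q p q P≐Q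
  keepOrChoose-cong P Q (no _) (yes (m , p)) (no _) (no ¬q) P≐Q ≡.refl =
    contradiction (m , proj₁ P≐Q p) ¬q
  keepOrChoose-cong P Q (no _) (no ¬p) (no _) (yes (m , q)) P≐Q ≡.refl =
    contradiction (m , proj₂ P≐Q q) ¬p
  keepOrChoose-cong P Q (no _) (no _) (no _) (no _) _ ≡.refl = ≡.refl

  module _ {μ : Assignment} {T : TimeFunction} {D : StepFunction} (W : Valuing)
    (rep : Represents W T D) where
    improve-best : ∀ s → BestMoves T D (config s) (Improve μ T D s)
    improve-best s = keepOrChoose-∈ (BestMoves T D (config s)) (μ s) em em
      (let m , b = best-exists W (config s) (proj₁ nonBlocking (config s) (isState s) (isMin s)) in
       m , Best⇒best W T D rep (config s) b)

    improve-strategy : IsStrategy (Improve μ T D)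
    improve-strategy s = proj₁ (improve-best s)

    improve-constant : IsRegionallyConstant μ → IsRegionallyConstant (Improve μ T D)
    improve-constant con s s′ e =
      keepOrChoose-cong (BestMoves T D (config s)) (BestMoves T D (config s′)) em em em em
      ((λ {m} b → move-to s s′ e {m} b) , (λ {m} b → move-to s′ s (≡.sym e) {m} b)) (con s s′ e)
      where
      move-to : ∀ s s′ → region (config s) ≡ region (config s′) → ∀ {m} →
        BestMoves T D (config s) m → BestMoves T D (config s′) m
      move-to s s′ e {m} b =
        Best⇒best W T D rep (config s′)
        (subst (λ R → Best W R m) e (best⇒Best W T D rep (config s) b))

    -- Min's new move is best, hence no worse than the old one, which the old solution bounds; Max's
    -- moves are unchanged.
    improve-bounding : IsStrategy μ → Solves (𝓜 ↾ μ) W → Bounding (𝓜 ↾ Improve μ T D) W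
    improve-bounding str sol = record { atFinal = atFinal ; bounds = improved }
      where
      open Solves sol
      improved : ∀ m → (𝓜 ↾ Improve μ T D) m → ¬ source m ∈Fᴿ → ∀ s → region s ≡ source m →
        moveVal W m ⊑[ val s ] W (source m)
      improved m (g , inj₁ max) = bounds m (g , inj₁ max)
      improved m (g , inj₂ (st , e , ≡.refl)) ∉F s s∈ =
        ⊑-trans (moveVal W m) (moveVal W (μ st)) (W (source m))
          (proj₂ (best⇒Best W T D rep (config st) (improve-best st)) (μ st) (str st) s
            (≡.trans s∈ (≡.sym e)))
          (subst (λ R → moveVal W (μ st) ⊑[ val s ] W R) same
            (bounds (μ st) (played str st) (λ p → ∉F (subst _∈Fᴿ same p)) s
              (≡.trans s∈ (≡.sym same))))
        where
        same : source (μ st) ≡ source m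
        same = ≡.trans (proj₂ (str st)) e

  -- Strategies form a finite set

  -- Code 0 is reserved for regions without a state of Min, so a move is coded by its index plus
  -- one.
  playedIn : Assignment → ∀ R → Dec (∃ λ s → region (config s) ≡ R) → Fin (suc (length moves))
  playedIn μ R (yes (s , _)) = Fin.suc (index (∈-moves (μ s)))
  playedIn μ R (no _)        = Fin.zero

  code : Assignment → Fin (suc (length moves) ^ length regions)
  code μ = funToFin (λ i → playedIn μ (lookup regions i) em)

  code-injective : ∀ {μ μ′} → IsRegionallyConstant μ → IsRegionallyConstant μ′ → code μ ≡ code μ′ →
    ∀ s → μ s ≡ μ′ s
  code-injective {μ} {μ′} con con′ e s =
    same em (≡.trans (≡.sym (finToFun-funToFin (λ i → playedIn μ (lookup regions i) em) i))
      (≡.trans (cong (λ c → finToFun c i) e)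
        (finToFun-funToFin (λ i → playedIn μ′ (lookup regions i) em) i)))
    where
    i = index (∈-regions (region (config s)))
    R≡ : region (config s) ≡ lookup regions i
    R≡ = lookup-index (∈-regions (region (config s)))
    same : ∀ d → playedIn μ (lookup regions i) d ≡ playedIn μ′ (lookup regions i) d → μ s ≡ μ′ s
    same (no none) _ = contradiction (s , R≡) none
    same (yes (s′ , e′)) h = ≡.trans (con s s′ (≡.trans R≡ (≡.sym e′))) (≡.trans
      (≡.trans (lookup-index (∈-moves (μ s′)))
        (≡.trans (cong (lookup moves) (suc-injective h)) (≡.sym (lookup-index (∈-moves (μ′ s′))))))
      (con′ s′ s (≡.trans e′ (≡.sym R≡))))

  bounding-⊆ : ∀ {G G′ W} → G ⊆ G′ → Bounding G′ W → Bounding G W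
  bounding-⊆ G⊆G′ b = record { atFinal = atFinal ; bounds = λ m g → bounds m (G⊆G′ g) }
    where open Bounding b

  record Solved (c : Fin (suc (length moves) ^ length regions)) (W : Valuing) : Set where
    constructor solution-of
    field
      strategy : Assignment
      constant : IsRegionallyConstant strategy
      code≡    : code strategy ≡ c
      solves   : Solves (𝓜 ↾ strategy) W

  -- Equal codes mean equal moves of Min, hence the same subgraph, in which each solution is a bound
  -- for the other.
  solved-unique : ∀ {c W W′} → Solved c W → Solved c W′ → W ≼ W′
  solved-unique {c} {W} {W′} (solution-of μ con e sol) (solution-of μ′ con′ e′ sol′) =
    solution-least {W = W′} {W′ = W} (↾⊆𝓜 μ) (bounding-⊆ ⊆′ (Solves.bounding sol′)) sol
    where
    ⊆′ : (𝓜 ↾ μ) ⊆ (𝓜 ↾ μ′)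
    ⊆′ (g , inj₁ max) = g , inj₁ max
    ⊆′ (g , inj₂ (s , h , h′)) =
      g , inj₂ (s , h , ≡.trans (≡.sym (code-injective con con′ (≡.trans e (≡.sym e′)) s)) h′)

  infix 4 _⊏_
  -- Values are compared, but the carrier is the finite set of codes. Solutions for one code are
  -- interchangeable by `solved-unique`, which gives irreflexivity and lets chains compose.
  _⊏_ : Rel (Fin (suc (length moves) ^ length regions)) 0ℓ
  c′ ⊏ c = ∃₂ λ W′ W → Solved c′ W′ × Solved c W × W′ ≼ W × ¬ (W ≼ W′)

  ⊏-wellFounded : WellFounded _⊏_
  ⊏-wellFounded = spo-wellFounded {_⊏_ = _⊏_} isSPO
    where
    isSPO : IsStrictPartialOrder _≡_ _⊏_
    isSPO = record
      { isEquivalence = ≡.isEquivalence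
      ; irrefl        = λ { ≡.refl (W′ , W , s′ , s , _ , W⋠W′) → W⋠W′ (solved-unique s s′) }
      ; trans         =
          λ { (W₁ , W₂ , s₁ , s₂ , W₁≼W₂ , W₂⋠W₁) (W₃ , W₄ , s₃ , s₄ , W₃≼W₄ , W₄⋠W₃) →
          W₁ , W₄ , s₁ , s₄ ,
          ≼-trans {W₁} {W₃} {W₄} (≼-trans {W₁} {W₂} {W₃} W₁≼W₂ (solved-unique s₂ s₃)) W₃≼W₄ ,
          λ W₄≼W₁ → W₄⋠W₃
            (≼-trans {W₄} {W₁} {W₃} W₄≼W₁ (≼-trans {W₁} {W₂} {W₃} W₁≼W₂ (solved-unique s₂ s₃))) }
      ; <-resp-≈      = (λ { ≡.refl p → p }) , (λ { ≡.refl p → p })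
      }

  -- Mutual `_≼_` makes times, and then steps, agree on every region of `S`; equal times let
  -- `shift-⊑` carry this back along a move.
  best-resp : ∀ {W W′} → W ≼ W′ → W′ ≼ W → ∀ {R m} → Best W R m → Best W′ R m
  best-resp {W} {W′} W≼W′ W′≼W {R} {m} ((g , e) , h) = (g , e) , λ m′ (g′ , e′) s s∈R →
    ⊑-trans (moveVal W′ m) (moveVal W m) (moveVal W′ m′)
      (transfer {W′} {W} W′≼W W≼W′ g s (≡.trans s∈R (≡.sym e)))
      (⊑-trans (moveVal W m) (moveVal W m′) (moveVal W′ m′) (h m′ (g′ , e′) s s∈R)
        (transfer {W} {W′} W≼W′ W′≼W g′ s (≡.trans s∈R (≡.sym e′))))
    where
    transfer : ∀ {W W′} → W ≼ W′ → W′ ≼ W → ∀ {m} → 𝓜 m → ∀ s → region s ≡ source m →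
      moveVal W m ⊑[ val s ] moveVal W′ m
    transfer {W} {W′} (_ , p) (q , _) {_ , α , R′} g s s∈R =
      shift-⊑ α (W R′) (W′ R′) (p q R′ target∈S) (q R′ target∈S) (lands s s∈R)
      where open MoveFacts (𝓜-facts g)

  -- The moves just chosen are best for `W`, hence best for the equivalent `W′`, and a current move
  -- that is best is kept.
  stable : ∀ {μ T D T′ D′ W W′} → Represents W T D → Represents W′ T′ D′ → W ≼ W′ → W′ ≼ W →
    IsFixed (Improve μ T D) T′ D′
  stable {μ} {T} {D} {T′} {D′} {W} {W′} rep rep′ W≼W′ W′≼W s =
    keepOrChoose-keep (BestMoves T′ D′ (config s)) (Improve μ T D s) em em
      (Best⇒best W′ T′ D′ rep′ (config s) (best-resp {W} {W′} W≼W′ W′≼W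
        (best⇒Best W T D rep (config s) (improve-best {μ} W rep s))))

  termination : ∀ μ → IsStrategy μ → IsRegionallyConstant μ → Acc _⊏_ (code μ) → Terminates μ
  termination μ str con (acc rs) = terminates str con (evaluated str) next
    where
    next : ∀ T D → Evaluation μ T D → ¬ IsFixed μ T D → Terminates (Improve μ T D)
    next T D ev _ = from-symbolic (symbolic ev)
      where
      μ′ : Assignment
      μ′ = Improve μ T D
      from-symbolic : (∃ λ W → Represents W T D × Solves (𝓜 ↾ μ) W) → Terminates μ′
      from-symbolic (W , rep , sol) = cases em
        where
        str′ : IsStrategy μ′
        str′ = improve-strategy {μ} W rep
        con′ : IsRegionallyConstant μ′
        con′ = improve-constant {μ} W rep con
        W′ : Valuing
        W′ = proj₁ (solved str′)
        sol′ : Solves (𝓜 ↾ μ′) W′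
        sol′ = proj₂ (solved str′)
        improves : ∀ {W″} → Solves (𝓜 ↾ μ′) W″ → W″ ≼ W
        improves {W″} sol″ =
          solution-least {W = W} {W′ = W″} (↾⊆𝓜 μ′) (improve-bounding {μ} W rep str sol) sol″
        cases : Dec (W ≼ W′) → Terminates μ′
        cases (no W⋠W′) = termination μ′ str′ con′
          (rs (W′ , W , solution-of μ′ con′ ≡.refl sol′ , solution-of μ con ≡.refl sol ,
            improves sol′ , W⋠W′))
        -- The value did not drop, so every evaluation of the new strategy, whatever its symbolic
        -- form `W″`, leaves the strategy fixed.
        cases (yes W≼W′) = terminates str′ con′ (evaluated str′) λ T′ D′ ev′ ¬fixed →
          contradiction (fixed T′ D′ (symbolic ev′)) ¬fixed
          where
          fixed : ∀ T′ D′ → (∃ λ W → Represents W T′ D′ × Solves (𝓜 ↾ μ′) W) → IsFixed μ′ T′ D′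
          fixed T′ D′ (W″ , rep″ , sol″) = stable {μ} {W = W} {W′ = W″} rep rep″
            (≼-trans {W} {W′} {W″} W≼W′
              (solved-unique (solution-of μ′ con′ ≡.refl sol′) (solution-of μ′ con′ ≡.refl sol″)))
            (improves sol″)

  -- In the subgraph Min has a single move at `s`; being fixed by the improvement, it is best among
  -- all moves from `s`, so the value it attains is the minimum. For Max both graphs offer the same
  -- moves.
  fixed⇒optimal : ∀ {μ T D} → IsRegionallyConstant μ → Evaluation μ T D → IsFixed μ T D →
    OptMinMax T D 𝓜
  fixed⇒optimal {μ} {T} {D} con ev fixed = proj₁ optimal , min (symbolic ev) , max
    where
    open Evaluation ev
    max : ∀ s → s ∈S → ¬ s ∈F → ownerOf s ≡ Max → IsMaxFrom T D 𝓜 s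
    max s s∈S s∉F o =
      let (m , (g , e) , same) , upper = proj₂ optimal s s∈S s∉F in
      (m , (proj₁ g , e) , same) ,
      λ m′ (g′ , e′) → upper m′ ((g′ , inj₁ (≡.trans (cong ownerOfRegion e′) o)) , e′)
    min : (∃ λ W → Represents W T D × Solves (𝓜 ↾ μ) W) → ∀ s → s ∈S → ¬ s ∈F → ownerOf s ≡ Min →
      IsMinFrom T D 𝓜 s
    min (W , rep , _) s s∈S s∉F o = attains (proj₁ (proj₂ optimal s s∈S s∉F))
      where
      st : MinState
      st = minState s s∈S o
      best : Best W (region s) (μ st)
      best = subst (Best W (region s)) (fixed st)
        (best⇒Best W T D rep s (improve-best {μ} W rep st))
      Min≢Max : Min ≢ Max
      Min≢Max ()
      is-played : ∀ m → (𝓜 ↾ μ) m → source m ≡ region s → μ st ≡ m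
      is-played m (_ , inj₁ max) e =
        contradiction (≡.trans (≡.sym o) (≡.trans (cong ownerOfRegion (≡.sym e)) max)) Min≢Max
      is-played m (_ , inj₂ (st′ , h , h′)) e =
        ≡.trans (con st st′ (≡.trans (≡.sym e) (≡.sym h))) h′
      attains : (∃ λ m → MovesFrom T D (𝓜 ↾ μ) s m × valueAt T D s ≈ˡᵉˣ moveValue T D s m) →
        IsMinFrom T D 𝓜 s
      attains (m , (g , e) , same) = (m , (proj₁ g , e) , same) , λ m′ (g′ , e′) →
        ⊑⇒≤ˡᵉˣ (W (region s)) (moveVal W m′) value (moveValue-represents W T D rep s m′ g′ e′)
          (⊑-trans (W (region s)) (moveVal W m) (moveVal W m′)
            (≈ˡᵉˣ⇒⊑ (W (region s)) (moveVal W m) value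
              (moveValue-represents W T D rep s m (proj₁ g) e) same)
            (proj₂ (subst (Best W (region s)) (is-played m g e) best) m′ (g′ , e′) s ≡.refl))
        where
        value : valueAt T D s ≈ˡᵉˣ ⟪ W (region s) ⟫ (val s)
        value = valueAt-represents W T D rep s s∈S

  correctness : ∀ {μ T D} → IsRegionallyConstant μ → Returns μ T D →
    OptMinMax T D 𝓜 × RegionallySimple T × RegionallyConstant D
  correctness con (return ev fixed) = fixed⇒optimal con ev fixed , Evaluation.simple ev ,
    Evaluation.constant ev
  correctness {μ} con (iterate ev _ returns) =
    let W , rep , _ = symbolic ev in correctness (improve-constant {μ} W rep con) returns

mainTheorem19 : (em : ExcludedMiddle 0ℓ) (ℝ : RealNumbers) (k : ℕ) (Γ : ReachabilityTimeGame ℝ k) →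
    let open TimedRegionGraph ℝ k Γ in
    NonBlocking → (Choose : Choice) →
    let open StrategyImprovement em ℝ k Γ Choose in
    (∃ λ μ₀ → IsStrategy μ₀ × IsRegionallyConstant μ₀) ×
    (∀ μ₀ → IsStrategy μ₀ → IsRegionallyConstant μ₀ →
    Terminates μ₀ ×
    (∀ T D → Returns μ₀ T D →
    OptMinMax T D 𝓜 × RegionallySimple T × RegionallyConstant D))
mainTheorem19 em ℝ k Γ nonBlocking Choose =
  initial , λ μ₀ str con → termination μ₀ str con (⊏-wellFounded (code μ₀)) , λ T D →
    correctness con
  where open Iteration em ℝ k Γ nonBlocking Choose
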